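{- Let $A$ be an associative unital $\mathbb K$-algebra. For every character $\Phi\in G_{NC}(A)$ there exists a unique infinitesimal character $\kappa\in g_{NC}(A)$ such that $$\Phi=e+\kappa\prec\Phi=\exp^\prec(\kappa),$$ and conversely, for every $\kappa\in g_{NC}(A)$, $\Phi:=\exp^\prec(\kappa)$ is a character; this gives a bijection $G_{NC}(A)\leftrightarrow g_{NC}(A)$. Moreover, if $\Phi$ and $\kappa$ are related in this way, then $$Sp^\ast(\Phi)=e+Sp^\ast(\kappa)\prec Sp^\ast(\Phi)=\exp^\prec(Sp^\ast(\kappa)).$$
   Context: $\mathbb K$ is a field of characteristic zero, $m_{\mathbb K}$ its multiplication. Double tensor algebra: $T(A)=\bigoplus_{n\ge1}A^{\otimes n}$ (words $a_1\cdots a_n$); for $S=\{s_1<\dots<s_k\}\subseteq[n]=\{1,\dots,n\}$, $a_S=a_{s_1}\cdots a_{s_k}$, $a_\emptyset=\mathbf 1$. $\overline T(T(A))=\bigoplus_{k\ge0}T(A)^{\otimes k}$ (bar notation, concatenation, unit $\mathbf 1$). Coproduct $\Delta(a_1\cdots a_n)=\sum_{S\subseteq[n]}a_S\otimes a_{J_1}|\cdots|a_{J_k}$ with $J_1,\dots,J_k$ the maximal sets of consecutive integers in $[n]\setminus S$ (empty bar word $=\mathbf 1$), extended multiplicatively; $\Delta^+_\prec$ is the sum over $S\ni1$, $\Delta^+_\succ$ over $S\not\ni1$; $\Delta_\prec(w)=\Delta^+_\prec(w)-w\otimes\mathbf 1$, $\Delta_\succ(w)=\Delta^+_\succ(w)-\mathbf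 1\otimes w$, $\Delta^+_\prec(w_1|\cdots|w_m)=\Delta^+_\prec(w_1)\Delta(w_2)\cdots\Delta(w_m)$ and likewise for $\succ$. Decorated non-crossing partitions: a partition of a finite $S\subset\mathbb N$ is non-crossing if there are no $p_1<q_1<p_2<q_2$ in $S$ with $p_1,p_2$ in one block and $q_1,q_2$ in another; $NC_n$ = non-crossing partitions of $[n]$, $\mathcal{NC}_n$ its span, $\mathcal{NC}(A)=\bigoplus_{n\ge1}\mathcal{NC}_n\otimes A^{\otimes n}$, graded by $n$. For blocks $B,C$ of $L$, $B<_LC$ iff $\inf C<m<\sup C$ for all $m\in B$; $L=Q\sqcup U$ (parts possibly empty) is admissible if no $B\in Q$, $C\in U$ satisfy $B<_LC$; then $J_1,\dots,J_k$ are the maximal sets of consecutive integers in $[n]\setminus\bigcup Q$, $J_i^{L,Q}$ the partition of $J_i$ by the blocks of $U$ in it, $a_Q=a_{\bigcup Q}$, $a_{J_i^{L,Q}}=a_{J_i}$; $st$ is the increasing bijection of a finite set onto $[m]$, applied to partitions by transport. $\overline T(\mathcal{NC}(A))$ is the unital tensor algebra with coproduct $\Delta(L\otimes a_1\cdots a_n)=\sum_{L=Q\sqcup U\text{ adm}}(st(Q)\otimes a_Q)\otimes(st(J_1^{L,Q})\otimes a_{J_1^{L,Q}}|\cdots|st(J_k^{L,Q})\otimes a_{J_k^{L,Q}})$, extended multiplicatively; $\Delta^+_\prec$ (resp. $\Delta^+_\succ$) restricts the sum to decompositions in which the block containing $1$ lies in $Q$ (resp. $U$), and $\Delta_\prec,\Delta_\succ$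 are obtained as for $\overline T(T(A))$. Splitting map: $Sp(a_1\cdots a_n)=\sum_{L\in NC_n}L\otimes(a_1\cdots a_n)$, extended by $Sp(A_1|\cdots|A_k)=Sp(A_1)|\cdots|Sp(A_k)$, $Sp(\mathbf 1)=\mathbf 1$; $Sp^\ast(f)=f\circ Sp$. On $\mathrm{Lin}(\overline T(H),\mathbb K)$ ($H=T(A)$ or $\mathcal{NC}(A)$): $f\prec g=m_{\mathbb K}(f\otimes g)\Delta_\prec$, $f\succ g=m_{\mathbb K}(f\otimes g)\Delta_\succ$ on $T(H)$; the unit $e$ vanishes on $T(H)$ and is $1$ on $\mathbf 1$, with $f\prec e=f=e\succ f$, $e\prec f=0=f\succ e$ for $f$ vanishing on $\mathbf 1$. $\kappa^{\prec0}=e$, $\kappa^{\prec n}=\kappa\prec\kappa^{\prec(n-1)}$, $\exp^\prec(\kappa)=\sum_{n\ge0}\kappa^{\prec n}$ (a finite sum in each degree). A character is a linear form $\Phi$ on $\overline T(H)$ with $\Phi(\mathbf 1)=1$ and $\Phi(a|b)=\Phi(a)\Phi(b)$ for $a,b\in T(H)$; an infinitesimal character is $\kappa$ with $\kappa(\mathbf 1)=0$ and $\kappa(a|b)=0$ for $a,b\in T(H)$. $G_{NC}(A)$, $g_{NC}(A)$ denote characters and infinitesimal characters on $\overline T(\mathcal{NC}(A))$. -}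

module Defs where

open import Level using (Level; _⊔_; suc)
open import Data.Bool.Base using (Bool; true; false; _∧_; not; if_then_else_; T)
open import Data.Nat.Base as ℕ using (ℕ; zero; _≤ᵇ_; _<ᵇ_; _≡ᵇ_; _⊓_)
  renaming (suc to 1+)
open import Data.Maybe.Base using (Maybe; just; nothing)
open import Data.Product.Base using (Σ; ∃; _×_; _,_; proj₁; proj₂)
open import Data.List.Base
  using (List; []; _∷_; _++_; map; foldr; length; upTo; concatMap; zip; zipWith; null)
open import Data.List.Relation.Unary.All using (All)
open import Data.List.Relation.Binary.Pointwise using (Pointwise)
open import Relation.Nullary using (¬_)
open import Relation.Binary.PropositionalEquality using (_≡_)
open import Algebra.Bundles using (CommutativeRing)
open import Algebra.Module.Bundles using (Module)
open import Algebra.Core using (Op₂)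

record Field (c ℓ : Level) : Set (suc (c ⊔ ℓ)) where
  field
    commutativeRing : CommutativeRing c ℓ
  open CommutativeRing commutativeRing public
  field
    1≉0     : ¬ (1# ≈ 0#)
    inverse : ∀ x → ¬ (x ≈ 0#) → ∃ λ y → (x * y) ≈ 1#

module _ {c ℓ} (K : Field c ℓ) where
  open Field K

  natK : ℕ → Carrier
  natK zero   = 0#
  natK (1+ n) = 1# + natK n

  CharZero : Set ℓ
  CharZero = ∀ n → ¬ (natK (1+ n) ≈ 0#)

record KAlgebra {c ℓ} (K : Field c ℓ) (a ℓa : Level) : Set (c ⊔ ℓ ⊔ suc (a ⊔ ℓa)) where
  open Field K using (commutativeRing; Carrier)
  field
    vectorSpace : Module commutativeRing a ℓa
  open Module vectorSpace public
  field
    _∙_       : Op₂ Carrierᴹ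
    1ᴬ        : Carrierᴹ
    ∙-cong    : ∀ {x x' y y'} → x ≈ᴹ x' → y ≈ᴹ y' → (x ∙ y) ≈ᴹ (x' ∙ y')
    ∙-assoc   : ∀ x y z → ((x ∙ y) ∙ z) ≈ᴹ (x ∙ (y ∙ z))
    ∙-identityˡ : ∀ x → (1ᴬ ∙ x) ≈ᴹ x
    ∙-identityʳ : ∀ x → (x ∙ 1ᴬ) ≈ᴹ x
    ∙-distribˡ : ∀ x y z → (x ∙ (y +ᴹ z)) ≈ᴹ ((x ∙ y) +ᴹ (x ∙ z))
    ∙-distribʳ : ∀ x y z → ((y +ᴹ z) ∙ x) ≈ᴹ ((y ∙ x) +ᴹ (z ∙ x))
    ∙-*ₗˡ : ∀ (r : Carrier) x y → ((r *ₗ x) ∙ y) ≈ᴹ (r *ₗ (x ∙ y))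
    ∙-*ₗʳ : ∀ (r : Carrier) x y → (x ∙ (r *ₗ y)) ≈ᴹ (r *ₗ (x ∙ y))

module _ {x} {X : Set x} where

  keep : (X → Bool) → List X → List X
  keep p []       = []
  keep p (y ∷ ys) = if p y then y ∷ keep p ys else keep p ys

  sel : List Bool → List X → List X
  sel (true  ∷ m) (y ∷ ys) = y ∷ sel m ys
  sel (false ∷ m) (y ∷ ys) = sel m ys
  sel _           _        = []

  close : List X → List (List X)
  close []       = []
  close (y ∷ ys) = (y ∷ ys) ∷ []

  runsAux : List (Bool × X) → List X → List (List X)
  runsAux []                 cur = close cur
  runsAux ((true  , y) ∷ r)  cur = close cur ++ runsAux r []
  runsAux ((false , y) ∷ r)  cur = runsAux r (cur ++ y ∷ [])

  runs : List Bool → List X → List (List X)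
  runs m ys = runsAux (zip m ys) []

  -- a word seen as an element of T̄: empty word ↦ 𝟏 (empty bar word)
  leftPart : List X → List (List X)
  leftPart = close

allB : ∀ {x} {X : Set x} → (X → Bool) → List X → Bool
allB p []       = true
allB p (y ∷ ys) = p y ∧ allB p ys

masks : ℕ → List (List Bool)
masks zero   = [] ∷ []
masks (1+ n) = map (true ∷_) (masks n) ++ map (false ∷_) (masks n)

-- Set partitions of [n], encoded canonically as restricted growth
-- strings: the i-th entry is the index of the block containing i, blocks
-- being numbered in order of their minima.

at : List ℕ → ℕ → ℕ
at []       _      = 0
at (x ∷ xs) zero   = x
at (x ∷ xs) (1+ i) = at xs i

rgsAux : ℕ → List ℕ → Bool
rgsAux k []       = true
rgsAux k (x ∷ xs) = (x ≤ᵇ k) ∧ rgsAux (if x ≡ᵇ k then 1+ k else k) xs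

isRGS : List ℕ → Bool
isRGS = rgsAux 0

nonCrossing : List ℕ → Bool
nonCrossing ls =
  allB (λ i → allB (λ j → allB (λ k → allB (λ l →
    not ((i <ᵇ j) ∧ (j <ᵇ k) ∧ (k <ᵇ l) ∧ (at ls i ≡ᵇ at ls k)
         ∧ (at ls j ≡ᵇ at ls l) ∧ not (at ls i ≡ᵇ at ls j)))
    is) is) is) is
  where is = upTo (length ls)

rgsList : ℕ → ℕ → List (List ℕ)
rgsList zero   k = [] ∷ []
rgsList (1+ n) k =
  concatMap (λ x → map (x ∷_) (rgsList n (if x ≡ᵇ k then 1+ k else k))) (upTo (1+ k))

ncParts : ℕ → List (List ℕ)
ncParts n = keep nonCrossing (rgsList n 0)

idx : ℕ → List ℕ → Maybe ℕ
idx l []       = nothing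
idx l (y ∷ ys) = if l ≡ᵇ y then just 0 else mapS (idx l ys)
  where
  mapS : Maybe ℕ → Maybe ℕ
  mapS (just j) = just (1+ j)
  mapS nothing  = nothing

dedup : List ℕ → List ℕ
dedup []       = []
dedup (y ∷ ys) = y ∷ keep (λ z → not (y ≡ᵇ z)) (dedup ys)

minL maxL : List ℕ → ℕ
minL []       = 0
minL (y ∷ ys) = foldr _⊓_ y ys
maxL []       = 0
maxL (y ∷ ys) = foldr ℕ._⊔_ y ys

module Setup {c ℓ a ℓa} (K : Field c ℓ) (A : KAlgebra K a ℓa) where
  open Field K
  open KAlgebra A using (Carrierᴹ; _≈ᴹ_; _+ᴹ_; _*ₗ_)

  Σ[_]_ : ∀ {y} {Y : Set y} → List Y → (Y → Carrier) → Carrier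
  Σ[ ys ] f = foldr (λ z s → f z + s) 0# ys

  -- Generic unital "tensor algebra over letters" with a coproduct given
  -- on letters; linear forms on T̄(H) are represented by their values on
  -- pure tensors (bar words of letters).

  module Dendriform {L : Set a}
    (δ⁺≺ : L → List (List L × List L))
    (δ   : L → List (List L × List L))
    (len : L → ℕ)
    where

    Form : Set (a ⊔ c)
    Form = List L → Carrier

    mult : List (List L × List L) → List (List L × List L) → List (List L × List L)
    mult xs ys = concatMap (λ p → map (λ q → (proj₁ p ++ proj₁ q , proj₂ p ++ proj₂ q)) ys) xs

    Δ : List L → List (List L × List L)
    Δ []      = ([] , []) ∷ []
    Δ (l ∷ w) = mult (δ l) (Δ w)

    Δ⁺≺ : List L → List (List L × List L)
    Δ⁺≺ []      = []
    Δ⁺≺ (l ∷ w) = mult (δ⁺≺ l) (Δ w)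

    e : Form
    e []      = 1#
    e (_ ∷ _) = 0#

    _⊕_ : Form → Form → Form
    (f ⊕ g) w = f w + g w

    -- f ≺ g = m_K (f ⊗ g) Δ_≺ on T(H), Δ_≺(w) = Δ⁺_≺(w) - w ⊗ 𝟏
    _≺ᵃ_ : Form → Form → Form
    (f ≺ᵃ g) []      = 0#
    (f ≺ᵃ g) (l ∷ w) =
      (Σ[ Δ⁺≺ (l ∷ w) ] λ p → f (proj₁ p) * g (proj₂ p)) - f (l ∷ w) * g []

    bar : Form → Form
    bar f w = f w - f [] * e w

    -- unital extension following the conventions f ≺ e = f, e ≺ f = 0
    -- (for f vanishing on 𝟏): with f = f(𝟏)e + f̄, g = g(𝟏)e + ḡ,
    -- f ≺ g = f̄ ≺ ḡ + g(𝟏) f̄   (e ≺ e is not defined in the paper and is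
    -- never used below, since κ(𝟏) = 0).
    _≺_ : Form → Form → Form
    (f ≺ g) w = (bar f ≺ᵃ bar g) w + g [] * bar f w

    pow≺ : Form → ℕ → Form
    pow≺ κ zero   = e
    pow≺ κ (1+ n) = κ ≺ pow≺ κ n

    deg : List L → ℕ
    deg w = foldr (λ l n → len l ℕ.+ n) 0 w

    -- exp^≺(κ) = Σ_n κ^{≺n}; for κ(𝟏) = 0, κ^{≺n} vanishes in degree < n,
    -- so in degree d the sum is over n ≤ d.
    exp≺ : Form → Form
    exp≺ κ w = Σ[ upTo (1+ (deg w)) ] λ n → pow≺ κ n w

  -- T̄(T(A)): letters are non-empty words a₁⋯aₙ over A

  TLetter : Set a
  TLetter = List Carrierᴹ

  TWord : Set a
  TWord = List TLetter

  splitT : List Bool → TLetter → TWord × TWord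
  splitT m l = (leftPart (sel m l) , runs m l)

  δT : TLetter → List (TWord × TWord)
  δT l = map (λ m → splitT m l) (masks (length l))

  δ⁺≺T : TLetter → List (TWord × TWord)
  δ⁺≺T []       = []
  δ⁺≺T (x ∷ xs) = map (λ m → splitT (true ∷ m) (x ∷ xs)) (masks (length xs))

  module TD = Dendriform δ⁺≺T δT length

  ValidT : TWord → Set a
  ValidT w = All (λ l → T (not (null l))) w

  _≈T_ : TD.Form → TD.Form → Set (a ⊔ ℓ)
  f ≈T g = ∀ w → ValidT w → f w ≈ g w

  -- T̄(NC(A)): a letter L ⊗ a₁⋯aₙ is the list of pairs (block of i, aᵢ)

  NCLetter : Set a
  NCLetter = List (ℕ × Carrierᴹ)

  NCWord : Set a
  NCWord = List NCLetter

  labels : NCLetter → List ℕ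
  labels = map proj₁

  validNC : NCLetter → Bool
  validNC xs = not (null xs) ∧ isRGS (labels xs) ∧ nonCrossing (labels xs)

  ValidNC : NCWord → Set a
  ValidNC w = All (λ l → T (validNC l)) w

  stAux : List ℕ → NCLetter → NCLetter
  stAux seen []              = []
  stAux seen ((l , x) ∷ r) with idx l seen
  ... | just j  = (j , x) ∷ stAux seen r
  ... | nothing = (length seen , x) ∷ stAux (seen ++ l ∷ []) r

  st : NCLetter → NCLetter
  st = stAux []

  blocksOf : NCLetter → List ℕ
  blocksOf xs = dedup (labels xs)

  inQ : List Bool → List ℕ → ℕ → Bool
  inQ (b ∷ q) (l' ∷ bs) l = if l ≡ᵇ l' then b else inQ q bs l
  inQ _       _         l = false

  positions : ℕ → NCLetter → List ℕ
  positions b xs = map proj₁ (keep (λ p → proj₂ p ≡ᵇ b) (zip (upTo (length xs)) (labels xs)))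

  nestedIn : NCLetter → ℕ → ℕ → Bool
  nestedIn xs b c' =
    allB (λ i → (minL pc <ᵇ i) ∧ (i <ᵇ maxL pc)) (positions b xs)
    where pc = positions c' xs

  admissible : NCLetter → List Bool → Bool
  admissible xs q =
    allB (λ b → allB (λ c' → not (inQ q bs b ∧ not (inQ q bs c') ∧ nestedIn xs b c')) bs) bs
    where bs = blocksOf xs

  posMask : List Bool → NCLetter → List Bool
  posMask q xs = map (λ p → inQ q (blocksOf xs) (proj₁ p)) xs

  splitNC : List Bool → NCLetter → NCWord × NCWord
  splitNC q xs = (leftPart (st (sel m xs)) , map st (runs m xs))
    where m = posMask q xs

  admMasks : NCLetter → List (List Bool)
  admMasks xs = keep (admissible xs) (masks (length (blocksOf xs)))

  δNC : NCLetter → List (NCWord × NCWord)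
  δNC xs = map (λ q → splitNC q xs) (admMasks xs)

  δ⁺≺NC : NCLetter → List (NCWord × NCWord)
  δ⁺≺NC []            = []
  δ⁺≺NC ((l , x) ∷ r) =
    map (λ q → splitNC q ((l , x) ∷ r))
        (keep (λ q → inQ q (blocksOf ((l , x) ∷ r)) l) (admMasks ((l , x) ∷ r)))

  module NCD = Dendriform δ⁺≺NC δNC length

  _≈NC_ : NCD.Form → NCD.Form → Set (a ⊔ ℓ)
  f ≈NC g = ∀ w → ValidNC w → f w ≈ g w

  -- linear forms on T̄(NC(A)): multilinear in every A-entry and
  -- compatible with the equality of A
  slot : NCWord → NCLetter → ℕ → NCLetter → NCWord → Carrierᴹ → NCWord
  slot pre ps l qs post z = pre ++ (ps ++ (l , z) ∷ qs) ∷ post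

  EntryEq : NCWord → NCWord → Set (a ⊔ ℓa)
  EntryEq = Pointwise (Pointwise (λ p q → proj₁ p ≡ proj₁ q × proj₂ p ≈ᴹ proj₂ q))

  record IsLinearNC (f : NCD.Form) : Set (c ⊔ a ⊔ ℓ ⊔ ℓa) where
    field
      cong     : ∀ w w' → ValidNC w → EntryEq w w' → f w ≈ f w'
      additive : ∀ pre ps l qs post x y → ValidNC (slot pre ps l qs post x) →
                 f (slot pre ps l qs post (x +ᴹ y))
                   ≈ f (slot pre ps l qs post x) + f (slot pre ps l qs post y)
      homogeneous : ∀ pre ps l qs post (r : Carrier) x → ValidNC (slot pre ps l qs post x) →
                 f (slot pre ps l qs post (r *ₗ x)) ≈ r * f (slot pre ps l qs post x)

  record IsCharacter (Φ : NCD.Form) : Set (c ⊔ a ⊔ ℓ ⊔ ℓa) where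
    field
      linear : IsLinearNC Φ
      unit   : Φ [] ≈ 1#
      mult   : ∀ x u y v → ValidNC ((x ∷ u) ++ (y ∷ v)) →
               Φ ((x ∷ u) ++ (y ∷ v)) ≈ Φ (x ∷ u) * Φ (y ∷ v)

  record IsInfChar (κ : NCD.Form) : Set (c ⊔ a ⊔ ℓ ⊔ ℓa) where
    field
      linear : IsLinearNC κ
      unit   : κ [] ≈ 0#
      mult   : ∀ x u y v → ValidNC ((x ∷ u) ++ (y ∷ v)) →
               κ ((x ∷ u) ++ (y ∷ v)) ≈ 0#

  choices : TWord → List (List (List ℕ))
  choices []      = [] ∷ []
  choices (l ∷ w) = concatMap (λ L → map (L ∷_) (choices w)) (ncParts (length l))

  -- Sp(w₁|…|w_k) as the list of its terms
  Sp : TWord → List NCWord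
  Sp w = map (λ Ls → zipWith zip Ls w) (choices w)

  Sp* : NCD.Form → TD.Form
  Sp* f w = Σ[ Sp w ] f

{-# OPTIONS --safe #-}

-- For an infinitesimal character κ, (κ ≺ F)(l | w) = Σ κ(Q) F(J | w) over the terms Q ⊗ J of Δ⁺≺(l).
-- As deg J < deg l, the equation F = e + κ ≺ F determines F by recursion on the degree; its solution
-- is exp≺(κ) and is multiplicative. Conversely the term Q = l, J = 𝟏 lets one solve the equation for
-- κ(l) by recursion on the length of l.
--
-- The splitting map intertwines the two coproducts Δ⁺≺: a non-crossing partition of [n] with an
-- admissible decomposition Q ⊔ U is the same thing as S = ⋃Q together with non-crossing partitions
-- of S and of the gaps of S, because a block of U meeting two gaps would have an element s of S
-- between two of its elements, and by non-crossingness the block of s would be nested in it.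
-- Hence Sp* turns a solution for Φ and κ into one for Sp*Φ and Sp*κ.

module Submission where

open import Defs
open import Level using (Level; _⊔_)
open import Function.Base using (_∘_; id; case_of_)
open import Function.Bundles using (Equivalence; mk⇔)
open import Data.Bool.Base using (Bool; true; false; _∧_; not; if_then_else_; T)
open import Data.Bool.Properties using (T-∧; T-≡; T?)
open import Data.Unit.Base using (tt)
open import Data.Empty using (⊥; ⊥-elim)
open import Data.Maybe.Base using (just; nothing)
open import Data.Nat.Base as ℕ using (ℕ; zero; suc; _≤_; _<_; z≤n; s≤s; _≤ᵇ_; _<ᵇ_; _≡ᵇ_; _⊓_)
open import Data.Nat.ListAction using (sum)
import Data.Nat.Properties as ℕₚ
open import Data.Product.Base using (Σ; ∃; _×_; _,_; proj₁; proj₂; map₂)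
import Data.Product.Properties as Productₚ
open import Data.Sum.Base using (_⊎_; inj₁; inj₂)
open import Data.List.Base
  using (List; []; _∷_; _++_; map; foldr; length; upTo; applyUpTo; concatMap; zip; zipWith; drop; filter; null)
import Data.List.Properties as Listₚ
open import Data.List.Membership.Propositional using (_∈_; _∉_)
open import Data.List.Membership.Propositional.Properties
  using (∈-filter⁺; ∈-filter⁻; ∈-upTo⁺; ∈-upTo⁻; ∈-map⁺; ∈-map⁻; ∈-++⁺ˡ; ∈-++⁺ʳ; ∈-++⁻)
open import Data.List.Membership.Propositional.Properties.WithK using (unique∧set⇒bag)
open import Data.List.Relation.Unary.Any using (here; there)
open import Data.List.Relation.Unary.All as All using (All; []; _∷_)
import Data.List.Relation.Unary.All.Properties as Allₚ
open import Data.List.Relation.Unary.AllPairs using ([]; _∷_)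
open import Data.List.Relation.Unary.Unique.Propositional using (Unique)
import Data.List.Relation.Unary.Unique.Propositional.Properties as Uniqueₚ
open import Data.List.Relation.Binary.BagAndSetEquality using (∼bag⇒↭)
open import Data.List.Relation.Binary.Permutation.Propositional as Perm using (_↭_)
open import Data.List.Relation.Binary.Pointwise as Pointwise using (Pointwise; []; _∷_)
open import Data.List.Relation.Binary.Sublist.Propositional
  using (_⊆_; []; _∷_; _∷ʳ_; ⊆-trans; ⊆-refl; lookup; from∈)
import Data.List.Relation.Binary.Sublist.Propositional.Properties as Sublistₚ
open import Relation.Nullary using (yes; no; does)
open import Relation.Binary.Definitions using (DecidableEquality; tri<; tri≈; tri>)
open import Relation.Binary.PropositionalEquality
  using (_≡_; _≢_; refl; sym; trans; cong; cong₂; subst; subst₂; module ≡-Reasoning)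
import Relation.Binary.Reasoning.Setoid as SetoidReasoning
import Algebra.Properties.CommutativeSemigroup as CommSemiₚ
import Algebra.Properties.Ring as Ringₚ

-- Restricted growth strings make equal partitions equal lists, but each restriction to a set of
-- positions must be renumbered. Renumbering by `rg` keeps exactly the information which positions
-- share a label, so partitions are compared through kernels (`SameKernel`) and not through label
-- values. The obstacle is the bijection between cut partitions and their pieces. Instead of inverse
-- functions, both sides are enumerated as lists of the same kind of triples (`headCuts`,
-- `headPieces`); these are duplicate-free and have the same members, hence are permutations of each
-- other, and sums over them agree. The recursion on the degree needs of a coproduct only a grading
-- and two counit laws. These are collected in `Unshuffle`, so one argument serves both tensor
-- algebras. Forms are bare functions on words: equations are relative to valid words, and
-- multilinearity in the entries from `A` is established separately.

T∧⁻ : ∀ {x y} → T (x ∧ y) → T x × T y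
T∧⁻ = Equivalence.to T-∧

T∧⁺ : ∀ {x y} → T x → T y → T (x ∧ y)
T∧⁺ p q = Equivalence.from T-∧ (p , q)

T⇒≡ : ∀ {x} → T x → x ≡ true
T⇒≡ = Equivalence.to T-≡

≡⇒T : ∀ {x} → x ≡ true → T x
≡⇒T = Equivalence.from T-≡

T-not⁺ : ∀ {x} → (T x → ⊥) → T (not x)
T-not⁺ {true}  f = ⊥-elim (f tt)
T-not⁺ {false} f = tt

T-not⁻ : ∀ {x} → T (not x) → T x → ⊥
T-not⁻ {false} _ ()

≢true⇒≡false : ∀ {x} → x ≢ true → x ≡ false
≢true⇒≡false {true}  p = ⊥-elim (p refl)
≢true⇒≡false {false} p = refl

≡ᵇ-refl : ∀ n → (n ≡ᵇ n) ≡ true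
≡ᵇ-refl n = T⇒≡ (ℕₚ.≡⇒≡ᵇ n n refl)

≢⇒≡ᵇ-false : ∀ {m n} → m ≢ n → (m ≡ᵇ n) ≡ false
≢⇒≡ᵇ-false {m} {n} p = ≢true⇒≡false (p ∘ ℕₚ.≡ᵇ⇒≡ m n ∘ ≡⇒T)

-- Membership, uniqueness and sublists

module _ {x} {X : Set x} where

  allB⁻ : ∀ (p : X → Bool) xs → T (allB p xs) → ∀ {y} → y ∈ xs → T (p y)
  allB⁻ p (y ∷ ys) t (here refl) = proj₁ (T∧⁻ t)
  allB⁻ p (y ∷ ys) t (there i)   = allB⁻ p ys (proj₂ (T∧⁻ {p y} t)) i

  allB⁺ : ∀ (p : X → Bool) xs → (∀ {y} → y ∈ xs → T (p y)) → T (allB p xs)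
  allB⁺ p []       h = tt
  allB⁺ p (y ∷ ys) h = T∧⁺ (h (here refl)) (allB⁺ p ys (h ∘ there))

  keep≡filter : ∀ (p : X → Bool) xs → keep p xs ≡ filter (T? ∘ p) xs
  keep≡filter p []       = refl
  keep≡filter p (y ∷ ys) with p y
  ... | true  = cong (y ∷_) (keep≡filter p ys)
  ... | false = keep≡filter p ys

  ∈-keep⁺ : ∀ (p : X → Bool) {y xs} → y ∈ xs → T (p y) → y ∈ keep p xs
  ∈-keep⁺ p {y} {xs} i t = subst (y ∈_) (sym (keep≡filter p xs)) (∈-filter⁺ (T? ∘ p) i t)

  ∈-keep⁻ : ∀ (p : X → Bool) {y} xs → y ∈ keep p xs → y ∈ xs × T (p y)
  ∈-keep⁻ p {y} xs i = ∈-filter⁻ (T? ∘ p) (subst (y ∈_) (keep≡filter p xs) i)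

  keep-unique : ∀ (p : X → Bool) {xs} → Unique xs → Unique (keep p xs)
  keep-unique p {xs} u = subst Unique (sym (keep≡filter p xs)) (Uniqueₚ.filter⁺ (T? ∘ p) u)

module _ {x} {X : Set x} where

  ∉-∷ : ∀ {y : X} {xs} → Unique (y ∷ xs) → y ∉ xs
  ∉-∷ = Uniqueₚ.Unique[x∷xs]⇒x∉xs

  unique-∷ : ∀ {y : X} {xs} → y ∉ xs → Unique xs → Unique (y ∷ xs)
  unique-∷ {y} h u = All.tabulate (λ i e → h (subst (_∈ _) (sym e) i)) ∷ u

  unique-tail : ∀ {y : X} {xs} → Unique (y ∷ xs) → Unique xs
  unique-tail (_ ∷ u) = u

  ∈-pair : ∀ {y z : X} {xs} → y ∈ xs → z ∈ xs →
           (y ≡ z) ⊎ ((y ∷ z ∷ []) ⊆ xs) ⊎ ((z ∷ y ∷ []) ⊆ xs)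
  ∈-pair (here refl) (here refl) = inj₁ refl
  ∈-pair (here refl) (there j)   = inj₂ (inj₁ (refl ∷ from∈ j))
  ∈-pair (there i)   (here refl) = inj₂ (inj₂ (refl ∷ from∈ i))
  ∈-pair (there i)   (there j)   with ∈-pair i j
  ... | inj₁ e        = inj₁ e
  ... | inj₂ (inj₁ s) = inj₂ (inj₁ (_ ∷ʳ s))
  ... | inj₂ (inj₂ s) = inj₂ (inj₂ (_ ∷ʳ s))

module _ {x y} {X : Set x} {Y : Set y} where

  unique-map : ∀ {f : X → Y} {xs} → (∀ {u v} → u ∈ xs → v ∈ xs → f u ≡ f v → u ≡ v) →
               Unique xs → Unique (map f xs)
  unique-map {f} {[]}     h u = []
  unique-map {f} {w ∷ ws} h u = unique-∷ notin (unique-map (λ i j → h (there i) (there j)) (unique-tail u))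
    where
    notin : f w ∉ map f ws
    notin i with ∈-map⁻ f i
    ... | v , j , e = ∉-∷ u (subst (_∈ ws) (sym (h (here refl) (there j) e)) j)

  ∈-concatMap⁻ : ∀ (f : X → List Y) xs {z} → z ∈ concatMap f xs → ∃ λ w → w ∈ xs × z ∈ f w
  ∈-concatMap⁻ f (w ∷ ws) i with ∈-++⁻ (f w) i
  ... | inj₁ j = w , here refl , j
  ... | inj₂ j with ∈-concatMap⁻ f ws j
  ...   | v , k , l = v , there k , l

  ∈-concatMap⁺ : ∀ (f : X → List Y) {xs z w} → w ∈ xs → z ∈ f w → z ∈ concatMap f xs
  ∈-concatMap⁺ f {w ∷ ws} (here refl) j = ∈-++⁺ˡ j
  ∈-concatMap⁺ f {w ∷ ws} (there i)   j = ∈-++⁺ʳ (f w) (∈-concatMap⁺ f i j)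

  unique-concatMap : ∀ (f : X → List Y) {xs} → Unique xs → (∀ {w} → w ∈ xs → Unique (f w)) →
                     (∀ {v w z} → v ∈ xs → w ∈ xs → z ∈ f v → z ∈ f w → v ≡ w) →
                     Unique (concatMap f xs)
  unique-concatMap f {[]}     u h d = []
  unique-concatMap f {w ∷ ws} u h d =
    Uniqueₚ.++⁺ (h (here refl))
      (unique-concatMap f (unique-tail u) (h ∘ there) (λ i j → d (there i) (there j)))
      λ { (i , j) → let v , k , l = ∈-concatMap⁻ f ws j in
                    ∉-∷ u (subst (_∈ ws) (sym (d (here refl) (there k) i l)) k) }

  ⊆-map⁻ : ∀ (f : X → Y) {s} xs → s ⊆ map f xs → ∃ λ t → t ⊆ xs × s ≡ map f t
  ⊆-map⁻ f []       []         = [] , [] , refl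
  ⊆-map⁻ f (w ∷ ws) (_ ∷ʳ p)   with ⊆-map⁻ f ws p
  ... | t , q , e = t , w ∷ʳ q , e
  ⊆-map⁻ f (w ∷ ws) (refl ∷ p) with ⊆-map⁻ f ws p
  ... | t , q , e = w ∷ t , refl ∷ q , cong (f w ∷_) e

  map-≡⁻ : ∀ {z} {Z : Set z} {f : X → Z} {g : X → Z} {xs} → map f xs ≡ map g xs →
           ∀ {w} → w ∈ xs → f w ≡ g w
  map-≡⁻ {xs = w ∷ ws} e (here refl) = Listₚ.∷-injectiveˡ e
  map-≡⁻ {xs = w ∷ ws} e (there i)   = map-≡⁻ (Listₚ.∷-injectiveʳ e) i

map-cong-∈ : ∀ {x y} {X : Set x} {Y : Set y} {f g : X → Y} xs →
             (∀ {w} → w ∈ xs → f w ≡ g w) → map f xs ≡ map g xs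
map-cong-∈ []       h = refl
map-cong-∈ (w ∷ ws) h = cong₂ _∷_ (h (here refl)) (map-cong-∈ ws (h ∘ there))

-- Converts a sublist into increasing positions one element at a time; the offset `b` records that
-- the next position comes after the previous one.
at-drop : ∀ b (zs : List ℕ) {x s} → (x ∷ s) ⊆ drop b zs →
          ∃ λ i → b ≤ i × i < length zs × at zs i ≡ x × s ⊆ drop (suc i) zs
at-drop zero    (z ∷ zs) (_ ∷ʳ p)   with at-drop zero zs p
... | i , _ , l , e , q = suc i , z≤n , s≤s l , e , q
at-drop zero    (z ∷ zs) (refl ∷ p) = zero , z≤n , s≤s z≤n , refl , p
at-drop (suc b) (z ∷ zs) p          with at-drop b zs p
... | i , h , l , e , q = suc i , s≤s h , s≤s l , e , q

drop-at : ∀ b i (zs : List ℕ) {s} → b ≤ i → i < length zs → s ⊆ drop (suc i) zs →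
          (at zs i ∷ s) ⊆ drop b zs
drop-at zero    zero    (z ∷ zs) h l         p = refl ∷ p
drop-at zero    (suc i) (z ∷ zs) h (s≤s l)   p = z ∷ʳ drop-at zero i zs z≤n l p
drop-at (suc b) (suc i) (z ∷ zs) (s≤s h) (s≤s l) p = drop-at b i zs h l p

[]⊆ : ∀ {x} {X : Set x} {xs : List X} → [] ⊆ xs
[]⊆ {xs = []}     = []
[]⊆ {xs = x ∷ xs} = x ∷ʳ []⊆

∈⇒at : ∀ {x} (zs : List ℕ) → x ∈ zs → ∃ λ i → i < length zs × at zs i ≡ x
∈⇒at (z ∷ zs) (here refl) = zero , s≤s z≤n , refl
∈⇒at (z ∷ zs) (there p)   with ∈⇒at zs p
... | i , l , e = suc i , s≤s l , e

at∈ : ∀ (zs : List ℕ) i → i < length zs → at zs i ∈ zs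
at∈ (z ∷ zs) zero    l       = here refl
at∈ (z ∷ zs) (suc i) (s≤s l) = there (at∈ zs i l)

at-⊆₃ : ∀ (zs : List ℕ) {i j k} → i < j → j < k → k < length zs →
        (at zs i ∷ at zs j ∷ at zs k ∷ []) ⊆ zs
at-⊆₃ zs {i} {j} {k} p q l =
  drop-at 0 i zs z≤n (ℕₚ.<-trans p (ℕₚ.<-trans q l))
    (drop-at (suc i) j zs p (ℕₚ.<-trans q l) (drop-at (suc j) k zs q l []⊆))

⊆₃-at : ∀ (zs : List ℕ) {x y z} → (x ∷ y ∷ z ∷ []) ⊆ zs →
        ∃ λ i → ∃ λ j → ∃ λ k → i < j × j < k × k < length zs × at zs i ≡ x × at zs j ≡ y × at zs k ≡ z
⊆₃-at zs p with at-drop 0 zs p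
... | i , _ , _ , ei , p₁ with at-drop (suc i) zs p₁
...   | j , ij , _ , ej , p₂ with at-drop (suc j) zs p₂
...     | k , jk , l , ek , _ = i , j , k , ij , jk , l , ei , ej , ek

-- Non-crossing labellings

-- The condition `NonXPos` in terms of sublists instead of positions. Sublists compose, so this form
-- passes at once to selected subwords and to gaps.
NonX : ∀ {z} {Z : Set z} → (Z → ℕ) → List Z → Set z
NonX f zs = ∀ {x y z w} → (x ∷ y ∷ z ∷ w ∷ []) ⊆ zs → f x ≡ f z → f y ≡ f w → f x ≡ f y

NonXPos : List ℕ → Set
NonXPos ls = ∀ {i j k l} → i < j → j < k → k < l → l < length ls →
             at ls i ≡ at ls k → at ls j ≡ at ls l → at ls i ≡ at ls j

nonCrossing⇒pos : ∀ ls → T (nonCrossing ls) → NonXPos ls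
nonCrossing⇒pos ls t {i} {j} {k} {l} ij jk kl ll e₁ e₂ with at ls i ℕₚ.≟ at ls j
... | yes e = e
... | no ne = ⊥-elim (T-not⁻ t₄
        (T∧⁺ (ℕₚ.<⇒<ᵇ ij) (T∧⁺ (ℕₚ.<⇒<ᵇ jk) (T∧⁺ (ℕₚ.<⇒<ᵇ kl)
          (T∧⁺ (ℕₚ.≡⇒≡ᵇ _ _ e₁) (T∧⁺ (ℕₚ.≡⇒≡ᵇ _ _ e₂) (T-not⁺ (ne ∘ ℕₚ.≡ᵇ⇒≡ _ _))))))))
  where
  kl' = ℕₚ.<-trans kl ll
  jl' = ℕₚ.<-trans jk kl'
  t₁ = allB⁻ _ (upTo (length ls)) t (∈-upTo⁺ (ℕₚ.<-trans ij jl'))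
  t₂ = allB⁻ _ (upTo (length ls)) t₁ (∈-upTo⁺ jl')
  t₃ = allB⁻ _ (upTo (length ls)) t₂ (∈-upTo⁺ kl')
  t₄ = allB⁻ _ (upTo (length ls)) t₃ (∈-upTo⁺ ll)

pos⇒nonCrossing : ∀ ls → NonXPos ls → T (nonCrossing ls)
pos⇒nonCrossing ls h =
  allB⁺ _ is λ {i} _ → allB⁺ _ is λ {j} _ → allB⁺ _ is λ {k} _ → allB⁺ _ is λ {l} ll →
    T-not⁺ λ t →
      let ij , t = T∧⁻ t; jk , t = T∧⁻ t; kl , t = T∧⁻ t; e₁ , t = T∧⁻ t; e₂ , t = T∧⁻ t in
      T-not⁻ t (ℕₚ.≡⇒≡ᵇ _ _ (h (ℕₚ.<ᵇ⇒< i j ij) (ℕₚ.<ᵇ⇒< j k jk) (ℕₚ.<ᵇ⇒< k l kl) (∈-upTo⁻ ll)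
        (ℕₚ.≡ᵇ⇒≡ _ _ e₁) (ℕₚ.≡ᵇ⇒≡ _ _ e₂)))
  where is = upTo (length ls)

pos⇒NonX : ∀ ls → NonXPos ls → NonX id ls
pos⇒NonX ls h p e₁ e₂ with at-drop 0 ls p
... | i , _ , _ , refl , p₁ with at-drop (suc i) ls p₁
...   | j , ij , _ , refl , p₂ with at-drop (suc j) ls p₂
...     | k , jk , _ , refl , p₃ with at-drop (suc k) ls p₃
...       | l , kl , ll , refl , _ = h ij jk kl ll e₁ e₂

NonX⇒pos : ∀ ls → NonX id ls → NonXPos ls
NonX⇒pos ls h {i} {j} {k} {l} ij jk kl ll =
  h (drop-at 0 i ls z≤n (ℕₚ.<-trans ij jl') (drop-at (suc i) j ls ij jl'
      (drop-at (suc j) k ls jk kl' (drop-at (suc k) l ls kl ll []⊆))))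
  where
  kl' = ℕₚ.<-trans kl ll
  jl' = ℕₚ.<-trans jk kl'

module _ {z} {Z : Set z} (f : Z → ℕ) where

  NonX-map⁺ : ∀ {zs} → NonX f zs → NonX id (map f zs)
  NonX-map⁺ {zs} h p e₁ e₂ with ⊆-map⁻ f zs p
  ... | _ ∷ _ ∷ _ ∷ _ ∷ [] , q , refl = h q e₁ e₂

  NonX-map⁻ : ∀ {zs} → NonX id (map f zs) → NonX f zs
  NonX-map⁻ h p = h (Sublistₚ.map⁺ f p)

nonCrossing⇒NonX : ∀ {z} {Z : Set z} (f : Z → ℕ) zs → T (nonCrossing (map f zs)) → NonX f zs
nonCrossing⇒NonX f zs t = NonX-map⁻ f (pos⇒NonX (map f zs) (nonCrossing⇒pos (map f zs) t))

NonX⇒nonCrossing : ∀ {z} {Z : Set z} (f : Z → ℕ) zs → NonX f zs → T (nonCrossing (map f zs))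
NonX⇒nonCrossing f zs h = pos⇒nonCrossing (map f zs) (NonX⇒pos (map f zs) (NonX-map⁺ f h))

-- Standardisation of labels

-- The label part of `stAux`, separated from the entries of the algebra; `stAux-zip` puts the two
-- together again.
rgAux : List ℕ → List ℕ → List ℕ
rgAux seen []      = []
rgAux seen (l ∷ r) with idx l seen
... | just j  = j ∷ rgAux seen r
... | nothing = length seen ∷ rgAux (seen ++ l ∷ []) r

rg : List ℕ → List ℕ
rg = rgAux []

module _ {x} {X : Set x} (_≟_ : DecidableEquality X) where

  position : List X → X → ℕ
  position []       y = 0
  position (z ∷ zs) y = if does (y ≟ z) then 0 else suc (position zs y)

  position-injective : ∀ zs {y w} → y ∈ zs → w ∈ zs → position zs y ≡ position zs w → y ≡ w
  position-injective (z ∷ zs) {y} {w} p q e with y ≟ z | w ≟ z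
  ... | yes a | yes b = trans a (sym b)
  position-injective (z ∷ zs) (here e) q _ | no a | no b = ⊥-elim (a e)
  position-injective (z ∷ zs) (there p) (here e) _ | no a | no b = ⊥-elim (b e)
  position-injective (z ∷ zs) (there p) (there q) e | no a | no b =
    position-injective zs p q (ℕₚ.suc-injective e)

-- The tail `t` is there because the list of seen labels grows to the right: the index of a label
-- already found must survive every later extension.
idx-just : ∀ l seen {j} t → idx l seen ≡ just j → position ℕₚ._≟_ (seen ++ t) l ≡ j × l ∈ seen × j < length seen
idx-just l (y ∷ ys) t e with l ≡ᵇ y in eq | idx l ys in eq'
idx-just l (y ∷ ys) t refl | true  | _ = refl , here (ℕₚ.≡ᵇ⇒≡ l y (≡⇒T eq)) , s≤s z≤n
idx-just l (y ∷ ys) t refl | false | just j with idx-just l ys t eq'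
... | a , b , c = cong suc a , there b , s≤s c

idx-nothing : ∀ l seen t → idx l seen ≡ nothing → l ∉ seen × position ℕₚ._≟_ (seen ++ l ∷ t) l ≡ length seen
idx-nothing l []       t e rewrite ≡ᵇ-refl l = (λ ()) , refl
idx-nothing l (y ∷ ys) t e with l ≡ᵇ y in eq | idx l ys in eq'
idx-nothing l (y ∷ ys) t e | false | nothing with idx-nothing l ys t eq'
... | a , b = (λ { (here refl) → case trans (sym eq) (≡ᵇ-refl l) of λ () ; (there p) → a p }) , cong suc b

idx-∉ : ∀ l seen → l ∉ seen → idx l seen ≡ nothing
idx-∉ l seen h with idx l seen in eq
... | nothing = refl
... | just j  = ⊥-elim (h (proj₁ (proj₂ (idx-just l seen [] eq))))

seenAfter : List ℕ → List ℕ → List ℕ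
seenAfter seen []      = seen
seenAfter seen (l ∷ r) with idx l seen
... | just j  = seenAfter seen r
... | nothing = seenAfter (seen ++ l ∷ []) r

seenAfter-++ : ∀ seen ls → ∃ λ t → seenAfter seen ls ≡ seen ++ t
seenAfter-++ seen []      = [] , sym (Listₚ.++-identityʳ seen)
seenAfter-++ seen (l ∷ r) with idx l seen
... | just j  = seenAfter-++ seen r
... | nothing with seenAfter-++ (seen ++ l ∷ []) r
...   | t , e = l ∷ t , trans e (Listₚ.++-assoc seen (l ∷ []) t)

⊆seenAfter : ∀ seen ls {l} → l ∈ seen → l ∈ seenAfter seen ls
⊆seenAfter seen ls {l} p with seenAfter-++ seen ls
... | t , e = subst (l ∈_) (sym e) (∈-++⁺ˡ p)

∈seenAfter : ∀ seen ls {l} → l ∈ ls → l ∈ seenAfter seen ls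
∈seenAfter seen (l ∷ r) p with idx l seen in eq
∈seenAfter seen (l ∷ r) (here refl) | just j = ⊆seenAfter seen r (proj₁ (proj₂ (idx-just l seen [] eq)))
∈seenAfter seen (l ∷ r) (there p)   | just j = ∈seenAfter seen r p
∈seenAfter seen (l ∷ r) (here refl) | nothing = ⊆seenAfter (seen ++ l ∷ []) r (∈-++⁺ʳ seen (here refl))
∈seenAfter seen (l ∷ r) (there p)   | nothing = ∈seenAfter (seen ++ l ∷ []) r p

-- Numbering on the fly agrees with looking every label up in the final list of seen labels, since
-- that list is only ever extended on the right.
rgAux-map : ∀ seen ls → rgAux seen ls ≡ map (position ℕₚ._≟_ (seenAfter seen ls)) ls
rgAux-map seen []      = refl
rgAux-map seen (l ∷ r) with idx l seen in eq
... | just j  = cong₂ _∷_ (sym (trans (cong (λ s → position ℕₚ._≟_ s l) e) (proj₁ (idx-just l seen t eq))))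
                          (rgAux-map seen r)
  where
  t = proj₁ (seenAfter-++ seen r)
  e = proj₂ (seenAfter-++ seen r)
... | nothing = cong₂ _∷_ (sym (trans (cong (λ s → position ℕₚ._≟_ s l) (trans e (Listₚ.++-assoc seen (l ∷ []) t)))
                                      (proj₂ (idx-nothing l seen t eq))))
                          (rgAux-map (seen ++ l ∷ []) r)
  where
  t = proj₁ (seenAfter-++ (seen ++ l ∷ []) r)
  e = proj₂ (seenAfter-++ (seen ++ l ∷ []) r)

-- Replaces a pass with changing state by one function applied to all labels. Its injectivity on the
-- labels present is what lets kernels and non-crossingness pass through `rg`.
rg-relabel : ∀ ls → ∃ λ (ψ : ℕ → ℕ) → rg ls ≡ map ψ ls × (∀ {x y} → x ∈ ls → y ∈ ls → ψ x ≡ ψ y → x ≡ y)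
rg-relabel ls = position ℕₚ._≟_ (seenAfter [] ls) , rgAux-map [] ls ,
  λ p q → position-injective ℕₚ._≟_ (seenAfter [] ls) (∈seenAfter [] ls p) (∈seenAfter [] ls q)

length-rg : ∀ ls → length (rg ls) ≡ length ls
length-rg ls with rg-relabel ls
... | ψ , e , _ = trans (cong length e) (Listₚ.length-map ψ ls)

module _ {z} {Z : Set z} (f g : Z → ℕ) where

  -- With `f` and `g` read as labellings of the members of `zs`, this is equality of the two
  -- partitions whatever the names of the blocks.
  SameKernel : List Z → Set z
  SameKernel zs = ∀ {x y} → x ∈ zs → y ∈ zs → (f x ≡ f y → g x ≡ g y) × (g x ≡ g y → f x ≡ f y)

  idx-kernel : ∀ z zs → (∀ {y} → y ∈ zs → (f z ≡ f y → g z ≡ g y) × (g z ≡ g y → f z ≡ f y)) →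
               idx (f z) (map f zs) ≡ idx (g z) (map g zs)
  idx-kernel z []       h = refl
  idx-kernel z (y ∷ ys) h
    with f z ≡ᵇ f y in p | g z ≡ᵇ g y in q | idx (f z) (map f ys) | idx (g z) (map g ys) | idx-kernel z ys (h ∘ there)
  ... | true  | true  | _ | _ | refl = refl
  ... | false | false | just j  | _ | refl = refl
  ... | false | false | nothing | _ | refl = refl
  ... | true  | false | _ | _ | _
    with () ← trans (sym q) (T⇒≡ (ℕₚ.≡⇒≡ᵇ _ _ (proj₁ (h (here refl)) (ℕₚ.≡ᵇ⇒≡ _ _ (≡⇒T p)))))
  ... | false | true  | _ | _ | _
    with () ← trans (sym p) (T⇒≡ (ℕₚ.≡⇒≡ᵇ _ _ (proj₂ (h (here refl)) (ℕₚ.≡ᵇ⇒≡ _ _ (≡⇒T q)))))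

  -- Renumbering consults a label only by testing equality with those already seen, so it cannot
  -- distinguish labellings with the same kernel. For the induction `seen` consists of members of
  -- `Z`, of which both labellings take images.
  rgAux-kernel : ∀ seen zs → SameKernel (seen ++ zs) →
                 rgAux (map f seen) (map f zs) ≡ rgAux (map g seen) (map g zs)
  rgAux-kernel seen []       h = refl
  rgAux-kernel seen (z ∷ zs) h
    with idx (f z) (map f seen) | idx (g z) (map g seen)
       | idx-kernel z seen (λ i → h (∈-++⁺ʳ seen (here refl)) (∈-++⁺ˡ i))
  ... | just j  | _ | refl = cong (j ∷_) (rgAux-kernel seen zs λ i j → h (weaken i) (weaken j))
    where
    weaken : ∀ {x} → x ∈ seen ++ zs → x ∈ seen ++ z ∷ zs
    weaken i with ∈-++⁻ seen i
    ... | inj₁ j = ∈-++⁺ˡ j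
    ... | inj₂ j = ∈-++⁺ʳ seen (there j)
  ... | nothing | _ | refl =
    cong₂ _∷_ (trans (Listₚ.length-map f seen) (sym (Listₚ.length-map g seen)))
      (begin
        rgAux (map f seen ++ f z ∷ []) (map f zs)
          ≡⟨ cong (λ s → rgAux s (map f zs)) (sym (Listₚ.map-++ f seen (z ∷ []))) ⟩
        rgAux (map f (seen ++ z ∷ [])) (map f zs)
          ≡⟨ rgAux-kernel (seen ++ z ∷ []) zs (subst SameKernel (sym (Listₚ.++-assoc seen (z ∷ []) zs)) h) ⟩
        rgAux (map g (seen ++ z ∷ [])) (map g zs)
          ≡⟨ cong (λ s → rgAux s (map g zs)) (Listₚ.map-++ g seen (z ∷ [])) ⟩
        rgAux (map g seen ++ g z ∷ []) (map g zs) ∎)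
    where open ≡-Reasoning

  kernel⇒rg : ∀ zs → SameKernel zs → rg (map f zs) ≡ rg (map g zs)
  kernel⇒rg = rgAux-kernel []

  -- The relabellings `ψ` and `χ` take the same values along `zs` and are injective on the labels
  -- present, so an equality of labels can be carried from either side to the other.
  rg⇒kernel : ∀ zs → rg (map f zs) ≡ rg (map g zs) → SameKernel zs
  rg⇒kernel zs e {x} {y} i j with rg-relabel (map f zs) | rg-relabel (map g zs)
  ... | ψ , a , p | χ , b , q =
      (λ r → q (∈-map⁺ g i) (∈-map⁺ g j) (trans (sym (eq i)) (trans (cong ψ r) (eq j))))
    , (λ r → p (∈-map⁺ f i) (∈-map⁺ f j) (trans (eq i) (trans (cong χ r) (sym (eq j)))))
    where
    eq : ∀ {w} → w ∈ zs → ψ (f w) ≡ χ (g w)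
    eq = map-≡⁻ {Y = ℕ} (trans (Listₚ.map-∘ zs) (trans (sym a) (trans e (trans b (sym (Listₚ.map-∘ zs))))))

rgAux-RGS : ∀ seen ls → T (rgsAux (length seen) (rgAux seen ls))
rgAux-RGS seen []      = tt
rgAux-RGS seen (l ∷ r) with idx l seen in eq
... | just j with _ , _ , j<n ← idx-just l seen [] eq rewrite ≢⇒≡ᵇ-false (ℕₚ.<⇒≢ j<n) =
  T∧⁺ (ℕₚ.≤⇒≤ᵇ (ℕₚ.<⇒≤ j<n)) (rgAux-RGS seen r)
... | nothing rewrite ≡ᵇ-refl (length seen) =
  T∧⁺ (ℕₚ.≤⇒≤ᵇ (ℕₚ.≤-refl {length seen}))
      (subst (λ n → T (rgsAux n (rgAux (seen ++ l ∷ []) r)))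
             (trans (Listₚ.length-++ seen) (ℕₚ.+-comm (length seen) 1)) (rgAux-RGS (seen ++ l ∷ []) r))

rg-RGS : ∀ ls → T (isRGS (rg ls))
rg-RGS = rgAux-RGS []

-- Stated for an injective `f` because the tail of `upTo` is `applyUpTo suc`, which is no longer an
-- `upTo`.
idx-applyUpTo : ∀ (f : ℕ → ℕ) k x → (∀ i j → f i ≡ f j → i ≡ j) → x < k → idx (f x) (applyUpTo f k) ≡ just x
idx-applyUpTo f (suc k) zero    h p rewrite ≡ᵇ-refl (f 0) = refl
idx-applyUpTo f (suc k) (suc x) h (s≤s p)
  rewrite ≢⇒≡ᵇ-false {f (suc x)} {f 0} (λ e → ℕₚ.1+n≢0 (h _ _ e))
        | idx-applyUpTo (f ∘ suc) k x (λ i j e → ℕₚ.suc-injective (h _ _ e)) p = refl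

-- When 0, ..., k-1 have been seen in this order, a label below `k` is found at its own index, and
-- the growth condition forces a new label to be `k`, the number it would receive anyway.
RGS⇒rgAux : ∀ k ls → T (rgsAux k ls) → rgAux (upTo k) ls ≡ ls
RGS⇒rgAux k []       t = refl
RGS⇒rgAux k (x ∷ xs) t with x ≡ᵇ k in eq
... | true with refl ← ℕₚ.≡ᵇ⇒≡ x k (≡⇒T eq)
  rewrite idx-∉ k (upTo k) (λ i → ℕₚ.<-irrefl refl (∈-upTo⁻ i)) =
  cong₂ _∷_ (Listₚ.length-upTo k)
    (trans (cong (λ s → rgAux s xs) (Listₚ.upTo-∷ʳ k)) (RGS⇒rgAux (suc k) xs (proj₂ (T∧⁻ {k ≤ᵇ k} t))))
... | false
  rewrite idx-applyUpTo id k x (λ _ _ e → e)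
            (ℕₚ.≤∧≢⇒< (ℕₚ.≤ᵇ⇒≤ x k (proj₁ (T∧⁻ t))) λ { refl → case trans (sym eq) (≡ᵇ-refl k) of λ () }) =
  cong (x ∷_) (RGS⇒rgAux k xs (proj₂ (T∧⁻ {x ≤ᵇ k} t)))

RGS⇒rg : ∀ ls → T (isRGS ls) → rg ls ≡ ls
RGS⇒rg = RGS⇒rgAux 0

rg-NonX : ∀ {z} {Z : Set z} (f : Z → ℕ) zs → NonX f zs → T (nonCrossing (rg (map f zs)))
rg-NonX f zs h with rg-relabel (map f zs)
... | ψ , e , inj rewrite e = subst (T ∘ nonCrossing) (Listₚ.map-∘ zs) (NonX⇒nonCrossing (ψ ∘ f) zs h')
  where
  h' : NonX (ψ ∘ f) zs
  h' p e₁ e₂ = cong ψ (h p (inj (m (here refl)) (m (there (there (here refl)))) e₁)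
                           (inj (m (there (here refl))) (m (there (there (there (here refl))))) e₂))
    where
    m : ∀ {w} → w ∈ _ → f w ∈ map f zs
    m i = ∈-map⁺ f (lookup p i)

-- Words with selected letters, and their gaps

module _ {x} {X : Set x} where

  chosen : List (Bool × X) → List X
  chosen []                 = []
  chosen ((true  , y) ∷ zs) = y ∷ chosen zs
  chosen ((false , y) ∷ zs) = chosen zs

  -- A replacement for the accumulator of `runsAux` by structural recursion: `firstGap` is the
  -- possibly empty run at the left end, `laterGaps` collects the runs after the first selected
  -- letter.
  firstGap : List (Bool × X) → List X
  firstGap []                 = []
  firstGap ((true  , y) ∷ zs) = []
  firstGap ((false , y) ∷ zs) = y ∷ firstGap zs

  laterGaps : List (Bool × X) → List (List X)
  laterGaps []                 = []
  laterGaps ((true  , y) ∷ zs) = close (firstGap zs) ++ laterGaps zs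
  laterGaps ((false , y) ∷ zs) = laterGaps zs

  gaps : List (Bool × X) → List (List X)
  gaps zs = close (firstGap zs) ++ laterGaps zs

  sel≡chosen : ∀ m (ys : List X) → sel m ys ≡ chosen (zip m ys)
  sel≡chosen []          ys       = refl
  sel≡chosen (true ∷ m)  []       = refl
  sel≡chosen (false ∷ m) []       = refl
  sel≡chosen (true ∷ m)  (y ∷ ys) = cong (y ∷_) (sel≡chosen m ys)
  sel≡chosen (false ∷ m) (y ∷ ys) = sel≡chosen m ys

  -- The pending run `cur` can merge only with the first gap; all later gaps are independent of it.
  runsAux≡ : ∀ (zs : List (Bool × X)) cur → runsAux zs cur ≡ close (cur ++ firstGap zs) ++ laterGaps zs
  runsAux≡ []                 cur = sym (trans (Listₚ.++-identityʳ _) (cong close (Listₚ.++-identityʳ cur)))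
  runsAux≡ ((true  , y) ∷ zs) cur = cong₂ _++_ (sym (cong close (Listₚ.++-identityʳ cur))) (runsAux≡ zs [])
  runsAux≡ ((false , y) ∷ zs) cur =
    trans (runsAux≡ zs (cur ++ y ∷ []))
          (cong (λ c → close c ++ laterGaps zs) (Listₚ.++-assoc cur (y ∷ []) (firstGap zs)))

  runs≡gaps : ∀ m (ys : List X) → runs m ys ≡ gaps (zip m ys)
  runs≡gaps m ys = runsAux≡ (zip m ys) []

  ∈-close⁻ : ∀ {r : List X} {ys} → r ∈ close ys → r ≡ ys × ∃ λ y → y ∈ ys
  ∈-close⁻ {ys = y ∷ ys} (here e) = e , y , here refl

  ∈-close⁺ : ∀ {y : X} {ys} → y ∈ ys → ys ∈ close ys
  ∈-close⁺ {ys = y ∷ ys} _ = here refl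

  chosen-⊆ : ∀ (zs : List (Bool × X)) → map (true ,_) (chosen zs) ⊆ zs
  chosen-⊆ []                 = []
  chosen-⊆ ((true  , y) ∷ zs) = refl ∷ chosen-⊆ zs
  chosen-⊆ ((false , y) ∷ zs) = _ ∷ʳ chosen-⊆ zs

  ⊆-chosen : ∀ {s} (zs : List (Bool × X)) → map (true ,_) s ⊆ zs → s ⊆ chosen zs
  ⊆-chosen {[]}    zs                 p          = []⊆
  ⊆-chosen {t ∷ s} ((true  , y) ∷ zs) (_ ∷ʳ p)   = y ∷ʳ ⊆-chosen zs p
  ⊆-chosen {t ∷ s} ((true  , y) ∷ zs) (refl ∷ p) = refl ∷ ⊆-chosen zs p
  ⊆-chosen {t ∷ s} ((false , y) ∷ zs) (_ ∷ʳ p)   = ⊆-chosen zs p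

  firstGap-⊆ : ∀ (zs : List (Bool × X)) → map (false ,_) (firstGap zs) ⊆ zs
  firstGap-⊆ []                 = []
  firstGap-⊆ ((true  , y) ∷ zs) = []⊆
  firstGap-⊆ ((false , y) ∷ zs) = refl ∷ firstGap-⊆ zs

  gaps-⊆ : ∀ (zs : List (Bool × X)) {r} → r ∈ gaps zs → map (false ,_) r ⊆ zs
  laterGaps-⊆ : ∀ (zs : List (Bool × X)) {r} → r ∈ laterGaps zs → map (false ,_) r ⊆ zs

  gaps-⊆ zs i with ∈-++⁻ (close (firstGap zs)) i
  ... | inj₁ j with refl , _ ← ∈-close⁻ j = firstGap-⊆ zs
  ... | inj₂ j = laterGaps-⊆ zs j

  laterGaps-⊆ ((true  , y) ∷ zs) i = _ ∷ʳ gaps-⊆ zs i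
  laterGaps-⊆ ((false , y) ∷ zs) i = _ ∷ʳ laterGaps-⊆ zs i

  gaps-nonempty : ∀ (zs : List (Bool × X)) {r} → r ∈ gaps zs → ∃ λ y → y ∈ r
  gaps-nonempty zs i with ∈-++⁻ (close (firstGap zs)) i
  gaps-nonempty zs i | inj₁ j with refl , h ← ∈-close⁻ j = h
  gaps-nonempty ((true  , y) ∷ zs) i | inj₂ j = gaps-nonempty zs j
  gaps-nonempty ((false , y) ∷ zs) i | inj₂ j = gaps-nonempty zs (∈-++⁺ʳ (close (firstGap zs)) j)

  laterGaps-before : ∀ (zs : List (Bool × X)) {r y} → r ∈ laterGaps zs → y ∈ r →
                     ∃ λ t → ((true , t) ∷ (false , y) ∷ []) ⊆ zs
  laterGaps-before ((true  , t) ∷ zs) {r} i j = t , refl ∷ from∈ (lookup (gaps-⊆ zs i) (∈-map⁺ (false ,_) j))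
  laterGaps-before ((false , t) ∷ zs) i j with laterGaps-before zs i j
  ... | u , p = u , _ ∷ʳ p

  gaps-size : ∀ (zs : List (Bool × X)) → length (chosen zs) ℕ.+ sum (map length (gaps zs)) ≡ length zs
  gaps-size' : ∀ (zs : List (Bool × X)) →
               length (chosen zs) ℕ.+ (length (firstGap zs) ℕ.+ sum (map length (laterGaps zs))) ≡ length zs

  gaps-size zs = trans (cong (length (chosen zs) ℕ.+_) (close-size (firstGap zs))) (gaps-size' zs)
    where
    close-size : ∀ (f : List X) {r} → sum (map length (close f ++ r)) ≡ length f ℕ.+ sum (map length r)
    close-size []      = refl
    close-size (_ ∷ _) = refl

  gaps-size' []                 = refl
  gaps-size' ((true  , y) ∷ zs) = cong suc (gaps-size zs)
  gaps-size' ((false , y) ∷ zs) = trans (ℕₚ.+-suc _ _) (cong suc (gaps-size' zs))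

  gaps-none : ∀ (zs : List (Bool × X)) → gaps zs ≡ [] → ∀ {y} → y ∈ zs → proj₁ y ≡ true
  gaps-none ((true  , y) ∷ zs) e (here refl) = refl
  gaps-none ((true  , y) ∷ zs) e (there i)   = gaps-none zs e i

  chosen-none : ∀ (zs : List (Bool × X)) → chosen zs ≡ [] → ∀ {y} → y ∈ zs → proj₁ y ≡ false
  chosen-none ((false , y) ∷ zs) e (here refl) = refl
  chosen-none ((false , y) ∷ zs) e (there i)   = chosen-none zs e i

  module _ {c} {C : Set c} (colour : X → C) where

    InGap : List (Bool × X) → List X → Set x
    InGap zs s = (s ⊆ firstGap zs) ⊎ (∃ λ r → r ∈ laterGaps zs × s ⊆ r)

    -- Letters of one colour cannot spread over two gaps: a letter of a later gap has a selected
    -- letter before it (`laterGaps-before`), and `h` forbids a selected letter between two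
    -- unselected ones of equal colour. The first gap is kept apart for the induction, because a new
    -- unselected letter in front enlarges that gap only.
    inGap : ∀ (zs : List (Bool × X)) →
            (∀ {y t z} → ((false , y) ∷ (true , t) ∷ (false , z) ∷ []) ⊆ zs → colour y ≢ colour z) →
            ∀ y s → (∀ {z} → z ∈ s → colour y ≡ colour z) → map (false ,_) (y ∷ s) ⊆ zs → InGap zs (y ∷ s)
    inGap ((true  , _) ∷ zs) h y s k (_ ∷ʳ p) with inGap zs (λ q → h (_ ∷ʳ q)) y s k p
    ... | inj₁ q           = inj₂ (_ , ∈-++⁺ˡ (∈-close⁺ (lookup q (here refl))) , q)
    ... | inj₂ (r , i , q) = inj₂ (r , ∈-++⁺ʳ (close (firstGap zs)) i , q)
    inGap ((false , _) ∷ zs) h y s k (_ ∷ʳ p) with inGap zs (λ q → h (_ ∷ʳ q)) y s k p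
    ... | inj₁ q = inj₁ (_ ∷ʳ q)
    ... | inj₂ q = inj₂ q
    inGap ((false , _) ∷ zs) h y []      k (refl ∷ p) = inj₁ (refl ∷ []⊆)
    inGap ((false , _) ∷ zs) h y (z ∷ s) k (refl ∷ p)
      with inGap zs (λ q → h (_ ∷ʳ q)) z s (λ i → trans (sym (k (here refl))) (k (there i))) p
    ... | inj₁ q           = inj₁ (refl ∷ q)
    ... | inj₂ (r , i , q) with laterGaps-before zs i (lookup q (here refl))
    ...   | t , w = ⊥-elim (h (refl ∷ w) (k (here refl)))

    inGaps : ∀ (zs : List (Bool × X)) →
             (∀ {y t z} → ((false , y) ∷ (true , t) ∷ (false , z) ∷ []) ⊆ zs → colour y ≢ colour z) →
             ∀ y s → (∀ {z} → z ∈ s → colour y ≡ colour z) → map (false ,_) (y ∷ s) ⊆ zs →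
             ∃ λ r → r ∈ gaps zs × (y ∷ s) ⊆ r
    inGaps zs h y s k p with inGap zs h y s k p
    ... | inj₁ q           = firstGap zs , ∈-++⁺ˡ (∈-close⁺ (lookup q (here refl))) , q
    ... | inj₂ (r , i , q) = r , ∈-++⁺ʳ (close (firstGap zs)) i , q

module _ {x y} {X : Set x} {Y : Set y} (f : X → Y) where

  chosen-map : ∀ zs → chosen (map (map₂ f) zs) ≡ map f (chosen zs)
  chosen-map []                 = refl
  chosen-map ((true  , _) ∷ zs) = cong (_ ∷_) (chosen-map zs)
  chosen-map ((false , _) ∷ zs) = chosen-map zs

  firstGap-map : ∀ zs → firstGap (map (map₂ f) zs) ≡ map f (firstGap zs)
  firstGap-map []                 = refl
  firstGap-map ((true  , _) ∷ zs) = refl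
  firstGap-map ((false , _) ∷ zs) = cong (_ ∷_) (firstGap-map zs)

  close-map : ∀ ys → close (map f ys) ≡ map (map f) (close ys)
  close-map []       = refl
  close-map (y ∷ ys) = refl

  gaps-map : ∀ zs → gaps (map (map₂ f) zs) ≡ map (map f) (gaps zs)
  laterGaps-map : ∀ zs → laterGaps (map (map₂ f) zs) ≡ map (map f) (laterGaps zs)

  gaps-map zs =
    trans (cong₂ _++_ (trans (cong close (firstGap-map zs)) (close-map (firstGap zs))) (laterGaps-map zs))
          (sym (Listₚ.map-++ (map f) (close (firstGap zs)) (laterGaps zs)))

  laterGaps-map []                 = refl
  laterGaps-map ((true  , _) ∷ zs) = gaps-map zs
  laterGaps-map ((false , _) ∷ zs) = laterGaps-map zs

  zip-map : ∀ {z} {Z : Set z} (m : List Z) ys → zip m (map f ys) ≡ map (map₂ f) (zip m ys)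
  zip-map []      ys       = refl
  zip-map (b ∷ m) []       = refl
  zip-map (b ∷ m) (y ∷ ys) = cong (_ ∷_) (zip-map m ys)

  sel-map : ∀ m ys → sel m (map f ys) ≡ map f (sel m ys)
  sel-map m ys = begin
    sel m (map f ys)                ≡⟨ sel≡chosen m (map f ys) ⟩
    chosen (zip m (map f ys))       ≡⟨ cong chosen (zip-map m ys) ⟩
    chosen (map (map₂ f) (zip m ys)) ≡⟨ chosen-map (zip m ys) ⟩
    map f (chosen (zip m ys))       ≡⟨ cong (map f) (sym (sel≡chosen m ys)) ⟩
    map f (sel m ys)                ∎
    where open ≡-Reasoning

  runs-map : ∀ m ys → runs m (map f ys) ≡ map (map f) (runs m ys)
  runs-map m ys = begin
    runs m (map f ys)               ≡⟨ runs≡gaps m (map f ys) ⟩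
    gaps (zip m (map f ys))         ≡⟨ cong gaps (zip-map m ys) ⟩
    gaps (map (map₂ f) (zip m ys))  ≡⟨ gaps-map (zip m ys) ⟩
    map (map f) (gaps (zip m ys))   ≡⟨ cong (map (map f)) (sym (runs≡gaps m ys)) ⟩
    map (map f) (runs m ys)         ∎
    where open ≡-Reasoning

map-proj₁-zip : ∀ {x y} {X : Set x} {Y : Set y} (xs : List X) (ys : List Y) → length xs ≡ length ys →
                map proj₁ (zip xs ys) ≡ xs
map-proj₁-zip []       []       e = refl
map-proj₁-zip (x ∷ xs) (y ∷ ys) e = cong (x ∷_) (map-proj₁-zip xs ys (ℕₚ.suc-injective e))

map-proj₂-zip : ∀ {x y} {X : Set x} {Y : Set y} (xs : List X) (ys : List Y) → length xs ≡ length ys →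
                map proj₂ (zip xs ys) ≡ ys
map-proj₂-zip []       []       e = refl
map-proj₂-zip (x ∷ xs) (y ∷ ys) e = cong (y ∷_) (map-proj₂-zip xs ys (ℕₚ.suc-injective e))

length-zip : ∀ {x y} {X : Set x} {Y : Set y} (xs : List X) (ys : List Y) → length xs ≡ length ys →
             length (zip xs ys) ≡ length ys
length-zip []       []       e = refl
length-zip (x ∷ xs) (y ∷ ys) e = cong suc (length-zip xs ys (ℕₚ.suc-injective e))

zip-∈₁ : ∀ {x y} {X : Set x} {Y : Set y} {z} (xs : List X) (ys : List Y) → z ∈ zip xs ys → proj₁ z ∈ xs
zip-∈₁ (x ∷ xs) (y ∷ ys) (here refl) = here refl
zip-∈₁ (x ∷ xs) (y ∷ ys) (there i)   = there (zip-∈₁ xs ys i)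

zip-∈₂ : ∀ {x y} {X : Set x} {Y : Set y} {z} (xs : List X) (ys : List Y) → z ∈ zip xs ys → proj₂ z ∈ ys
zip-∈₂ (x ∷ xs) (y ∷ ys) (here refl) = here refl
zip-∈₂ (x ∷ xs) (y ∷ ys) (there i)   = there (zip-∈₂ xs ys i)

-- Unions of blocks

∈-dedup⁻ : ∀ ls {l} → l ∈ dedup ls → l ∈ ls
∈-dedup⁻ (y ∷ ys) (here e)  = here e
∈-dedup⁻ (y ∷ ys) (there i) = there (∈-dedup⁻ ys (proj₁ (∈-keep⁻ _ (dedup ys) i)))

∈-dedup⁺ : ∀ {ls l} → l ∈ ls → l ∈ dedup ls
∈-dedup⁺ {y ∷ ys} (here e) = here e
∈-dedup⁺ {y ∷ ys} {l} (there i) with y ℕₚ.≟ l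
... | yes refl = here refl
... | no ¬p    = there (∈-keep⁺ _ (∈-dedup⁺ i) (T-not⁺ (¬p ∘ ℕₚ.≡ᵇ⇒≡ y l)))

dedup-unique : ∀ ls → Unique (dedup ls)
dedup-unique []       = []
dedup-unique (y ∷ ys) =
  unique-∷ (λ i → T-not⁻ (proj₂ (∈-keep⁻ _ (dedup ys) i)) (ℕₚ.≡⇒≡ᵇ y y refl)) (keep-unique _ (dedup-unique ys))

-- The function `inQ` on a zipped list. It is used in two ways: with a colouring zipped to the list
-- of blocks, and with a position mask zipped to the labels.
colour : List (Bool × ℕ) → ℕ → Bool
colour []              l = false
colour ((b , l') ∷ zs) l = if l ≡ᵇ l' then b else colour zs l

-- For a mask zipped with labels this says that the selected positions form a union of blocks.
Saturated : List (Bool × ℕ) → Set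
Saturated zs = ∀ {x y} → x ∈ zs → y ∈ zs → proj₂ x ≡ proj₂ y → proj₁ x ≡ proj₁ y

colour-∈ : ∀ zs → Saturated zs → ∀ {b l} → (b , l) ∈ zs → colour zs l ≡ b
colour-∈ ((b' , l') ∷ zs) h {b} {l} i with l ≡ᵇ l' in eq
... | true = h (here refl) i (sym (ℕₚ.≡ᵇ⇒≡ l l' (≡⇒T eq)))
colour-∈ ((b' , l') ∷ zs) h {l = l} (here refl) | false with () ← trans (sym eq) (≡ᵇ-refl l)
colour-∈ ((b' , l') ∷ zs) h (there i) | false = colour-∈ zs (λ p q → h (there p) (there q)) i

map-colour : ∀ zs → Saturated zs → map (colour zs) (map proj₂ zs) ≡ map proj₁ zs
map-colour zs h = trans (sym (Listₚ.map-∘ zs)) (map-cong-∈ zs (colour-∈ zs h))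

map-colour-zip : ∀ m ls → length m ≡ length ls → Saturated (zip m ls) → map (colour (zip m ls)) ls ≡ m
map-colour-zip m ls e h = begin
  map (colour (zip m ls)) ls                        ≡⟨ cong (map (colour (zip m ls))) (sym (map-proj₂-zip m ls e)) ⟩
  map (colour (zip m ls)) (map proj₂ (zip m ls))    ≡⟨ map-colour (zip m ls) h ⟩
  map proj₁ (zip m ls)                              ≡⟨ map-proj₁-zip m ls e ⟩
  m                                                 ∎
  where open ≡-Reasoning

zip-functional : ∀ {x} {X : Set x} (q : List X) (bs : List ℕ) → Unique bs →
                 ∀ {y z} → y ∈ zip q bs → z ∈ zip q bs → proj₂ y ≡ proj₂ z → proj₁ y ≡ proj₁ z
zip-functional (b ∷ q) (l ∷ bs) u (here refl) (here refl) e = refl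
zip-functional (b ∷ q) (l ∷ bs) u (here refl) (there j)   refl = ⊥-elim (∉-∷ u (zip-∈₂ q bs j))
zip-functional (b ∷ q) (l ∷ bs) u (there i)   (here refl) refl = ⊥-elim (∉-∷ u (zip-∈₂ q bs i))
zip-functional (b ∷ q) (l ∷ bs) u (there i)   (there j)   e = zip-functional q bs (unique-tail u) i j e

zip-map-self : ∀ {x y} {X : Set x} {Y : Set y} (g : X → Y) ls → zip (map g ls) ls ≡ map (λ l → g l , l) ls
zip-map-self g []       = refl
zip-map-self g (l ∷ ls) = cong (_ ∷_) (zip-map-self g ls)

∈-masks⁺ : ∀ m → m ∈ masks (length m)
∈-masks⁺ []          = here refl
∈-masks⁺ (true ∷ m)  = ∈-++⁺ˡ (∈-map⁺ (true ∷_) (∈-masks⁺ m))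
∈-masks⁺ (false ∷ m) = ∈-++⁺ʳ (map (true ∷_) (masks (length m))) (∈-map⁺ (false ∷_) (∈-masks⁺ m))

∈-masks⁻ : ∀ n {m} → m ∈ masks n → length m ≡ n
∈-masks⁻ zero    (here refl) = refl
∈-masks⁻ (suc n) i with ∈-++⁻ (map (true ∷_) (masks n)) i
... | inj₁ j with _ , k , refl ← ∈-map⁻ (true ∷_) j  = cong suc (∈-masks⁻ n k)
... | inj₂ j with _ , k , refl ← ∈-map⁻ (false ∷_) j = cong suc (∈-masks⁻ n k)

masks-unique : ∀ n → Unique (masks n)
masks-unique zero    = [] ∷ []
masks-unique (suc n) =
  Uniqueₚ.++⁺ (Uniqueₚ.map⁺ Listₚ.∷-injectiveʳ (masks-unique n)) (Uniqueₚ.map⁺ Listₚ.∷-injectiveʳ (masks-unique n))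
    λ (i , j) → let _ , _ , e = ∈-map⁻ (true ∷_) i; _ , _ , e' = ∈-map⁻ (false ∷_) j in
                case Listₚ.∷-injectiveˡ (trans (sym e) e') of λ ()

blockPositions : ℕ → List ℕ → ℕ → List ℕ
blockPositions n ls b = map proj₁ (keep (λ p → proj₂ p ≡ᵇ b) (zip (upTo n) ls))

∈-zip-applyUpTo⁻ : ∀ (f : ℕ → ℕ) ls {p} → p ∈ zip (applyUpTo f (length ls)) ls →
                   ∃ λ i → i < length ls × proj₁ p ≡ f i × at ls i ≡ proj₂ p
∈-zip-applyUpTo⁻ f (l ∷ ls) (here refl) = zero , s≤s z≤n , refl , refl
∈-zip-applyUpTo⁻ f (l ∷ ls) (there p)   with ∈-zip-applyUpTo⁻ (f ∘ suc) ls p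
... | i , l< , e , e' = suc i , s≤s l< , e , e'

∈-zip-applyUpTo⁺ : ∀ (f : ℕ → ℕ) ls {i} → i < length ls → (f i , at ls i) ∈ zip (applyUpTo f (length ls)) ls
∈-zip-applyUpTo⁺ f (l ∷ ls) {zero}  p       = here refl
∈-zip-applyUpTo⁺ f (l ∷ ls) {suc i} (s≤s p) = there (∈-zip-applyUpTo⁺ (f ∘ suc) ls p)

∈-blockPositions⁻ : ∀ ls b {i} → i ∈ blockPositions (length ls) ls b → i < length ls × at ls i ≡ b
∈-blockPositions⁻ ls b i with ∈-map⁻ proj₁ i
... | p , j , refl with ∈-keep⁻ (λ p → proj₂ p ≡ᵇ b) (zip (upTo (length ls)) ls) j
...   | k , t with ∈-zip-applyUpTo⁻ id ls k
...     | _ , l , refl , e = l , trans e (ℕₚ.≡ᵇ⇒≡ (proj₂ p) b t)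

∈-blockPositions⁺ : ∀ ls {i} → i < length ls → i ∈ blockPositions (length ls) ls (at ls i)
∈-blockPositions⁺ ls {i} p =
  ∈-map⁺ proj₁ (∈-keep⁺ (λ p → proj₂ p ≡ᵇ at ls i) (∈-zip-applyUpTo⁺ id ls p) (ℕₚ.≡⇒≡ᵇ (at ls i) (at ls i) refl))

foldr-⊓-≤ : ∀ y ys {i} → i ∈ (y ∷ ys) → foldr _⊓_ y ys ≤ i
foldr-⊓-≤ y []       (here refl)         = ℕₚ.≤-refl
foldr-⊓-≤ y (z ∷ zs) (here refl)         = ℕₚ.≤-trans (ℕₚ.m⊓n≤n z _) (foldr-⊓-≤ y zs (here refl))
foldr-⊓-≤ y (z ∷ zs) (there (here refl)) = ℕₚ.m⊓n≤m z _
foldr-⊓-≤ y (z ∷ zs) (there (there i))   = ℕₚ.≤-trans (ℕₚ.m⊓n≤n z _) (foldr-⊓-≤ y zs (there i))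

foldr-⊓-∈ : ∀ y ys → foldr _⊓_ y ys ∈ (y ∷ ys)
foldr-⊓-∈ y []       = here refl
foldr-⊓-∈ y (z ∷ zs) with ℕₚ.⊓-sel z (foldr _⊓_ y zs)
... | inj₁ e = there (here e)
... | inj₂ e with foldr-⊓-∈ y zs
...   | here e' = here (trans e e')
...   | there i = there (there (subst (_∈ zs) (sym e) i))

foldr-⊔-≤ : ∀ y ys {i} → i ∈ (y ∷ ys) → i ≤ foldr ℕ._⊔_ y ys
foldr-⊔-≤ y []       (here refl)         = ℕₚ.≤-refl
foldr-⊔-≤ y (z ∷ zs) (here refl)         = ℕₚ.≤-trans (foldr-⊔-≤ y zs (here refl)) (ℕₚ.m≤n⊔m z _)
foldr-⊔-≤ y (z ∷ zs) (there (here refl)) = ℕₚ.m≤m⊔n z _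
foldr-⊔-≤ y (z ∷ zs) (there (there i))   = ℕₚ.≤-trans (foldr-⊔-≤ y zs (there i)) (ℕₚ.m≤n⊔m z _)

foldr-⊔-∈ : ∀ y ys → foldr ℕ._⊔_ y ys ∈ (y ∷ ys)
foldr-⊔-∈ y []       = here refl
foldr-⊔-∈ y (z ∷ zs) with ℕₚ.⊔-sel z (foldr ℕ._⊔_ y zs)
... | inj₁ e = there (here e)
... | inj₂ e with foldr-⊔-∈ y zs
...   | here e' = here (trans e e')
...   | there i = there (there (subst (_∈ zs) (sym e) i))

minL-≤ : ∀ {ys i} → i ∈ ys → minL ys ≤ i
minL-≤ {y ∷ ys} = foldr-⊓-≤ y ys

minL-∈ : ∀ {ys i} → i ∈ ys → minL ys ∈ ys
minL-∈ {y ∷ ys} _ = foldr-⊓-∈ y ys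

≤-maxL : ∀ {ys i} → i ∈ ys → i ≤ maxL ys
≤-maxL {y ∷ ys} = foldr-⊔-≤ y ys

maxL-∈ : ∀ {ys i} → i ∈ ys → maxL ys ∈ ys
maxL-∈ {y ∷ ys} _ = foldr-⊔-∈ y ys

-- Admissible decompositions and their position masks

nested : ℕ → List ℕ → ℕ → ℕ → Bool
nested n ls b c = allB (λ i → (minL pc <ᵇ i) ∧ (i <ᵇ maxL pc)) (blockPositions n ls b)
  where pc = blockPositions n ls c

admissibleColouring : ℕ → List ℕ → (ℕ → Bool) → Bool
admissibleColouring n ls g =
  allB (λ b → allB (λ c → not (g b ∧ not (g c) ∧ nested n ls b c)) (dedup ls)) (dedup ls)

Unstraddled : List (Bool × ℕ) → Set
Unstraddled zs = ∀ {x y z} → (x ∷ y ∷ z ∷ []) ⊆ zs → proj₂ x ≡ proj₂ z → proj₁ x ≡ false → proj₁ y ≡ true → ⊥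

-- Let a selected position j lie between positions i and k of an unselected block. An element p of
-- the block of j to the left of that block's minimum would give the crossing p < i < j < k, and one
-- to the right of its maximum the crossing i < j < k < p. So the whole block of j is nested,
-- against admissibility.
admissible⇒unstraddled : ∀ ls g → NonXPos ls → T (admissibleColouring (length ls) ls g) →
                         Unstraddled (map (λ l → g l , l) ls)
admissible⇒unstraddled ls g nx t {x} {y} {z} p e gx gy with ⊆-map⁻ (λ l → g l , l) ls p
... | c ∷ b ∷ _ ∷ [] , q , refl with ⊆₃-at ls q
...   | i , j , k , ij , jk , kn , refl , refl , ek =
  T-not⁻ (allB⁻ _ (dedup ls) (allB⁻ _ (dedup ls) t (∈-dedup⁺ (at∈ ls j jn))) (∈-dedup⁺ (at∈ ls i in')))
         (T∧⁺ (≡⇒T gy) (T∧⁺ (T-not⁺ (λ u → case trans (sym gx) (T⇒≡ u) of λ ()))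
           (allB⁺ _ (blockPositions n ls (at ls j)) inside)))
  where
  n  = length ls
  jn = ℕₚ.<-trans jk kn
  in' = ℕₚ.<-trans ij jn
  pc = blockPositions n ls (at ls i)
  b≢c : at ls j ≢ at ls i
  b≢c h = case trans (sym gy) (trans (cong g h) gx) of λ ()
  ck : at ls k ≡ at ls i
  ck = trans ek (sym e)
  i∈ = ∈-blockPositions⁺ ls in'
  k∈ : k ∈ pc
  k∈ = subst (λ c → k ∈ blockPositions n ls c) ck (∈-blockPositions⁺ ls kn)
  inside : ∀ {p} → p ∈ blockPositions n ls (at ls j) → T ((minL pc <ᵇ p) ∧ (p <ᵇ maxL pc))
  inside {p} p∈ with ∈-blockPositions⁻ ls _ p∈ | ∈-blockPositions⁻ ls _ (minL-∈ i∈) | ∈-blockPositions⁻ ls _ (maxL-∈ i∈)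
  ... | p< , ep | u< , eu | v< , ev = T∧⁺ (ℕₚ.<⇒<ᵇ min<p) (ℕₚ.<⇒<ᵇ p<max)
    where
    min<p : minL pc < p
    min<p with ℕₚ.<-cmp (minL pc) p
    ... | tri< a _ _ = a
    ... | tri≈ _ h _ = ⊥-elim (b≢c (trans (sym ep) (trans (cong (at ls) (sym h)) eu)))
    ... | tri> _ _ a =
      ⊥-elim (b≢c (trans (sym ep) (nx (ℕₚ.<-≤-trans a (minL-≤ i∈)) ij jk kn ep (sym ck))))
    p<max : p < maxL pc
    p<max with ℕₚ.<-cmp p (maxL pc)
    ... | tri< a _ _ = a
    ... | tri≈ _ h _ = ⊥-elim (b≢c (trans (sym ep) (trans (cong (at ls) h) ev)))
    ... | tri> _ _ a =
      ⊥-elim (b≢c (sym (nx ij jk (ℕₚ.≤-<-trans (≤-maxL k∈) a) p< (sym ck) (sym ep))))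

-- A nested pair of blocks contains a straddling triple: the minimum of the outer block, any element
-- of the inner one, the maximum of the outer one.
unstraddled⇒admissible : ∀ ls g → Unstraddled (map (λ l → g l , l) ls) → T (admissibleColouring (length ls) ls g)
unstraddled⇒admissible ls g h =
  allB⁺ _ (dedup ls) λ {b} b∈ → allB⁺ _ (dedup ls) λ {c} c∈ → T-not⁺ λ t →
    let gb , t = T∧⁻ t; gc , t = T∧⁻ t in contra (∈-dedup⁻ ls b∈) (∈-dedup⁻ ls c∈) gb gc t
  where
  contra : ∀ {b c} → b ∈ ls → c ∈ ls → T (g b) → T (not (g c)) → T (nested (length ls) ls b c) → ⊥
  contra {b} {c} b∈ c∈ gb gc t with ∈⇒at ls b∈ | ∈⇒at ls c∈
  ... | i , il , refl | j , jl , refl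
    with minL-∈ (∈-blockPositions⁺ ls jl) | maxL-∈ (∈-blockPositions⁺ ls jl)
       | T∧⁻ (allB⁻ _ (blockPositions (length ls) ls (at ls i)) t (∈-blockPositions⁺ ls il))
  ... | u | v | a , a'
    with ∈-blockPositions⁻ ls _ u | ∈-blockPositions⁻ ls _ v
  ... | _ , eu | vl , ev =
    h (Sublistₚ.map⁺ (λ l → g l , l) (at-⊆₃ ls (ℕₚ.<ᵇ⇒< _ i a) (ℕₚ.<ᵇ⇒< i _ a') vl))
      (trans eu (sym ev)) (trans (cong g eu) (≢true⇒≡false (T-not⁻ gc ∘ ≡⇒T))) (T⇒≡ gb)

-- Over a non-crossing partition, a set of positions is ⋃Q for an admissible decomposition
-- L = Q ⊔ U iff it is a union of blocks and no other block straddles one of its elements.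
record Cut (m : List Bool) (ls : List ℕ) : Set where
  field
    sizes       : length m ≡ length ls
    saturated   : Saturated (zip m ls)
    unstraddled : Unstraddled (zip m ls)

open Cut public

-- The counterpart of `admMasks` on labels alone. A mask here has one bit per block; `positionMask`
-- spreads it to one bit per position, the form that can be compared with the masks cutting a plain
-- word.
blockColourings : List ℕ → List (List Bool)
blockColourings ls =
  keep (λ q → admissibleColouring (length ls) ls (colour (zip q (dedup ls)))) (masks (length (dedup ls)))

positionMask : List ℕ → List Bool → List Bool
positionMask ls q = map (colour (zip q (dedup ls))) ls

cuts : List ℕ → List (List Bool)
cuts ls = map (positionMask ls) (blockColourings ls)

cuts⁺ : ℕ → List ℕ → List (List Bool)
cuts⁺ l ls = map (positionMask ls) (keep (λ q → colour (zip q (dedup ls)) l) (blockColourings ls))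

colouring-size : ∀ ls {q} → q ∈ blockColourings ls → length q ≡ length (dedup ls)
colouring-size ls i = ∈-masks⁻ _ (proj₁ (∈-keep⁻ _ (masks (length (dedup ls))) i))

positionMask-determines : ∀ ls {q} → length q ≡ length (dedup ls) → map (colour (zip q (dedup ls))) (dedup ls) ≡ q
positionMask-determines ls {q} e =
  map-colour-zip q (dedup ls) e (λ i j → zip-functional q (dedup ls) (dedup-unique ls) i j)

-- Every block occurs at some position, so its colour can be read off the position mask. This keeps
-- `cuts` free of duplicates.
positionMask-injective : ∀ ls {q q'} → q ∈ blockColourings ls → q' ∈ blockColourings ls →
                         positionMask ls q ≡ positionMask ls q' → q ≡ q'
positionMask-injective ls {q} {q'} i j e = begin
  q                                          ≡⟨ sym (positionMask-determines ls (colouring-size ls i)) ⟩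
  map (colour (zip q (dedup ls))) (dedup ls)  ≡⟨ map-cong-∈ (dedup ls) (λ k → map-≡⁻ {Y = ℕ} e (∈-dedup⁻ ls k)) ⟩
  map (colour (zip q' (dedup ls))) (dedup ls) ≡⟨ positionMask-determines ls (colouring-size ls j) ⟩
  q'                                         ∎
  where open ≡-Reasoning

blockColourings-unique : ∀ ls → Unique (blockColourings ls)
blockColourings-unique ls = keep-unique _ (masks-unique (length (dedup ls)))

cuts-unique : ∀ ls → Unique (cuts ls)
cuts-unique ls = unique-map (positionMask-injective ls) (blockColourings-unique ls)

cuts⁺-unique : ∀ l ls → Unique (cuts⁺ l ls)
cuts⁺-unique l ls =
  unique-map (λ i j → positionMask-injective ls (proj₁ (∈-keep⁻ _ (blockColourings ls) i)) (proj₁ (∈-keep⁻ _ (blockColourings ls) j)))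
             (keep-unique _ (blockColourings-unique ls))

∈-cuts⁻ : ∀ ls → NonXPos ls → ∀ {m} → m ∈ cuts ls → Cut m ls
∈-cuts⁻ ls nx i with ∈-map⁻ (positionMask ls) i
... | q , j , refl = record
  { sizes       = Listₚ.length-map g ls
  ; saturated   = subst Saturated (sym (zip-map-self g ls)) sat
  ; unstraddled = subst Unstraddled (sym (zip-map-self g ls))
      (admissible⇒unstraddled ls g nx (proj₂ (∈-keep⁻ _ (masks (length (dedup ls))) j)))
  }
  where
  g = colour (zip q (dedup ls))
  sat : Saturated (map (λ l → g l , l) ls)
  sat a b e with ∈-map⁻ (λ l → g l , l) a | ∈-map⁻ (λ l → g l , l) b
  ... | _ , _ , refl | _ , _ , refl = cong g e

module _ {m ls} (c : Cut m ls) where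

  private
    g = colour (zip m ls)
    -- The block colouring read off the mask; by saturation, spreading it over the positions again
    -- gives back `m`.
    q = map g (dedup ls)

    same : ∀ {l} → l ∈ ls → colour (zip q (dedup ls)) l ≡ g l
    same {l} i = colour-∈ (zip q (dedup ls)) (zip-functional q (dedup ls) (dedup-unique ls))
      (subst ((g l , l) ∈_) (sym (zip-map-self g (dedup ls))) (∈-map⁺ (λ l → g l , l) (∈-dedup⁺ i)))

    mask : positionMask ls q ≡ m
    mask = trans (map-cong-∈ ls same) (map-colour-zip m ls (sizes c) (saturated c))

    q∈ : q ∈ blockColourings ls
    q∈ = ∈-keep⁺ _ (subst (λ n → q ∈ masks n) (Listₚ.length-map g (dedup ls)) (∈-masks⁺ q))
      (unstraddled⇒admissible ls _
        (subst Unstraddled (trans (cong (λ m → zip m ls) (sym mask)) (zip-map-self _ ls)) (unstraddled c)))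

  ∈-cuts⁺ : m ∈ cuts ls
  ∈-cuts⁺ = subst (_∈ cuts ls) mask (∈-map⁺ (positionMask ls) q∈)

∈-cuts⁺⁻ : ∀ l ls → NonXPos (l ∷ ls) → ∀ {m} → m ∈ cuts⁺ l (l ∷ ls) →
           Cut m (l ∷ ls) × ∃ λ m' → m ≡ true ∷ m'
∈-cuts⁺⁻ l ls nx i with ∈-map⁻ (positionMask (l ∷ ls)) i
... | q , j , refl with ∈-keep⁻ (λ q → colour (zip q (dedup (l ∷ ls))) l) (blockColourings (l ∷ ls)) j
...   | k , t = ∈-cuts⁻ (l ∷ ls) nx (∈-map⁺ (positionMask (l ∷ ls)) k) , _ , cong (_∷ map (colour (zip q (dedup (l ∷ ls)))) ls) (T⇒≡ t)

∈-cuts⁺⁺ : ∀ {l ls m} → Cut (true ∷ m) (l ∷ ls) → (true ∷ m) ∈ cuts⁺ l (l ∷ ls)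
∈-cuts⁺⁺ {l} {ls} c with ∈-map⁻ (positionMask (l ∷ ls)) (∈-cuts⁺ c)
... | q , j , e = subst (_∈ cuts⁺ l (l ∷ ls)) (sym e)
  (∈-map⁺ (positionMask (l ∷ ls))
    (∈-keep⁺ (λ q → colour (zip q (dedup (l ∷ ls))) l) j (≡⇒T (sym (Listₚ.∷-injectiveˡ e)))))

-- Enumerations of non-crossing partitions

∈-rgsList⁻ : ∀ n k {ls} → ls ∈ rgsList n k → length ls ≡ n × T (rgsAux k ls)
∈-rgsList⁻ zero    k (here refl) = refl , tt
∈-rgsList⁻ (suc n) k i with ∈-concatMap⁻ _ (upTo (suc k)) i
... | x , x∈ , j with ∈-map⁻ (x ∷_) j
...   | ls , l , refl with ∈-rgsList⁻ n _ l
...     | e , t = cong suc e , T∧⁺ (ℕₚ.≤⇒≤ᵇ (ℕₚ.≤-pred (∈-upTo⁻ x∈))) t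

∈-rgsList⁺ : ∀ k ls → T (rgsAux k ls) → ls ∈ rgsList (length ls) k
∈-rgsList⁺ k []       t = here refl
∈-rgsList⁺ k (x ∷ xs) t with T∧⁻ {x ≤ᵇ k} t
... | a , b = ∈-concatMap⁺ _ (∈-upTo⁺ (s≤s (ℕₚ.≤ᵇ⇒≤ x k a))) (∈-map⁺ (x ∷_) (∈-rgsList⁺ _ xs b))

rgsList-unique : ∀ n k → Unique (rgsList n k)
rgsList-unique zero    k = [] ∷ []
rgsList-unique (suc n) k =
  unique-concatMap _ (Uniqueₚ.upTo⁺ (suc k))
    (λ _ → Uniqueₚ.map⁺ Listₚ.∷-injectiveʳ (rgsList-unique n _))
    λ {v} {w} _ _ i j → let _ , _ , e = ∈-map⁻ (v ∷_) i; _ , _ , e' = ∈-map⁻ (w ∷_) j in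
                        Listₚ.∷-injectiveˡ (trans (sym e) e')

record IsNC (n : ℕ) (ls : List ℕ) : Set where
  constructor isNC
  field
    size        : length ls ≡ n
    rgs         : T (isRGS ls)
    noncrossing : T (nonCrossing ls)

open IsNC public

∈-ncParts⁻ : ∀ n {ls} → ls ∈ ncParts n → IsNC n ls
∈-ncParts⁻ n i with ∈-keep⁻ nonCrossing (rgsList n 0) i
... | j , nc with ∈-rgsList⁻ n 0 j
...   | e , r = isNC e r nc

∈-ncParts⁺ : ∀ {n ls} → IsNC n ls → ls ∈ ncParts n
∈-ncParts⁺ {ls = ls} (isNC refl r nc) = ∈-keep⁺ nonCrossing (∈-rgsList⁺ 0 ls r) nc

ncParts-unique : ∀ n → Unique (ncParts n)
ncParts-unique n = keep-unique nonCrossing (rgsList-unique n 0)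

rg-isNC : ∀ {z} {Z : Set z} (f : Z → ℕ) zs → NonX f zs → IsNC (length zs) (rg (map f zs))
rg-isNC f zs h = isNC (trans (length-rg (map f zs)) (Listₚ.length-map f zs)) (rg-RGS (map f zs)) (rg-NonX f zs h)

ncFamilies : List ℕ → List (List (List ℕ))
ncFamilies []       = [] ∷ []
ncFamilies (n ∷ ns) = concatMap (λ L → map (L ∷_) (ncFamilies ns)) (ncParts n)

∈-ncFamilies⁻ : ∀ ns {Ls} → Ls ∈ ncFamilies ns → Pointwise IsNC ns Ls
∈-ncFamilies⁻ []       (here refl) = []
∈-ncFamilies⁻ (n ∷ ns) i with ∈-concatMap⁻ _ (ncParts n) i
... | L , l , j with ∈-map⁻ (L ∷_) j
...   | Ls , k , refl = ∈-ncParts⁻ n l ∷ ∈-ncFamilies⁻ ns k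

∈-ncFamilies⁺ : ∀ {ns Ls} → Pointwise IsNC ns Ls → Ls ∈ ncFamilies ns
∈-ncFamilies⁺ []       = here refl
∈-ncFamilies⁺ (p ∷ ps) = ∈-concatMap⁺ _ (∈-ncParts⁺ p) (∈-map⁺ (_ ∷_) (∈-ncFamilies⁺ ps))

ncFamilies-unique : ∀ ns → Unique (ncFamilies ns)
ncFamilies-unique []       = [] ∷ []
ncFamilies-unique (n ∷ ns) =
  unique-concatMap _ (ncParts-unique n)
    (λ _ → Uniqueₚ.map⁺ Listₚ.∷-injectiveʳ (ncFamilies-unique ns))
    λ {v} {w} _ _ i j → let _ , _ , e = ∈-map⁻ (v ∷_) i; _ , _ , e' = ∈-map⁻ (w ∷_) j in
                        Listₚ.∷-injectiveˡ (trans (sym e) e')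

module _ {x y} {X : Set x} {Y : Set y} (m : List Bool) (xs : List X) (ys : List Y) (e : length xs ≡ length ys) where

  -- Both words are projections of their zip and selection commutes with maps, so the sizes of the
  -- pieces depend on the mask alone.
  length-sel : length (sel m xs) ≡ length (sel m ys)
  length-sel = begin
    length (sel m xs)                          ≡⟨ cong (λ l → length (sel m l)) (sym (map-proj₁-zip xs ys e)) ⟩
    length (sel m (map proj₁ (zip xs ys)))     ≡⟨ cong length (sel-map proj₁ m (zip xs ys)) ⟩
    length (map proj₁ (sel m (zip xs ys)))     ≡⟨ Listₚ.length-map proj₁ (sel m (zip xs ys)) ⟩
    length (sel m (zip xs ys))                 ≡⟨ sym (Listₚ.length-map proj₂ (sel m (zip xs ys))) ⟩
    length (map proj₂ (sel m (zip xs ys)))     ≡⟨ cong length (sym (sel-map proj₂ m (zip xs ys))) ⟩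
    length (sel m (map proj₂ (zip xs ys)))     ≡⟨ cong (λ l → length (sel m l)) (map-proj₂-zip xs ys e) ⟩
    length (sel m ys)                          ∎
    where open ≡-Reasoning

  length-runs : map length (runs m xs) ≡ map length (runs m ys)
  length-runs = begin
    map length (runs m xs)                             ≡⟨ cong (λ l → map length (runs m l)) (sym (map-proj₁-zip xs ys e)) ⟩
    map length (runs m (map proj₁ (zip xs ys)))        ≡⟨ cong (map length) (runs-map proj₁ m (zip xs ys)) ⟩
    map length (map (map proj₁) (runs m (zip xs ys)))  ≡⟨ sym (Listₚ.map-∘ (runs m (zip xs ys))) ⟩
    map (length ∘ map proj₁) (runs m (zip xs ys))      ≡⟨ Listₚ.map-cong (λ r → trans (Listₚ.length-map proj₁ r) (sym (Listₚ.length-map proj₂ r))) (runs m (zip xs ys)) ⟩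
    map (length ∘ map proj₂) (runs m (zip xs ys))      ≡⟨ Listₚ.map-∘ (runs m (zip xs ys)) ⟩
    map length (map (map proj₂) (runs m (zip xs ys)))  ≡⟨ cong (map length) (sym (runs-map proj₂ m (zip xs ys))) ⟩
    map length (runs m (map proj₂ (zip xs ys)))        ≡⟨ cong (λ l → map length (runs m l)) (map-proj₂-zip xs ys e) ⟩
    map length (runs m ys)                             ∎
    where open ≡-Reasoning

module _ {x} {X : Set x} where

  sel-⊆ : ∀ m (ys : List X) → sel m ys ⊆ ys
  sel-⊆ []          ys       = []⊆
  sel-⊆ (true ∷ m)  []       = []
  sel-⊆ (false ∷ m) []       = []
  sel-⊆ (true ∷ m)  (y ∷ ys) = refl ∷ sel-⊆ m ys
  sel-⊆ (false ∷ m) (y ∷ ys) = y ∷ʳ sel-⊆ m ys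

  map-proj₂-zip-⊆ : ∀ {b} {B : Set b} (m : List B) (ys : List X) → map proj₂ (zip m ys) ⊆ ys
  map-proj₂-zip-⊆ []      ys       = []⊆
  map-proj₂-zip-⊆ (b ∷ m) []       = []
  map-proj₂-zip-⊆ (b ∷ m) (y ∷ ys) = refl ∷ map-proj₂-zip-⊆ m ys

  runs-⊆ : ∀ m (ys : List X) {r} → r ∈ runs m ys → r ⊆ ys
  runs-⊆ m ys {r} i =
    subst (_⊆ ys) (trans (sym (Listₚ.map-∘ r)) (Listₚ.map-id r))
      (⊆-trans (Sublistₚ.map⁺ proj₂ (gaps-⊆ (zip m ys) (subst (r ∈_) (runs≡gaps m ys) i)))
               (map-proj₂-zip-⊆ m ys))

  NonX-⊆ : ∀ {f : X → ℕ} {xs ys} → xs ⊆ ys → NonX f ys → NonX f xs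
  NonX-⊆ p h q = h (⊆-trans q p)

-- Cutting a partition and reassembling it from its pieces

-- The mask of a cut, the renumbered partition of the selected positions, and the renumbered
-- partitions of the gaps. The mask tells where the pieces belong.
Pieces : Set
Pieces = List Bool × List ℕ × List (List ℕ)

pieces : List Bool → List ℕ → Pieces
pieces m ls = m , rg (sel m ls) , map rg (runs m ls)

cutsHead : List ℕ → List (List Bool)
cutsHead []       = []
cutsHead (l ∷ ls) = cuts⁺ l (l ∷ ls)

-- One side of the bijection: cuts of non-crossing partitions that select the first position. The
-- other side, `headPieces`, chooses a mask and then, independently, a partition for each part.
headCuts : ℕ → List Pieces
headCuts n = concatMap (λ L → map (λ m → pieces m L) (cutsHead L)) (ncParts n)

module _ {x} {X : Set x} (y : X) (ys : List X) where

  headPieces : List Pieces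
  headPieces = concatMap (λ m → concatMap (λ Q → map (λ J → m , Q , J)
                   (ncFamilies (map length (runs m (y ∷ ys)))))
                 (ncParts (length (sel m (y ∷ ys)))))
               (map (true ∷_) (masks (length ys)))

  headPieces-unique : Unique headPieces
  headPieces-unique =
    unique-concatMap _ (Uniqueₚ.map⁺ Listₚ.∷-injectiveʳ (masks-unique (length ys)))
      (λ {m} _ → unique-concatMap _ (ncParts-unique (length (sel m (y ∷ ys))))
         (λ _ → Uniqueₚ.map⁺ (λ { refl → refl }) (ncFamilies-unique (map length (runs m (y ∷ ys)))))
         (λ {v} {w} _ _ i j → let _ , _ , e = ∈-map⁻ (λ J → m , v , J) i; _ , _ , e' = ∈-map⁻ (λ J → m , w , J) j in
                              cong (proj₁ ∘ proj₂) (trans (sym e) e')))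
      λ {v} {w} _ _ i j → trans (sym (mask v i)) (mask w j)
    where
    mask : ∀ m {z} → z ∈ concatMap (λ Q → map (λ J → m , Q , J) (ncFamilies (map length (runs m (y ∷ ys)))))
                                   (ncParts (length (sel m (y ∷ ys)))) → proj₁ z ≡ m
    mask m i with ∈-concatMap⁻ _ (ncParts (length (sel m (y ∷ ys)))) i
    ... | Q , _ , j with ∈-map⁻ (λ J → m , Q , J) j
    ...   | _ , _ , refl = refl

  ∈-headPieces⁺ : ∀ {m Q J} → length m ≡ length ys → IsNC (length (sel (true ∷ m) (y ∷ ys))) Q →
                  Pointwise IsNC (map length (runs (true ∷ m) (y ∷ ys))) J → (true ∷ m , Q , J) ∈ headPieces
  ∈-headPieces⁺ {m} {Q} e q j =
    ∈-concatMap⁺ _ (∈-map⁺ (true ∷_) (subst (λ n → m ∈ masks n) e (∈-masks⁺ m)))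
      (∈-concatMap⁺ _ (∈-ncParts⁺ q) (∈-map⁺ (λ J → true ∷ m , Q , J) (∈-ncFamilies⁺ j)))

  ∈-headPieces⁻ : ∀ {p} → p ∈ headPieces → ∃ λ m → ∃ λ Q → ∃ λ J → p ≡ (true ∷ m , Q , J) × length m ≡ length ys
                  × IsNC (length (sel (true ∷ m) (y ∷ ys))) Q × Pointwise IsNC (map length (runs (true ∷ m) (y ∷ ys))) J
  ∈-headPieces⁻ i with ∈-concatMap⁻ _ (map (true ∷_) (masks (length ys))) i
  ... | m , j , k with ∈-map⁻ (true ∷_) j
  ...   | m' , m∈ , refl with ∈-concatMap⁻ _ (ncParts (length (sel m (y ∷ ys)))) k
  ...     | Q , q , l with ∈-map⁻ (λ J → m , Q , J) l
  ...       | J , J∈ , refl = m' , Q , J , refl , ∈-masks⁻ (length ys) m∈ , ∈-ncParts⁻ (length (sel m (y ∷ ys))) q , ∈-ncFamilies⁻ _ J∈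

cutsHead⁻ : ∀ {n L m} → IsNC n L → m ∈ cutsHead L → Cut m L × ∃ λ m' → m ≡ true ∷ m'
cutsHead⁻ {L = l ∷ ls} nc i = ∈-cuts⁺⁻ l ls (nonCrossing⇒pos (l ∷ ls) (noncrossing nc)) i

cutsHead-unique : ∀ L → Unique (cutsHead L)
cutsHead-unique []       = []
cutsHead-unique (l ∷ ls) = cuts⁺-unique l (l ∷ ls)

module _ {m ls ls'} (c : Cut m ls) (c' : Cut m ls') where

  private
    -- Both labellings are carried by one word, so that they can be compared position by position;
    -- `ws` adds the common selection flag.
    zs : List (ℕ × ℕ)
    zs = zip ls ls'
    eq : length ls ≡ length ls'
    eq = trans (sym (sizes c)) (sizes c')
    p₁ : map proj₁ zs ≡ ls
    p₁ = map-proj₁-zip ls ls' eq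
    p₂ : map proj₂ zs ≡ ls'
    p₂ = map-proj₂-zip ls ls' eq
    ws : List (Bool × ℕ × ℕ)
    ws = zip m zs
    mem : ∀ {z} → z ∈ zs → ∃ λ b → (b , z) ∈ ws
    mem {z} i with ∈-map⁻ proj₂ (subst (z ∈_) (sym (map-proj₂-zip m zs (trans (sizes c') (sym (length-zip ls ls' eq))))) i)
    ... | (b , _) , j , refl = b , j

    module Side (f : ℕ × ℕ → ℕ) {l} (p : map f zs ≡ l) (c : Cut m l) where
      f∈ : ∀ {w} → w ∈ ws → map₂ f w ∈ zip m l
      f∈ i = subst (_ ∈_) (trans (sym (zip-map f m zs)) (cong (zip m) p)) (∈-map⁺ (map₂ f) i)
      f⊆ : ∀ {s} → s ⊆ ws → map (map₂ f) s ⊆ zip m l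
      f⊆ q = subst (_ ⊆_) (trans (sym (zip-map f m zs)) (cong (zip m) p)) (Sublistₚ.map⁺ (map₂ f) q)

      sat : ∀ {b b' x y} → (b , x) ∈ ws → (b' , y) ∈ ws → f x ≡ f y → b ≡ b'
      sat i j e = saturated c (f∈ i) (f∈ j) e

      sep : ∀ {y t z} → ((false , y) ∷ (true , t) ∷ (false , z) ∷ []) ⊆ ws → f y ≢ f z
      sep q e = unstraddled c (f⊆ q) e refl refl

      -- An instance of `inGaps` with the block label as colour. Which of the two entries starts the
      -- sublist depends on their order of occurrence, hence the cases of `∈-pair`.
      sameGap : ∀ {x y} → (false , x) ∈ ws → (false , y) ∈ ws → f x ≡ f y → ∃ λ r → r ∈ gaps ws × x ∈ r × y ∈ r
      sameGap {x} {y} i j e with ∈-pair i j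
      ... | inj₁ refl     = let r , k , q = inGaps f ws sep x [] (λ ()) (from∈ i) in r , k , lookup q (here refl) , lookup q (here refl)
      ... | inj₂ (inj₁ s) = let r , k , q = inGaps f ws sep x (y ∷ []) (λ { (here refl) → e }) s in
                            r , k , lookup q (here refl) , lookup q (there (here refl))
      ... | inj₂ (inj₂ s) = let r , k , q = inGaps f ws sep y (x ∷ []) (λ { (here refl) → sym e }) s in
                            r , k , lookup q (there (here refl)) , lookup q (here refl)

    module L = Side proj₁ p₁ c
    module R = Side proj₂ p₂ c'

  module _ (eQ : rg (sel m ls) ≡ rg (sel m ls')) (eJ : map rg (runs m ls) ≡ map rg (runs m ls')) where

    private
      kQ : SameKernel proj₁ proj₂ (chosen ws)
      kQ = rg⇒kernel proj₁ proj₂ (chosen ws) (begin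
        rg (map proj₁ (chosen ws)) ≡⟨ cong rg (piece proj₁ p₁) ⟩
        rg (sel m ls)              ≡⟨ eQ ⟩
        rg (sel m ls')             ≡⟨ cong rg (sym (piece proj₂ p₂)) ⟩
        rg (map proj₂ (chosen ws)) ∎)
        where
        open ≡-Reasoning
        piece : ∀ (f : ℕ × ℕ → ℕ) {l} → map f zs ≡ l → map f (chosen ws) ≡ sel m l
        piece f refl = trans (cong (map f) (sym (sel≡chosen m zs))) (sym (sel-map f m zs))

      kJ : ∀ {r} → r ∈ gaps ws → SameKernel proj₁ proj₂ r
      kJ {r} i = rg⇒kernel proj₁ proj₂ r (map-≡⁻ {Y = ℕ} (begin
        map (rg ∘ map proj₁) (gaps ws)  ≡⟨ Listₚ.map-∘ (gaps ws) ⟩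
        map rg (map (map proj₁) (gaps ws)) ≡⟨ cong (map rg) (piece proj₁ p₁) ⟩
        map rg (runs m ls)              ≡⟨ eJ ⟩
        map rg (runs m ls')             ≡⟨ cong (map rg) (sym (piece proj₂ p₂)) ⟩
        map rg (map (map proj₂) (gaps ws)) ≡⟨ sym (Listₚ.map-∘ (gaps ws)) ⟩
        map (rg ∘ map proj₂) (gaps ws)  ∎) i)
        where
        open ≡-Reasoning
        piece : ∀ (f : ℕ × ℕ → ℕ) {l} → map f zs ≡ l → map (map f) (gaps ws) ≡ runs m l
        piece f refl = trans (cong (map (map f)) (sym (runs≡gaps m zs))) (sym (runs-map f m zs))

      chosen∈ : ∀ {vs : List (Bool × ℕ × ℕ)} {x} → (true , x) ∈ vs → x ∈ chosen vs
      chosen∈ {vs} i = lookup (⊆-chosen vs (from∈ i)) (here refl)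

      -- Two selected positions are compared inside the selected piece. A selected and an unselected
      -- one lie in different blocks on both sides, by saturation. Two unselected ones in a common
      -- block lie in one gap, and the piece on that gap decides.
      kernel : SameKernel proj₁ proj₂ zs
      kernel {x} {y} i j with mem i | mem j
      ... | true  , a | true  , b = kQ (chosen∈ a) (chosen∈ b)
      ... | true  , a | false , b = (λ e → case L.sat a b e of λ ()) , (λ e → case R.sat a b e of λ ())
      ... | false , a | true  , b = (λ e → case L.sat a b e of λ ()) , (λ e → case R.sat a b e of λ ())
      ... | false , a | false , b =
          (λ e → let r , k , u , v = L.sameGap a b e in proj₁ (kJ k u v) e)
        , (λ e → let r , k , u , v = R.sameGap a b e in proj₂ (kJ k u v) e)

    pieces-injective : T (isRGS ls) → T (isRGS ls') → ls ≡ ls'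
    pieces-injective t t' = begin
      ls                 ≡⟨ sym (RGS⇒rg ls t) ⟩
      rg ls              ≡⟨ cong rg (sym p₁) ⟩
      rg (map proj₁ zs)  ≡⟨ kernel⇒rg proj₁ proj₂ zs kernel ⟩
      rg (map proj₂ zs)  ≡⟨ cong rg p₂ ⟩
      rg ls'             ≡⟨ RGS⇒rg ls' t' ⟩
      ls'                ∎
      where open ≡-Reasoning

-- Mask and pieces together recover the partition (`pieces-injective`), so different partitions
-- never yield the same triple.
headCuts-unique : ∀ n → Unique (headCuts n)
headCuts-unique n =
  unique-concatMap _ (ncParts-unique n)
    (λ {L} _ → Uniqueₚ.map⁺ (cong proj₁) (cutsHead-unique L))
    λ {L} {L'} l l' i j → case (∈-map⁻ (λ m → pieces m L) i , ∈-map⁻ (λ m → pieces m L') j) of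
      λ { ((m , k , e) , (m' , k' , e')) → same l l' k k' (trans (sym e) e') }
  where
  same : ∀ {L L' m m'} → L ∈ ncParts n → L' ∈ ncParts n → m ∈ cutsHead L → m' ∈ cutsHead L' →
         pieces m L ≡ pieces m' L' → L ≡ L'
  same {L} {L'} {m} l l' k k' e with cong proj₁ e
  ... | refl = pieces-injective (proj₁ (cutsHead⁻ nc k)) (proj₁ (cutsHead⁻ nc' k'))
                 (cong (proj₁ ∘ proj₂) e) (cong (proj₂ ∘ proj₂) e) (rgs nc) (rgs nc')
    where
    nc  = ∈-ncParts⁻ n l
    nc' = ∈-ncParts⁻ n l'

sel-isNC : ∀ m L → NonX id L → IsNC (length (sel m L)) (rg (sel m L))
sel-isNC m L nx = subst (λ l → IsNC (length (sel m L)) (rg l)) (Listₚ.map-id (sel m L))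
                    (rg-isNC id (sel m L) (NonX-⊆ (sel-⊆ m L) nx))

runs-isNC : ∀ m L → NonX id L → Pointwise IsNC (map length (runs m L)) (map rg (runs m L))
runs-isNC m L nx = go (runs m L) (runs-⊆ m L)
  where
  go : ∀ rs → (∀ {r} → r ∈ rs → r ⊆ L) → Pointwise IsNC (map length rs) (map rg rs)
  go []       h = []
  go (r ∷ rs) h = subst (λ l → IsNC (length r) (rg l)) (Listₚ.map-id r) (rg-isNC id r (NonX-⊆ (h (here refl)) nx))
                  ∷ go rs (h ∘ there)

headCuts⊆headPieces : ∀ {x} {X : Set x} (y : X) ys {p} → p ∈ headCuts (suc (length ys)) → p ∈ headPieces y ys
headCuts⊆headPieces y ys i with ∈-concatMap⁻ _ (ncParts (suc (length ys))) i
... | L , l , j with ∈-map⁻ (λ m → pieces m L) j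
...   | m , k , refl with ∈-ncParts⁻ (suc (length ys)) l
...     | nc with cutsHead⁻ nc k
...       | c , m' , refl =
  ∈-headPieces⁺ y ys (ℕₚ.suc-injective (trans (sizes c) (size nc)))
    (subst (λ n → IsNC n (rg (sel (true ∷ m') L))) (length-sel (true ∷ m') L (y ∷ ys) (size nc)) (sel-isNC (true ∷ m') L nx))
    (subst (λ n → Pointwise IsNC n (map rg (runs (true ∷ m') L))) (length-runs (true ∷ m') L (y ∷ ys) (size nc)) (runs-isNC (true ∷ m') L nx))
  where
  nx : NonX id L
  nx = pos⇒NonX L (nonCrossing⇒pos L (noncrossing nc))

-- `zs` serves as a template that fixes where the labels of `Q`, `F` and `R` go. The first gap is a
-- separate argument because a selected letter closes it and takes the next open gap from the front
-- of `R`.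
assemble : ∀ {x} {X : Set x} (zs : List (Bool × X)) Q F R → length Q ≡ length (chosen zs) →
           length F ≡ length (firstGap zs) → map length R ≡ map length (laterGaps zs) →
           ∃ λ (ps : List (Bool × ℕ)) → map proj₁ ps ≡ map proj₁ zs
             × chosen ps ≡ Q × firstGap ps ≡ F × laterGaps ps ≡ R

splitGaps : ∀ {x} {X : Set x} (f : List X) r {G : List (List ℕ)} → map length G ≡ map length (close f ++ r) →
            ∃ λ F → ∃ λ R → length F ≡ length f × map length R ≡ map length r × G ≡ close F ++ R
splitGaps []      r {G}     e = [] , G , refl , e , refl
splitGaps (y ∷ f) r {[] ∷ G} ()
splitGaps (y ∷ f) r {(g ∷ F) ∷ R} e = g ∷ F , R , Listₚ.∷-injectiveˡ e , Listₚ.∷-injectiveʳ e , refl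

assemble []                 []      []      []      eQ eF eR = [] , refl , refl , refl , refl
assemble ((true  , _) ∷ zs) (q ∷ Q) []      G       eQ eF eR with splitGaps (firstGap zs) (laterGaps zs) eR
... | F , R , eF' , eR' , refl with assemble zs Q F R (ℕₚ.suc-injective eQ) eF' eR'
...   | ps , a , b , c , d = (true , q) ∷ ps , cong (true ∷_) a , cong (q ∷_) b , refl , cong₂ (λ f r → close f ++ r) c d
assemble ((false , _) ∷ zs) Q       (g ∷ F) R       eQ eF eR with assemble zs Q F R eQ (ℕₚ.suc-injective eF) eR
... | ps , a , b , c , d = (false , g) ∷ ps , cong (false ∷_) a , b , cong (g ∷_) c , d

assembleGaps : ∀ {x} {X : Set x} (zs : List (Bool × X)) {Q G} → length Q ≡ length (chosen zs) →
               map length G ≡ map length (gaps zs) →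
               ∃ λ (ps : List (Bool × ℕ)) → map proj₁ ps ≡ map proj₁ zs × chosen ps ≡ Q × gaps ps ≡ G
assembleGaps zs eQ eG with splitGaps (firstGap zs) (laterGaps zs) eG
... | F , R , eF , eR , refl with assemble zs _ F R eQ eF eR
...   | ps , a , b , c , d = ps , a , b , cong₂ (λ f r → close f ++ r) c d

-- Selected entries get tag 0, and an entry of a gap the number (from suc k on) of selected
-- entries before it, so that distinct gaps have distinct tags.
tag : ℕ → List (Bool × ℕ) → List (Bool × ℕ × ℕ)
tag k []                 = []
tag k ((true  , y) ∷ zs) = (true , 0 , y) ∷ tag (suc k) zs
tag k ((false , y) ∷ zs) = (false , suc k , y) ∷ tag k zs

untag : ∀ k zs → map (map₂ proj₂) (tag k zs) ≡ zs
untag k []                 = refl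
untag k ((true  , y) ∷ zs) = cong (_ ∷_) (untag (suc k) zs)
untag k ((false , y) ∷ zs) = cong (_ ∷_) (untag k zs)

tag-true : ∀ k zs {t y} → (true , t , y) ∈ tag k zs → t ≡ 0
tag-true k ((true  , y) ∷ zs) (here refl) = refl
tag-true k ((true  , y) ∷ zs) (there i)   = tag-true (suc k) zs i
tag-true k ((false , y) ∷ zs) (there i)   = tag-true k zs i

tag-false : ∀ k zs {t y} → (false , t , y) ∈ tag k zs → k < t
tag-false k ((true  , y) ∷ zs) (there i)   = ℕₚ.<-trans (ℕₚ.n<1+n k) (tag-false (suc k) zs i)
tag-false k ((false , y) ∷ zs) (here refl) = ℕₚ.≤-refl
tag-false k ((false , y) ∷ zs) (there i)   = tag-false k zs i

tag-mask : ∀ k zs {b b' t y y'} → (b , t , y) ∈ tag k zs → (b' , t , y') ∈ tag k zs → b ≡ b'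
tag-mask k zs {true}  {true}  i j = refl
tag-mask k zs {false} {false} i j = refl
tag-mask k zs {true}  {false} i j with refl ← tag-true k zs i | () ← tag-false k zs j
tag-mask k zs {false} {true}  i j with refl ← tag-true k zs j | () ← tag-false k zs i

tag-after : ∀ k zs {w t y} → ((true , w) ∷ (false , t , y) ∷ []) ⊆ tag k zs → suc k < t
tag-after k ((true  , y) ∷ zs) (refl ∷ p) = tag-false (suc k) zs (lookup p (here refl))
tag-after k ((true  , y) ∷ zs) (_ ∷ʳ p)   = ℕₚ.<-trans (ℕₚ.n<1+n _) (tag-after (suc k) zs p)
tag-after k ((false , y) ∷ zs) (_ ∷ʳ p)   = tag-after k zs p

-- The selected entry in the middle raises the counter. This is the source both of the cut being
-- unstraddled and of the absence of crossings between different pieces.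
tag-straddle : ∀ k zs {t y w t' y'} → ((false , t , y) ∷ (true , w) ∷ (false , t' , y') ∷ []) ⊆ tag k zs → t < t'
tag-straddle k ((true  , y) ∷ zs) (_ ∷ʳ p)   = tag-straddle (suc k) zs p
tag-straddle k ((false , y) ∷ zs) (refl ∷ p) = tag-after k zs p
tag-straddle k ((false , y) ∷ zs) (_ ∷ʳ p)   = tag-straddle k zs p

tag-mono : ∀ k zs {t y t' y'} → ((false , t , y) ∷ (false , t' , y') ∷ []) ⊆ tag k zs → t ≤ t'
tag-mono k ((true  , y) ∷ zs) (_ ∷ʳ p)   = tag-mono (suc k) zs p
tag-mono k ((false , y) ∷ zs) (refl ∷ p) = tag-false k zs (lookup p (here refl))
tag-mono k ((false , y) ∷ zs) (_ ∷ʳ p)   = tag-mono k zs p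

tag-firstGap : ∀ k zs {x} → x ∈ firstGap (tag k zs) → proj₁ x ≡ suc k
tag-firstGap k ((false , y) ∷ zs) (here refl) = refl
tag-firstGap k ((false , y) ∷ zs) (there i)   = tag-firstGap k zs i

tag-gaps : ∀ k zs {r} → r ∈ gaps (tag k zs) → ∃ λ t → ∀ {x} → x ∈ r → proj₁ x ≡ t
tag-laterGaps : ∀ k zs {r} → r ∈ laterGaps (tag k zs) → ∃ λ t → ∀ {x} → x ∈ r → proj₁ x ≡ t
tag-gaps k zs i with ∈-++⁻ (close (firstGap (tag k zs))) i
... | inj₁ j with refl , _ ← ∈-close⁻ j = suc k , tag-firstGap k zs
... | inj₂ j = tag-laterGaps k zs j
tag-laterGaps k ((true  , y) ∷ zs) i = tag-gaps (suc k) zs i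
tag-laterGaps k ((false , y) ∷ zs) i = tag-laterGaps k zs i

Pointwise-IsNC : ∀ {ns J} → Pointwise IsNC ns J → ∀ {r} → r ∈ J → ∃ λ k → IsNC k r
Pointwise-IsNC (p ∷ ps) (here refl) = _ , p
Pointwise-IsNC (p ∷ ps) (there i)   = Pointwise-IsNC ps i

module _ (ps : List (Bool × ℕ)) (ncQ : IsNC (length (chosen ps)) (chosen ps))
         (ncJ : ∀ {r} → r ∈ gaps ps → ∃ λ k → IsNC k r) where

  private
    ws = tag 0 ps
    V  = map proj₂ ws

    ≟-pair : DecidableEquality (ℕ × ℕ)
    ≟-pair = Productₚ.≡-dec ℕₚ._≟_ ℕₚ._≟_

    -- Blocks of the assembled partition are named by pairs of tag and old label, which keeps blocks
    -- of different pieces apart. The position in `V` turns such a pair into a number, and `rg` then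
    -- makes the result a growth string.
    encoding : ∃ λ (χ : ℕ × ℕ → ℕ) → rg (map (position ≟-pair V) V) ≡ map χ V
               × (∀ {x y} → x ∈ V → y ∈ V → χ x ≡ χ y → x ≡ y)
    encoding with rg-relabel (map (position ≟-pair V) V)
    ... | ψ , e , inj = ψ ∘ position ≟-pair V , trans e (sym (Listₚ.map-∘ V)) ,
      λ i j h → position-injective ≟-pair V i j (inj (∈-map⁺ _ i) (∈-map⁺ _ j) h)

    χ = proj₁ encoding

    χ-inj : ∀ {x y} → x ∈ ws → y ∈ ws → χ (proj₂ x) ≡ χ (proj₂ y) → proj₂ x ≡ proj₂ y
    χ-inj i j = proj₂ (proj₂ encoding) (∈-map⁺ proj₂ i) (∈-map⁺ proj₂ j)

  assembled : List ℕ
  assembled = map χ V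

  private
    m = map proj₁ ps

    m≡ : m ≡ map proj₁ ws
    m≡ = trans (cong (map proj₁) (sym (untag 0 ps))) (sym (Listₚ.map-∘ ws))

    zip≡ : zip m assembled ≡ map (map₂ χ) ws
    zip≡ = trans (cong (λ m → zip m assembled) m≡) (trans (zip-map χ (map proj₁ ws) V) (cong (map (map₂ χ)) (go ws)))
      where
      go : ∀ (ws : List (Bool × ℕ × ℕ)) → zip (map proj₁ ws) (map proj₂ ws) ≡ ws
      go []       = refl
      go (w ∷ ws) = cong (w ∷_) (go ws)

    chosen≡ : map proj₂ (chosen ws) ≡ chosen ps
    chosen≡ = trans (sym (chosen-map proj₂ ws)) (cong chosen (untag 0 ps))

    gaps≡ : map (map proj₂) (gaps ws) ≡ gaps ps
    gaps≡ = trans (sym (gaps-map proj₂ ws)) (cong gaps (untag 0 ps))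

    chosen∈ : ∀ {x} → x ∈ chosen ws → (true , x) ∈ ws
    chosen∈ i = lookup (chosen-⊆ ws) (∈-map⁺ (true ,_) i)

    gaps∈ : ∀ {r x} → r ∈ gaps ws → x ∈ r → (false , x) ∈ ws
    gaps∈ k i = lookup (gaps-⊆ ws k) (∈-map⁺ (false ,_) i)

  assembled-length : length assembled ≡ length ps
  assembled-length = begin
    length (map χ V)  ≡⟨ Listₚ.length-map χ V ⟩
    length V          ≡⟨ Listₚ.length-map proj₂ ws ⟩
    length ws         ≡⟨ sym (Listₚ.length-map (map₂ proj₂) ws) ⟩
    length (map (map₂ proj₂) ws) ≡⟨ cong length (untag 0 ps) ⟩
    length ps         ∎
    where open ≡-Reasoning

  assembled-sel : rg (sel m assembled) ≡ chosen ps
  assembled-sel = begin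
    rg (sel m assembled)          ≡⟨ cong rg (sel≡chosen m assembled) ⟩
    rg (chosen (zip m assembled)) ≡⟨ cong (rg ∘ chosen) zip≡ ⟩
    rg (chosen (map (map₂ χ) ws)) ≡⟨ cong rg (chosen-map χ ws) ⟩
    rg (map χ (chosen ws))        ≡⟨ kernel⇒rg χ proj₂ (chosen ws) kernel ⟩
    rg (map proj₂ (chosen ws))    ≡⟨ cong rg chosen≡ ⟩
    rg (chosen ps)                ≡⟨ RGS⇒rg (chosen ps) (rgs ncQ) ⟩
    chosen ps                     ∎
    where
    open ≡-Reasoning
    kernel : SameKernel χ proj₂ (chosen ws)
    kernel i j = (λ e → cong proj₂ (χ-inj (chosen∈ i) (chosen∈ j) e)) ,
      λ e → cong χ (cong₂ _,_ (trans (tag-true 0 ps (chosen∈ i)) (sym (tag-true 0 ps (chosen∈ j)))) e)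

  assembled-runs : map rg (runs m assembled) ≡ gaps ps
  assembled-runs = begin
    map rg (runs m assembled)          ≡⟨ cong (map rg) (runs≡gaps m assembled) ⟩
    map rg (gaps (zip m assembled))    ≡⟨ cong (map rg ∘ gaps) zip≡ ⟩
    map rg (gaps (map (map₂ χ) ws))    ≡⟨ cong (map rg) (gaps-map χ ws) ⟩
    map rg (map (map χ) (gaps ws))     ≡⟨ sym (Listₚ.map-∘ (gaps ws)) ⟩
    map (rg ∘ map χ) (gaps ws)         ≡⟨ map-cong-∈ (gaps ws) (λ {r} k → kernel⇒rg χ proj₂ r (kernel k)) ⟩
    map (rg ∘ map proj₂) (gaps ws)     ≡⟨ Listₚ.map-∘ (gaps ws) ⟩
    map rg (map (map proj₂) (gaps ws)) ≡⟨ cong (map rg) gaps≡ ⟩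
    map rg (gaps ps)                   ≡⟨ map-cong-∈ (gaps ps) (λ {r} k → RGS⇒rg r (rgs (proj₂ (ncJ k)))) ⟩
    map id (gaps ps)                   ≡⟨ Listₚ.map-id (gaps ps) ⟩
    gaps ps                            ∎
    where
    open ≡-Reasoning
    kernel : ∀ {r} → r ∈ gaps ws → SameKernel χ proj₂ r
    kernel k i j with tag-gaps 0 ps k
    ... | t , h = (λ e → cong proj₂ (χ-inj (gaps∈ k i) (gaps∈ k j) e)) , λ e → cong χ (cong₂ _,_ (trans (h i) (sym (h j))) e)

  assembled-cut : Cut m assembled
  assembled-cut = record
    { sizes       = trans (Listₚ.length-map proj₁ ps) (sym assembled-length)
    ; saturated   = subst Saturated (sym zip≡) sat
    ; unstraddled = subst Unstraddled (sym zip≡) uns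
    }
    where
    sat : Saturated (map (map₂ χ) ws)
    sat i j e with ∈-map⁻ (map₂ χ) i | ∈-map⁻ (map₂ χ) j
    ... | (b , t , y) , k , refl | (b' , _) , l , refl with refl ← χ-inj k l e = tag-mask 0 ps k l
    uns : Unstraddled (map (map₂ χ) ws)
    uns p e refl refl with ⊆-map⁻ (map₂ χ) ws p
    ... | (false , t , y) ∷ (true , w) ∷ (false , t' , y') ∷ [] , q , refl =
      ℕₚ.<-irrefl (cong proj₁ (χ-inj (lookup q (here refl)) (lookup q (there (there (here refl)))) e)) (tag-straddle 0 ps q)
    ... | (false , t , y) ∷ (true , w) ∷ (true , t' , y') ∷ [] , q , refl
      with () ← sat (∈-map⁺ (map₂ χ) (lookup q (here refl))) (∈-map⁺ (map₂ χ) (lookup q (there (there (here refl))))) e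

  private
    -- A pattern x, y, x, y is treated by its flags. Both selected: the selected piece is
    -- non-crossing. Only one selected: the other would recur with the same tag across a selected
    -- entry, contradicting `tag-straddle`. Neither selected: tags increase weakly, so all four
    -- entries lie in one gap, whose piece is non-crossing.
    noncrossing-pairs : ∀ {x y z w} → (x ∷ y ∷ z ∷ w ∷ []) ⊆ ws → proj₂ x ≡ proj₂ z → proj₂ y ≡ proj₂ w →
                        proj₂ x ≡ proj₂ y
    noncrossing-pairs {b₁ , x} {b₂ , y} {b₃ , _} {b₄ , _} p refl refl
      with refl ← tag-mask 0 ps (lookup p (here refl)) (lookup p (there (there (here refl))))
         | refl ← tag-mask 0 ps (lookup p (there (here refl))) (lookup p (there (there (there (here refl)))))
      = go b₁ b₂ p
      where
      go : ∀ b c → ((b , x) ∷ (c , y) ∷ (b , x) ∷ (c , y) ∷ []) ⊆ ws → x ≡ y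
      go true true p =
        cong₂ _,_ (trans (tag-true 0 ps (lookup p (here refl))) (sym (tag-true 0 ps (lookup p (there (here refl))))))
          (NonX-map⁻ proj₂ (subst (NonX id) (sym chosen≡) (pos⇒NonX (chosen ps) (nonCrossing⇒pos (chosen ps) (noncrossing ncQ))))
            (⊆-chosen ws p) refl refl)
      go true false p = ⊥-elim (ℕₚ.<-irrefl refl (tag-straddle 0 ps (⊆-trans (_ ∷ʳ ⊆-refl) p)))
      go false true p = ⊥-elim (ℕₚ.<-irrefl refl (tag-straddle 0 ps (⊆-trans (refl ∷ refl ∷ refl ∷ _ ∷ʳ []) p)))
      go false false p = cong₂ _,_ t≡ (inRun (inGaps proj₁ ws sep x (y ∷ x ∷ y ∷ []) const p))
        where
        t≡ : proj₁ x ≡ proj₁ y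
        t≡ = ℕₚ.≤-antisym (tag-mono 0 ps (⊆-trans (refl ∷ refl ∷ []⊆) p))
                          (tag-mono 0 ps (⊆-trans (_ ∷ʳ refl ∷ refl ∷ []⊆) p))
        sep : ∀ {y t z} → ((false , y) ∷ (true , t) ∷ (false , z) ∷ []) ⊆ ws → proj₁ y ≢ proj₁ z
        sep q e = ℕₚ.<-irrefl e (tag-straddle 0 ps q)
        const : ∀ {z} → z ∈ (y ∷ x ∷ y ∷ []) → proj₁ x ≡ proj₁ z
        const (here refl)                 = t≡
        const (there (here refl))         = refl
        const (there (there (here refl))) = t≡
        inRun : (∃ λ r → r ∈ gaps ws × (x ∷ y ∷ x ∷ y ∷ []) ⊆ r) → proj₂ x ≡ proj₂ y
        inRun (r , k , q) = NonX-map⁻ proj₂ (pos⇒NonX r' (nonCrossing⇒pos r' (noncrossing (proj₂ (ncJ r'∈))))) q refl refl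
          where
          r' = map proj₂ r
          r'∈ : r' ∈ gaps ps
          r'∈ = subst (r' ∈_) gaps≡ (∈-map⁺ (map proj₂) k)

  assembled-isNC : IsNC (length ps) assembled
  assembled-isNC = isNC assembled-length
    (subst (T ∘ isRGS) (proj₁ (proj₂ encoding)) (rg-RGS (map (position ≟-pair V) V)))
    (subst (T ∘ nonCrossing) (Listₚ.map-∘ ws) (NonX⇒nonCrossing (χ ∘ proj₂) ws
      λ p e₁ e₂ → cong χ (noncrossing-pairs p (χ-inj (lookup p (here refl)) (lookup p (there (there (here refl)))) e₁)
                            (χ-inj (lookup p (there (here refl))) (lookup p (there (there (there (here refl))))) e₂))))

module _ {x} {X : Set x} (y : X) (ys : List X) where

  headPieces⊆headCuts : ∀ {p} → p ∈ headPieces y ys → p ∈ headCuts (suc (length ys))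
  headPieces⊆headCuts i with ∈-headPieces⁻ y ys i
  ... | m , Q , J , refl , em , ncQ , ncJ
    with assembleGaps (zip (true ∷ m) (y ∷ ys)) {Q} {J}
           (trans (size ncQ) (cong length (sel≡chosen (true ∷ m) (y ∷ ys))))
           (trans (sizes-IsNC ncJ) (cong (map length) (runs≡gaps (true ∷ m) (y ∷ ys))))
    where
    sizes-IsNC : ∀ {ns J} → Pointwise IsNC ns J → map length J ≡ ns
    sizes-IsNC []       = refl
    sizes-IsNC (p ∷ ps) = cong₂ _∷_ (size p) (sizes-IsNC ps)
  ... | ps , em' , refl , refl =
    subst (_∈ headCuts (suc (length ys)))
      (cong₂ _,_ m≡ (cong₂ _,_ (assembled-sel ps nc₁ nc₂) (assembled-runs ps nc₁ nc₂)))
      (∈-concatMap⁺ _ (∈-ncParts⁺ (subst (λ n → IsNC n L) n≡ (assembled-isNC ps nc₁ nc₂))) (∈-map⁺ (λ m → pieces m L) m∈))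
    where
    nc₁ : IsNC (length (chosen ps)) (chosen ps)
    nc₁ = isNC refl (rgs ncQ) (noncrossing ncQ)
    nc₂ : ∀ {r} → r ∈ gaps ps → ∃ λ k → IsNC k r
    nc₂ = Pointwise-IsNC ncJ
    L = assembled ps nc₁ nc₂
    m≡ : map proj₁ ps ≡ true ∷ m
    m≡ = trans em' (cong (true ∷_) (map-proj₁-zip m ys em))
    n≡ : length ps ≡ suc (length ys)
    n≡ = trans (sym (Listₚ.length-map proj₁ ps)) (trans (cong length m≡) (cong suc em))
    m∈ : map proj₁ ps ∈ cutsHead L
    -- `cutsHead` computes only on a visibly non-empty list; the length equation excludes the empty
    -- one.
    m∈ with L | trans (assembled-length ps nc₁ nc₂) n≡ | subst (λ m → Cut m L) m≡ (assembled-cut ps nc₁ nc₂)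
    ... | l ∷ ls | _ | c = subst (_∈ cutsHead (l ∷ ls)) (sym m≡) (∈-cuts⁺⁺ c)

-- Duplicate-free lists with the same members are permutations of each other. This is the
-- combinatorial input for the compatibility of the splitting map with `δ⁺≺`.
headCuts↭headPieces : ∀ {x} {X : Set x} (y : X) ys → headCuts (suc (length ys)) ↭ headPieces y ys
headCuts↭headPieces y ys =
  ∼bag⇒↭ (unique∧set⇒bag (headCuts-unique (suc (length ys))) (headPieces-unique y ys)
    (mk⇔ (headCuts⊆headPieces y ys) (headPieces⊆headCuts y ys)))

-- Fixed points of κ ≺ ·

module Sums {c ℓ a ℓa} (K : Field c ℓ) (A : KAlgebra K a ℓa) where
  open Setup K A
  private module F = Field K
  open F hiding (refl; sym; trans)
  open Ringₚ ring using (-0#≈0#; -‿+-comm)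
  open CommSemiₚ +-commutativeSemigroup using (interchange; x∙yz≈y∙xz)
  open SetoidReasoning setoid

  x-0≈x : ∀ x → x - 0# ≈ x
  x-0≈x x = F.trans (+-congˡ -0#≈0#) (+-identityʳ x)

  module _ {y} {Y : Set y} where

    Σ-cong : ∀ (ys : List Y) {f g : Y → Carrier} → (∀ {z} → z ∈ ys → f z ≈ g z) → Σ[ ys ] f ≈ Σ[ ys ] g
    Σ-cong []       h = F.refl
    Σ-cong (z ∷ ys) h = +-cong (h (here refl)) (Σ-cong ys (h ∘ there))

    Σ-zero : ∀ (ys : List Y) {f : Y → Carrier} → (∀ {z} → z ∈ ys → f z ≈ 0#) → Σ[ ys ] f ≈ 0#
    Σ-zero []       h = F.refl
    Σ-zero (z ∷ ys) h = F.trans (+-cong (h (here refl)) (Σ-zero ys (h ∘ there))) (+-identityˡ 0#)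

    Σ-++ : ∀ (xs ys : List Y) (f : Y → Carrier) → Σ[ xs ++ ys ] f ≈ Σ[ xs ] f + Σ[ ys ] f
    Σ-++ []       ys f = F.sym (+-identityˡ _)
    Σ-++ (x ∷ xs) ys f = F.trans (+-congˡ (Σ-++ xs ys f)) (F.sym (+-assoc _ _ _))

    Σ-+ : ∀ (ys : List Y) (f g : Y → Carrier) → Σ[ ys ] (λ z → f z + g z) ≈ Σ[ ys ] f + Σ[ ys ] g
    Σ-+ []       f g = F.sym (+-identityˡ 0#)
    Σ-+ (z ∷ ys) f g = F.trans (+-congˡ (Σ-+ ys f g)) (interchange _ _ _ _)

    Σ-neg : ∀ (ys : List Y) (f : Y → Carrier) → Σ[ ys ] (λ z → - f z) ≈ - Σ[ ys ] f
    Σ-neg []       f = F.sym -0#≈0#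
    Σ-neg (z ∷ ys) f = F.trans (+-congˡ (Σ-neg ys f)) (-‿+-comm _ _)

    Σ-*ˡ : ∀ (ys : List Y) (f : Y → Carrier) x → Σ[ ys ] (λ z → x * f z) ≈ x * Σ[ ys ] f
    Σ-*ˡ []       f x = F.sym (zeroʳ x)
    Σ-*ˡ (z ∷ ys) f x = F.trans (+-congˡ (Σ-*ˡ ys f x)) (F.sym (distribˡ _ _ _))

    Σ-*ʳ : ∀ (ys : List Y) (f : Y → Carrier) x → Σ[ ys ] (λ z → f z * x) ≈ Σ[ ys ] f * x
    Σ-*ʳ []       f x = F.sym (zeroˡ x)
    Σ-*ʳ (z ∷ ys) f x = F.trans (+-congˡ (Σ-*ʳ ys f x)) (F.sym (distribʳ _ _ _))

    Σ-↭ : ∀ {xs ys : List Y} (f : Y → Carrier) → xs ↭ ys → Σ[ xs ] f ≈ Σ[ ys ] f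
    Σ-↭ f Perm.refl         = F.refl
    Σ-↭ f (Perm.prep x p)   = +-congˡ (Σ-↭ f p)
    Σ-↭ f (Perm.swap x y p) = F.trans (x∙yz≈y∙xz _ _ _) (+-congˡ (+-congˡ (Σ-↭ f p)))
    Σ-↭ f (Perm.trans p q)  = F.trans (Σ-↭ f p) (Σ-↭ f q)

    Σ-single : ∀ {ys : List Y} (f : Y → Carrier) {z} → Unique ys → z ∈ ys →
               (∀ {w} → w ∈ ys → w ≢ z → f w ≈ 0#) → Σ[ ys ] f ≈ f z
    Σ-single {z ∷ ys} f u (here refl) h =
      F.trans (+-congˡ (Σ-zero ys λ i → h (there i) λ e → ∉-∷ u (subst (_∈ ys) e i))) (+-identityʳ _)
    Σ-single {x ∷ ys} f u (there j) h =
      F.trans (+-cong (h (here refl) λ e → ∉-∷ u (subst (_∈ ys) (sym e) j))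
                    (Σ-single f (unique-tail u) j (h ∘ there)))
            (+-identityˡ _)

  module _ {x y} {X : Set x} {Y : Set y} where

    Σ-map : ∀ (g : X → Y) xs (f : Y → Carrier) → Σ[ map g xs ] f ≡ Σ[ xs ] (f ∘ g)
    Σ-map g []       f = refl
    Σ-map g (x ∷ xs) f = cong (f (g x) +_) (Σ-map g xs f)

    Σ-concatMap : ∀ (g : X → List Y) xs (f : Y → Carrier) → Σ[ concatMap g xs ] f ≈ Σ[ xs ] (λ x → Σ[ g x ] f)
    Σ-concatMap g []       f = F.refl
    Σ-concatMap g (x ∷ xs) f = F.trans (Σ-++ (g x) _ f) (+-congˡ (Σ-concatMap g xs f))

    Σ-swap : ∀ xs ys (f : X → Y → Carrier) →
             Σ[ xs ] (λ x → Σ[ ys ] (λ y → f x y)) ≈ Σ[ ys ] (λ y → Σ[ xs ] (λ x → f x y))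
    Σ-swap []       ys f = F.sym (Σ-zero ys λ _ → F.refl)
    Σ-swap (x ∷ xs) ys f = F.trans (+-congˡ (Σ-swap xs ys f)) (F.sym (Σ-+ ys _ _))

  Σ-upTo-suc : ∀ N (f : ℕ → Carrier) → Σ[ upTo (suc N) ] f ≈ f 0 + Σ[ upTo N ] (f ∘ suc)
  Σ-upTo-suc N f = +-congˡ (reflexive (trans (cong (λ ys → Σ[ ys ] f) (sym (Listₚ.map-upTo suc N))) (Σ-map suc (upTo N) f)))

  Σ-upTo-extend : ∀ {M N} (f : ℕ → Carrier) → M ≤ N → (∀ n → M ≤ n → f n ≈ 0#) → Σ[ upTo N ] f ≈ Σ[ upTo M ] f
  Σ-upTo-extend {N = N} f z≤n h = Σ-zero (upTo N) λ {n} _ → h n z≤n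
  Σ-upTo-extend {suc M} {suc N} f (s≤s p) h = begin
    Σ[ upTo (suc N) ] f              ≈⟨ Σ-upTo-suc N f ⟩
    f 0 + Σ[ upTo N ] (f ∘ suc)      ≈⟨ +-congˡ (Σ-upTo-extend (f ∘ suc) p (λ n q → h (suc n) (s≤s q))) ⟩
    f 0 + Σ[ upTo M ] (f ∘ suc)      ≈⟨ Σ-upTo-suc M f ⟨
    Σ[ upTo (suc M) ] f              ∎

  -- `head-shape` provides the descent in degree for all recursions below. Tested against every
  -- form, `counit-head` says that `l ⊗ 𝟏` is what remains of `δ⁺≺ l` when the right factor is
  -- trivial, and `counit` that `𝟏 ⊗ l` is what remains of `δ l` when the left factor is trivial.
  record Unshuffle {L : Set a} (δ⁺≺ δ : L → List (List L × List L)) (len : L → ℕ) : Set (Level.suc Level.zero ⊔ a ⊔ c ⊔ ℓ) where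
    open Dendriform δ⁺≺ δ len using (Form; e; deg)
    field
      Valid        : L → Set
      len-pos      : ∀ {l} → Valid l → 0 < len l
      head-shape   : ∀ {l p} → Valid l → p ∈ δ⁺≺ l →
                     ∃ λ x → proj₁ p ≡ x ∷ [] × Valid x × All Valid (proj₂ p) × len x ℕ.+ deg (proj₂ p) ≡ len l
      left-valid   : ∀ {l p} → Valid l → p ∈ δ l → All Valid (proj₁ p)
      counit-head  : ∀ {l} → Valid l → (f : Form) → Σ[ δ⁺≺ l ] (λ p → f (proj₁ p) * e (proj₂ p)) ≈ f (l ∷ [])
      counit       : ∀ {l} → Valid l → (f : Form) → Σ[ δ l ] (λ p → e (proj₁ p) * f (proj₂ p)) ≈ f (l ∷ [])

  module FixedPoint {L : Set a} {δ⁺≺ δ : L → List (List L × List L)} {len : L → ℕ}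
                    (U : Unshuffle δ⁺≺ δ len) where
    open Unshuffle U
    open Dendriform δ⁺≺ δ len

    ValidWord : List L → Set a
    ValidWord = All Valid

    _≃_ : Form → Form → Set (a ⊔ ℓ)
    f ≃ g = ∀ w → ValidWord w → f w ≈ g w

    record Inf (κ : Form) : Set (a ⊔ ℓ) where
      field
        at-𝟏      : κ [] ≈ 0#
        at-proper : ∀ x y u → ValidWord (x ∷ y ∷ u) → κ (x ∷ y ∷ u) ≈ 0#
    open Inf

    -- For infinitesimal κ this is κ ≺ g: in Δ⁺≺(l ∷ w) = Δ⁺≺(l) Δ(w) only the terms taking nothing
    -- from w into the left factor survive.
    infixl 7 _⊛_
    _⊛_ : Form → Form → Form
    (κ ⊛ g) []      = 0#
    (κ ⊛ g) (l ∷ w) = Σ[ δ⁺≺ l ] λ p → κ (proj₁ p) * g (proj₂ p ++ w)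

    e-++ : ∀ u v → e (u ++ v) ≈ e u * e v
    e-++ []      v = F.sym (*-identityˡ _)
    e-++ (x ∷ u) v = F.sym (zeroˡ _)

    deg-++ : ∀ u v → deg (u ++ v) ≡ deg u ℕ.+ deg v
    deg-++ []      v = refl
    deg-++ (x ∷ u) v = trans (cong (len x ℕ.+_) (deg-++ u v)) (sym (ℕₚ.+-assoc (len x) _ _))

    gap-deg : ∀ {l p} → Valid l → p ∈ δ⁺≺ l → ∀ w → deg (proj₂ p ++ w) < deg (l ∷ w)
    gap-deg {l} {p} v i w with head-shape v i
    ... | x , _ , vx , _ , s =
      subst₂ _<_ (sym (deg-++ (proj₂ p) w))
        (trans (sym (ℕₚ.+-assoc (len x) _ _)) (cong (ℕ._+ deg w) s))
        (ℕₚ.m<n+m _ (len-pos vx))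

    gap-valid : ∀ {l w p} → ValidWord (l ∷ w) → p ∈ δ⁺≺ l → ValidWord (proj₂ p ++ w)
    gap-valid (v ∷ vw) i with head-shape v i
    ... | _ , _ , _ , vJ , _ = Allₚ.++⁺ vJ vw

    Σ-mult : ∀ xs ys (F : List L × List L → Carrier) →
             Σ[ mult xs ys ] F ≈ Σ[ xs ] (λ p → Σ[ ys ] (λ q → F (proj₁ p ++ proj₁ q , proj₂ p ++ proj₂ q)))
    Σ-mult xs ys F = F.trans (Σ-concatMap _ xs F) (Σ-cong xs λ _ → reflexive (Σ-map _ ys F))

    -- The left counit law passes from letters to words because `e` is multiplicative for
    -- concatenation.
    Σ-Δ-counit : ∀ w → ValidWord w → (f : Form) → Σ[ Δ w ] (λ p → e (proj₁ p) * f (proj₂ p)) ≈ f w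
    Σ-Δ-counit []      _        f = F.trans (+-identityʳ _) (*-identityˡ _)
    Σ-Δ-counit (l ∷ w) (v ∷ vw) f = begin
      Σ[ mult (δ l) (Δ w) ] (λ p → e (proj₁ p) * f (proj₂ p))
        ≈⟨ Σ-mult (δ l) (Δ w) _ ⟩
      Σ[ δ l ] (λ p → Σ[ Δ w ] (λ q → e (proj₁ p ++ proj₁ q) * f (proj₂ p ++ proj₂ q)))
        ≈⟨ (Σ-cong (δ l) λ {p} _ → F.trans
             (Σ-cong (Δ w) λ {q} _ → F.trans (*-congʳ (e-++ (proj₁ p) (proj₁ q))) (*-assoc _ _ _))
             (F.trans (Σ-*ˡ (Δ w) _ (e (proj₁ p))) (*-congˡ (Σ-Δ-counit w vw (λ u → f (proj₂ p ++ u)))))) ⟩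
      Σ[ δ l ] (λ p → e (proj₁ p) * f (proj₂ p ++ w))
        ≈⟨ counit v (λ u → f (u ++ w)) ⟩
      f (l ∷ w) ∎

    Δ-left-valid : ∀ w {q} → ValidWord w → q ∈ Δ w → ValidWord (proj₁ q)
    Δ-left-valid []      _        (here refl) = []
    Δ-left-valid (l ∷ w) (v ∷ vw) i with ∈-concatMap⁻ _ (δ l) i
    ... | p , j , k with ∈-map⁻ _ k
    ...   | q , m , refl = Allₚ.++⁺ (left-valid v j) (Δ-left-valid w vw m)

    module _ {κ : Form} (inf : Inf κ) where

      -- Vanishing on products is rewritten as a factor `e u`. With `u` a left factor of `Δ w`, this
      -- is a left counit and collapses the sum over `Δ w` to its term `𝟏 ⊗ w`.
      Inf-∷ : ∀ x u → ValidWord (x ∷ u) → κ (x ∷ u) ≈ κ (x ∷ []) * e u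
      Inf-∷ x []      v = F.sym (*-identityʳ _)
      Inf-∷ x (y ∷ u) v = F.trans (at-proper inf x y u v) (F.sym (zeroʳ _))

      Σ-Δ⁺≺ : ∀ l w → ValidWord (l ∷ w) → (h : Form) →
              Σ[ Δ⁺≺ (l ∷ w) ] (λ p → κ (proj₁ p) * h (proj₂ p)) ≈ (κ ⊛ h) (l ∷ w)
      Σ-Δ⁺≺ l w (v ∷ vw) h = F.trans (Σ-mult (δ⁺≺ l) (Δ w) _) (Σ-cong (δ⁺≺ l) term)
        where
        term : ∀ {p} → p ∈ δ⁺≺ l → Σ[ Δ w ] (λ q → κ (proj₁ p ++ proj₁ q) * h (proj₂ p ++ proj₂ q))
                                   ≈ κ (proj₁ p) * h (proj₂ p ++ w)
        term {p} i with head-shape v i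
        ... | x , refl , vx , _ , _ = begin
          Σ[ Δ w ] (λ q → κ (x ∷ proj₁ q) * h (proj₂ p ++ proj₂ q))
            ≈⟨ (Σ-cong (Δ w) λ {q} j → F.trans (*-congʳ (Inf-∷ x (proj₁ q) (vx ∷ Δ-left-valid w vw j))) (*-assoc _ _ _)) ⟩
          Σ[ Δ w ] (λ q → κ (x ∷ []) * (e (proj₁ q) * h (proj₂ p ++ proj₂ q)))
            ≈⟨ Σ-*ˡ (Δ w) _ _ ⟩
          κ (x ∷ []) * Σ[ Δ w ] (λ q → e (proj₁ q) * h (proj₂ p ++ proj₂ q))
            ≈⟨ *-congˡ (Σ-Δ-counit w vw (λ u → h (proj₂ p ++ u))) ⟩
          κ (x ∷ []) * h (proj₂ p ++ w) ∎

      ⊛-e : ∀ l w → ValidWord (l ∷ w) → (κ ⊛ e) (l ∷ w) ≈ κ (l ∷ w)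
      ⊛-e l w v@(vl ∷ _) = begin
        Σ[ δ⁺≺ l ] (λ p → κ (proj₁ p) * e (proj₂ p ++ w))
          ≈⟨ (Σ-cong (δ⁺≺ l) λ {p} _ → F.trans (*-congˡ (e-++ (proj₂ p) w)) (F.sym (*-assoc _ _ _))) ⟩
        Σ[ δ⁺≺ l ] (λ p → κ (proj₁ p) * e (proj₂ p) * e w)
          ≈⟨ Σ-*ʳ (δ⁺≺ l) _ (e w) ⟩
        Σ[ δ⁺≺ l ] (λ p → κ (proj₁ p) * e (proj₂ p)) * e w
          ≈⟨ *-congʳ (counit-head vl κ) ⟩
        κ (l ∷ []) * e w
          ≈⟨ Inf-∷ l w v ⟨
        κ (l ∷ w) ∎

      bar-Inf : ∀ w → bar κ w ≈ κ w
      bar-Inf w = F.trans (+-congˡ (-‿cong (F.trans (*-congʳ (at-𝟏 inf)) (zeroˡ _)))) (x-0≈x _)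

      -- By `⊛-e`, removing the part `g [] * e` from `g` costs `g [] * κ`, which is exactly what the
      -- unital extension of `≺` adds back.
      ⊛-bar : ∀ g l w → ValidWord (l ∷ w) → (κ ⊛ bar g) (l ∷ w) ≈ (κ ⊛ g) (l ∷ w) - g [] * κ (l ∷ w)
      ⊛-bar g l w v = begin
        Σ[ δ⁺≺ l ] (λ p → κ (proj₁ p) * (g (proj₂ p ++ w) - g [] * e (proj₂ p ++ w)))
          ≈⟨ (Σ-cong (δ⁺≺ l) λ {p} _ → F.trans (distribˡ _ _ _) (+-congˡ (rearrange _ _ _))) ⟩
        Σ[ δ⁺≺ l ] (λ p → κ (proj₁ p) * g (proj₂ p ++ w) + - (g [] * (κ (proj₁ p) * e (proj₂ p ++ w))))
          ≈⟨ Σ-+ (δ⁺≺ l) _ _ ⟩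
        (κ ⊛ g) (l ∷ w) + Σ[ δ⁺≺ l ] (λ p → - (g [] * (κ (proj₁ p) * e (proj₂ p ++ w))))
          ≈⟨ +-congˡ (F.trans (Σ-neg (δ⁺≺ l) _) (-‿cong (F.trans (Σ-*ˡ (δ⁺≺ l) _ (g [])) (*-congˡ (⊛-e l w v))))) ⟩
        (κ ⊛ g) (l ∷ w) - g [] * κ (l ∷ w) ∎
        where
        rearrange : ∀ x y z → x * (- (y * z)) ≈ - (y * (x * z))
        rearrange x y z = F.trans (F.sym (Ringₚ.-‿distribʳ-* ring x (y * z)))
          (-‿cong (F.trans (F.sym (*-assoc x y z)) (F.trans (*-congʳ (*-comm x y)) (*-assoc y x z))))

      ≺⇒⊛ : ∀ g → (κ ≺ g) ≃ (κ ⊛ g)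
      ≺⇒⊛ g []      v = F.trans (+-identityˡ _) (F.trans (*-congˡ (F.trans (bar-Inf []) (at-𝟏 inf))) (zeroʳ _))
      ≺⇒⊛ g (l ∷ w) v = begin
        (Σ[ Δ⁺≺ (l ∷ w) ] (λ p → bar κ (proj₁ p) * bar g (proj₂ p)) - bar κ (l ∷ w) * bar g []) + g [] * bar κ (l ∷ w)
          -- `bar g` vanishes on `𝟏`, so the subtracted term `w ⊗ 𝟏` of the reduced half-coproduct
          -- contributes 0.
          ≈⟨ +-cong (+-cong (Σ-cong (Δ⁺≺ (l ∷ w)) λ {p} _ → *-congʳ (bar-Inf (proj₁ p))) (-‿cong (F.trans (*-congˡ bar-𝟏) (zeroʳ _)))) (*-congˡ (bar-Inf (l ∷ w))) ⟩
        (Σ[ Δ⁺≺ (l ∷ w) ] (λ p → κ (proj₁ p) * bar g (proj₂ p)) - 0#) + g [] * κ (l ∷ w)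
          ≈⟨ +-congʳ (F.trans (x-0≈x _) (F.trans (Σ-Δ⁺≺ l w v (bar g)) (⊛-bar g l w v))) ⟩
        ((κ ⊛ g) (l ∷ w) - g [] * κ (l ∷ w)) + g [] * κ (l ∷ w)
          ≈⟨ F.trans (+-assoc _ _ _) (F.trans (+-congˡ (-‿inverseˡ _)) (+-identityʳ _)) ⟩
        (κ ⊛ g) (l ∷ w) ∎
        where
        bar-𝟏 : bar g [] ≈ 0#
        bar-𝟏 = F.trans (+-congˡ (-‿cong (*-identityʳ _))) (-‿inverseʳ _)

    ⊛-congʳ : ∀ κ {g h} l w → ValidWord (l ∷ w) → g ≃ h → (κ ⊛ g) (l ∷ w) ≈ (κ ⊛ h) (l ∷ w)
    ⊛-congʳ κ l w v eq = Σ-cong (δ⁺≺ l) λ i → *-congˡ (eq _ (gap-valid v i))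

    record Fix (κ F : Form) : Set (a ⊔ ℓ) where
      field
        unit : F [] ≈ 1#
        step : ∀ l w → ValidWord (l ∷ w) → F (l ∷ w) ≈ (κ ⊛ F) (l ∷ w)
    open Fix

    module _ {κ : Form} (inf : Inf κ) where

      equation⇒Fix : ∀ {F} → F ≃ (e ⊕ (κ ≺ F)) → Fix κ F
      equation⇒Fix {F} h = record
        { unit = F.trans (h [] []) (F.trans (+-congˡ (≺⇒⊛ inf F [] [])) (+-identityʳ 1#))
        ; step = λ l w v → F.trans (h (l ∷ w) v) (F.trans (+-identityˡ _) (≺⇒⊛ inf F (l ∷ w) v))
        }

      Fix⇒equation : ∀ {F} → Fix κ F → F ≃ (e ⊕ (κ ≺ F))
      Fix⇒equation {F} fix []      v = F.trans (unit fix) (F.sym (F.trans (+-congˡ (≺⇒⊛ inf F [] [])) (+-identityʳ 1#)))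
      Fix⇒equation {F} fix (l ∷ w) v = F.trans (step fix l w v) (F.sym (F.trans (+-identityˡ _) (≺⇒⊛ inf F (l ∷ w) v)))

      -- Each factor `κ ≺` lowers the degree of the remaining word by at least one, so `n` factors
      -- need degree at least `n`.
      pow-vanishes : ∀ n w → ValidWord w → deg w < n → pow≺ κ n w ≈ 0#
      pow-vanishes (suc n) []      v p       = ≺⇒⊛ inf (pow≺ κ n) [] []
      pow-vanishes (suc n) (l ∷ w) v@(vl ∷ _) (s≤s p) = F.trans (≺⇒⊛ inf (pow≺ κ n) (l ∷ w) v)
        (Σ-zero (δ⁺≺ l) λ i → F.trans (*-congˡ (pow-vanishes n _ (gap-valid v i) (ℕₚ.<-≤-trans (gap-deg vl i w) p))) (zeroʳ _))

      -- `exp≺` truncates its sum according to the degree of the argument. Stability allows one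
      -- common bound for all right factors of a coproduct, as the exchange of sums in `exp-Fix`
      -- requires.
      exp-stable : ∀ {N} w → ValidWord w → deg w < N → Σ[ upTo N ] (λ n → pow≺ κ n w) ≈ exp≺ κ w
      exp-stable w v p = Σ-upTo-extend (λ n → pow≺ κ n w) p (λ n q → pow-vanishes n w v q)

      exp-Fix : Fix κ (exp≺ κ)
      exp-Fix .unit = +-identityʳ 1#
      exp-Fix .step l w v@(vl ∷ _) = begin
        Σ[ upTo (suc d) ] (λ n → pow≺ κ n (l ∷ w))            ≈⟨ Σ-upTo-suc d (λ n → pow≺ κ n (l ∷ w)) ⟩
        0# + Σ[ upTo d ] (λ n → (κ ≺ pow≺ κ n) (l ∷ w))       ≈⟨ +-identityˡ _ ⟩
        Σ[ upTo d ] (λ n → (κ ≺ pow≺ κ n) (l ∷ w))            ≈⟨ Σ-cong (upTo d) (λ {n} _ → ≺⇒⊛ inf (pow≺ κ n) (l ∷ w) v) ⟩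
        Σ[ upTo d ] (λ n → Σ[ δ⁺≺ l ] (λ p → κ (proj₁ p) * pow≺ κ n (proj₂ p ++ w)))
          ≈⟨ Σ-swap (upTo d) (δ⁺≺ l) _ ⟩
        Σ[ δ⁺≺ l ] (λ p → Σ[ upTo d ] (λ n → κ (proj₁ p) * pow≺ κ n (proj₂ p ++ w)))
          ≈⟨ (Σ-cong (δ⁺≺ l) λ i → F.trans (Σ-*ˡ (upTo d) _ _) (*-congˡ (exp-stable _ (gap-valid v i) (gap-deg vl i w)))) ⟩
        (κ ⊛ exp≺ κ) (l ∷ w) ∎
        where d = deg (l ∷ w)

    Fix-unique : ∀ {κ F G} → Fix κ F → Fix κ G → F ≃ G
    Fix-unique {κ} {F} {G} f g w v = go (suc (deg w)) w v ℕₚ.≤-refl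
      where
      go : ∀ n w → ValidWord w → deg w < n → F w ≈ G w
      go n       []      v p       = F.trans (unit f) (F.sym (unit g))
      go (suc n) (l ∷ w) v@(vl ∷ _) (s≤s p) = begin
        F (l ∷ w)         ≈⟨ step f l w v ⟩
        (κ ⊛ F) (l ∷ w)   ≈⟨ (Σ-cong (δ⁺≺ l) λ i → *-congˡ (go n _ (gap-valid v i) (ℕₚ.<-≤-trans (gap-deg vl i w) p))) ⟩
        (κ ⊛ G) (l ∷ w)   ≈⟨ step g l w v ⟨
        G (l ∷ w)         ∎

    Fix⇒exp : ∀ {κ F} → Inf κ → Fix κ F → F ≃ exp≺ κ
    Fix⇒exp inf fix = Fix-unique fix (exp-Fix inf)

    Multiplicative : Form → Set (a ⊔ ℓ)
    Multiplicative F = ∀ u v → ValidWord u → ValidWord v → F (u ++ v) ≈ F u * F v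

    -- In `κ ⊛ F` the tail of the word is appended uncut to the right factor `J`. By induction on
    -- the degree of the first word, `F (J ++ u ++ v)` splits off `F v`, a common factor of all
    -- terms.
    Fix⇒multiplicative : ∀ {κ F} → Fix κ F → Multiplicative F
    Fix⇒multiplicative {κ} {F} f u v vu vv = go (suc (deg u)) u vu ℕₚ.≤-refl
      where
      go : ∀ n u → ValidWord u → deg u < n → F (u ++ v) ≈ F u * F v
      go n       []      _  p = F.sym (F.trans (*-congʳ (unit f)) (*-identityˡ _))
      go (suc n) (l ∷ u) vu@(vl ∷ vu') (s≤s p) = begin
        F (l ∷ u ++ v)
          ≈⟨ step f l (u ++ v) (vl ∷ Allₚ.++⁺ vu' vv) ⟩
        Σ[ δ⁺≺ l ] (λ p → κ (proj₁ p) * F (proj₂ p ++ u ++ v))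
          ≈⟨ (Σ-cong (δ⁺≺ l) λ {p'} i → F.trans
               (*-congˡ (F.trans (reflexive (cong F (sym (Listₚ.++-assoc (proj₂ p') u v))))
                               (go n _ (gap-valid vu i) (ℕₚ.<-≤-trans (gap-deg vl i u) p))))
               (F.sym (*-assoc _ _ _))) ⟩
        Σ[ δ⁺≺ l ] (λ p → κ (proj₁ p) * F (proj₂ p ++ u) * F v)
          ≈⟨ Σ-*ʳ (δ⁺≺ l) _ (F v) ⟩
        (κ ⊛ F) (l ∷ u) * F v
          ≈⟨ *-congʳ (step f l u vu) ⟨
        F (l ∷ u) * F v ∎

    -- The half-logarithm: on a letter, κ(l) = F(l) − Σ κ(Q) F̄(J) with F̄ = F − e, which
    -- only involves κ on shorter letters because F̄ vanishes on the empty word.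

    reduced : Form → Form
    reduced F w = F w - e w

    onLetters : Form → Form
    onLetters f (l ∷ []) = f (l ∷ [])
    onLetters f _        = 0#

    log-approx : Form → ℕ → Form
    log-approx F zero    w = 0#
    log-approx F (suc n) = onLetters (λ w → F w - (log-approx F n ⊛ reduced F) w)

    log≺ : Form → Form
    log≺ F w = log-approx F (deg w) w

    Inf-log-approx : ∀ F n → Inf (log-approx F n)
    Inf-log-approx F zero    = record { at-𝟏 = F.refl ; at-proper = λ _ _ _ _ → F.refl }
    Inf-log-approx F (suc n) = record { at-𝟏 = F.refl ; at-proper = λ _ _ _ _ → F.refl }

    Inf-log : ∀ F → Inf (log≺ F)
    Inf-log F = record
      { at-𝟏      = F.refl
      ; at-proper = λ x y u v → at-proper (Inf-log-approx F (deg (x ∷ y ∷ u))) x y u v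
      }

    reduced-[] : ∀ F → F [] ≈ 1# → reduced F [] ≈ 0#
    reduced-[] F h = F.trans (+-congʳ h) (-‿inverseʳ 1#)

    -- `reduced F` kills the terms with empty right factor; in all others the left letter is
    -- strictly shorter than `l`. This makes the equation at `l` explicit in the value of `κ` there.
    ⊛-reduced-cong : ∀ F {κ κ'} → F [] ≈ 1# → ∀ l → Valid l →
                     (∀ x → Valid x → len x < len l → κ (x ∷ []) ≈ κ' (x ∷ [])) →
                     (κ ⊛ reduced F) (l ∷ []) ≈ (κ' ⊛ reduced F) (l ∷ [])
    ⊛-reduced-cong F {κ} {κ'} unitF l vl h = Σ-cong (δ⁺≺ l) term
      where
      term : ∀ {p} → p ∈ δ⁺≺ l → κ (proj₁ p) * reduced F (proj₂ p ++ []) ≈ κ' (proj₁ p) * reduced F (proj₂ p ++ [])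
      term {_ , []} i with head-shape vl i
      ... | x , refl , _ = F.trans (F.trans (*-congˡ (reduced-[] F unitF)) (zeroʳ _)) (F.sym (F.trans (*-congˡ (reduced-[] F unitF)) (zeroʳ _)))
      term {_ , y ∷ J} i with head-shape vl i
      ... | x , refl , vx , vy ∷ _ , s = *-congʳ (h x vx
        (subst (len x <_) s (ℕₚ.m<m+n (len x) (ℕₚ.<-≤-trans (len-pos vy) (ℕₚ.m≤m+n (len y) _)))))

    -- The index of `log-approx` is fuel for the recursion. Each unfolding passes to strictly
    -- shorter letters, so every amount not below the length gives the same value.
    log-approx-stable : ∀ F → F [] ≈ 1# → ∀ m n l → Valid l → len l ≤ m → len l ≤ n →
                        log-approx F m (l ∷ []) ≈ log-approx F n (l ∷ [])
    log-approx-stable F u zero    n       l v p q = ⊥-elim (ℕₚ.<-irrefl refl (ℕₚ.<-≤-trans (len-pos v) p))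
    log-approx-stable F u (suc m) zero    l v p q = ⊥-elim (ℕₚ.<-irrefl refl (ℕₚ.<-≤-trans (len-pos v) q))
    log-approx-stable F u (suc m) (suc n) l v p q =
      +-congˡ (-‿cong (⊛-reduced-cong F u l v λ x vx s →
        log-approx-stable F u m n x vx (ℕₚ.≤-pred (ℕₚ.<-≤-trans s p)) (ℕₚ.≤-pred (ℕₚ.<-≤-trans s q))))

    -- Writing `F` as `reduced F` plus `e` isolates the term `l ⊗ 𝟏`, where `κ` is evaluated at `l`
    -- itself.
    ⊛-reduced : ∀ F {κ} → Inf κ → ∀ l → Valid l → (κ ⊛ F) (l ∷ []) ≈ (κ ⊛ reduced F) (l ∷ []) + κ (l ∷ [])
    ⊛-reduced F {κ} inf l vl = begin
      Σ[ δ⁺≺ l ] (λ p → κ (proj₁ p) * F (proj₂ p ++ []))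
        ≈⟨ (Σ-cong (δ⁺≺ l) λ {p} _ → F.trans (*-congˡ (split (F (proj₂ p ++ [])) (e (proj₂ p ++ [])))) (distribˡ _ _ _)) ⟩
      Σ[ δ⁺≺ l ] (λ p → κ (proj₁ p) * reduced F (proj₂ p ++ []) + κ (proj₁ p) * e (proj₂ p ++ []))
        ≈⟨ Σ-+ (δ⁺≺ l) _ _ ⟩
      (κ ⊛ reduced F) (l ∷ []) + (κ ⊛ e) (l ∷ [])
        ≈⟨ +-congˡ (⊛-e inf l [] (vl ∷ [])) ⟩
      (κ ⊛ reduced F) (l ∷ []) + κ (l ∷ []) ∎
      where
      split : ∀ x y → x ≈ (x - y) + y
      split x y = F.sym (F.trans (+-assoc _ _ _) (F.trans (+-congˡ (-‿inverseˡ y)) (+-identityʳ x)))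

    log-step : ∀ {F} → F [] ≈ 1# → ∀ l → Valid l → F (l ∷ []) ≈ (log≺ F ⊛ F) (l ∷ [])
    log-step {F} u l vl = F.sym (begin
      (log≺ F ⊛ F) (l ∷ [])
        ≈⟨ ⊛-reduced F (Inf-log F) l vl ⟩
      (log≺ F ⊛ reduced F) (l ∷ []) + log≺ F (l ∷ [])
        -- `log≺` runs with fuel `deg (l ∷ [])`, that is `len l + 0`; fuel `suc (len l)` unfolds to
        -- the defining equation.
        ≈⟨ +-congˡ (log-approx-stable F u _ (suc (len l)) l vl (ℕₚ.≤-reflexive (sym (ℕₚ.+-identityʳ (len l)))) (ℕₚ.n≤1+n (len l))) ⟩
      (log≺ F ⊛ reduced F) (l ∷ []) + (F (l ∷ []) - (log-approx F (len l) ⊛ reduced F) (l ∷ []))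
        ≈⟨ +-congʳ (⊛-reduced-cong F u l vl λ x vx s →
             log-approx-stable F u _ (len l) x vx (ℕₚ.≤-reflexive (sym (ℕₚ.+-identityʳ (len x)))) (ℕₚ.<⇒≤ s)) ⟩
      (log-approx F (len l) ⊛ reduced F) (l ∷ []) + (F (l ∷ []) - (log-approx F (len l) ⊛ reduced F) (l ∷ []))
        ≈⟨ F.trans (+-comm _ _) (F.trans (+-assoc _ _ _) (F.trans (+-congˡ (-‿inverseˡ _)) (+-identityʳ _))) ⟩
      F (l ∷ []) ∎)

    -- `log-step` solves the equation on single letters. Multiplicativity carries it to words, both
    -- sides acquiring the factor `F w`.
    log-Fix : ∀ {F} → F [] ≈ 1# → Multiplicative F → Fix (log≺ F) F
    log-Fix u m .unit = u
    log-Fix {F} u m .step l w v@(vl ∷ vw) = begin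
      F (l ∷ w)                        ≈⟨ m (l ∷ []) w (vl ∷ []) vw ⟩
      F (l ∷ []) * F w                 ≈⟨ *-congʳ (log-step u l vl) ⟩
      (log≺ F ⊛ F) (l ∷ []) * F w      ≈⟨ Σ-*ʳ (δ⁺≺ l) _ (F w) ⟨
      Σ[ δ⁺≺ l ] (λ p → log≺ F (proj₁ p) * F (proj₂ p ++ []) * F w)
        ≈⟨ (Σ-cong (δ⁺≺ l) λ {p} i → F.trans (*-assoc _ _ _) (*-congˡ (F.trans
              (F.sym (m (proj₂ p ++ []) w (gap-valid (vl ∷ []) i) vw))
              (reflexive (cong (λ J → F (J ++ w)) (Listₚ.++-identityʳ (proj₂ p))))))) ⟩
      (log≺ F ⊛ F) (l ∷ w)             ∎

    -- Infinitesimal forms agree off the letters, where they vanish. On a letter, induction on its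
    -- length identifies the reduced parts of the two equations, and cancelling them leaves `κ` and
    -- `κ'`.
    Fix-injective : ∀ {F G κ κ'} → Inf κ → Inf κ' → F ≃ G → Fix κ F → Fix κ' G → κ ≃ κ'
    Fix-injective inf inf' F≃G f g []          _ = F.trans (at-𝟏 inf) (F.sym (at-𝟏 inf'))
    Fix-injective inf inf' F≃G f g (l ∷ y ∷ w) v = F.trans (at-proper inf l y w v) (F.sym (at-proper inf' l y w v))
    Fix-injective {F} {G} {κ} {κ'} inf inf' F≃G f g (l ∷ []) (vl ∷ _) = go (suc (len l)) l vl ℕₚ.≤-refl
      where
      go : ∀ n l → Valid l → len l < n → κ (l ∷ []) ≈ κ' (l ∷ [])
      go (suc n) l vl (s≤s p) = Ringₚ.+-cancelˡ ring _ _ _ (begin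
        (κ ⊛ reduced F) (l ∷ []) + κ (l ∷ [])    ≈⟨ ⊛-reduced F inf l vl ⟨
        (κ ⊛ F) (l ∷ [])                         ≈⟨ step f l [] (vl ∷ []) ⟨
        F (l ∷ [])                               ≈⟨ F≃G (l ∷ []) (vl ∷ []) ⟩
        G (l ∷ [])                               ≈⟨ step g l [] (vl ∷ []) ⟩
        (κ' ⊛ G) (l ∷ [])                        ≈⟨ ⊛-congʳ κ' l [] (vl ∷ []) (λ w v → F≃G w v) ⟨
        (κ' ⊛ F) (l ∷ [])                        ≈⟨ ⊛-reduced F inf' l vl ⟩
        (κ' ⊛ reduced F) (l ∷ []) + κ' (l ∷ [])  ≈⟨ +-congʳ (⊛-reduced-cong F (unit f) l vl λ x vx s → go n x vx (ℕₚ.<-≤-trans s p)) ⟨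
        (κ ⊛ reduced F) (l ∷ []) + κ' (l ∷ [])   ∎)

-- Constant masks

constant-mask : ∀ {x} {X : Set x} {b : Bool} m (xs : List X) → length m ≡ length xs →
                (∀ {y} → y ∈ zip m xs → proj₁ y ≡ b) → m ≡ map (λ _ → b) xs
constant-mask []      []       e h = refl
constant-mask (c ∷ m) (x ∷ xs) e h = cong₂ _∷_ (h (here refl)) (constant-mask m xs (ℕₚ.suc-injective e) (h ∘ there))

-- The two trivial decompositions, with all blocks in `Q` or all in `U`; they carry the counit
-- terms.
constant-Cut : ∀ b ls → Cut (map (λ _ → b) ls) ls
constant-Cut b ls = record
  { sizes       = Listₚ.length-map _ ls
  ; saturated   = λ i j _ → trans (const∈ i) (sym (const∈ j))
  ; unstraddled = λ p _ f t → case trans (sym f) (trans (const∈ (lookup p (here refl)))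
                    (trans (sym (const∈ (lookup p (there (here refl))))) t)) of λ ()
  }
  where
  const∈ : ∀ {z} → z ∈ zip (map (λ _ → b) ls) ls → proj₁ z ≡ b
  const∈ i with ∈-map⁻ (λ _ → b) (zip-∈₁ (map (λ _ → b) ls) ls i)
  ... | _ , _ , e = e

module _ {x} {X : Set x} where

  sel-all : ∀ (xs : List X) → sel (map (λ _ → true) xs) xs ≡ xs
  sel-all []       = refl
  sel-all (x ∷ xs) = cong (x ∷_) (sel-all xs)

  sel-none : ∀ (xs : List X) → sel (map (λ _ → false) xs) xs ≡ []
  sel-none []       = refl
  sel-none (x ∷ xs) = sel-none xs

  runs-all : ∀ (xs : List X) → runs (map (λ _ → true) xs) xs ≡ []
  runs-all xs = trans (runs≡gaps (map (λ _ → true) xs) xs) (go xs)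
    where
    go : ∀ (xs : List X) → gaps (zip (map (λ _ → true) xs) xs) ≡ []
    go []       = refl
    go (x ∷ xs) = go xs

  runs-none : ∀ (xs : List X) → runs (map (λ _ → false) xs) xs ≡ close xs
  runs-none xs = trans (runs≡gaps (map (λ _ → false) xs) xs)
    (trans (cong₂ (λ f r → close f ++ r) (first xs) (later xs)) (Listₚ.++-identityʳ (close xs)))
    where
    first : ∀ (xs : List X) → firstGap (zip (map (λ _ → false) xs) xs) ≡ xs
    first []       = refl
    first (x ∷ xs) = cong (x ∷_) (first xs)
    later : ∀ (xs : List X) → laterGaps (zip (map (λ _ → false) xs) xs) ≡ []
    later []       = refl
    later (x ∷ xs) = later xs

  sel-size : ∀ m (xs : List X) → length m ≡ length xs → length (sel m xs) ℕ.+ sum (map length (runs m xs)) ≡ length xs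
  sel-size m xs e =
    trans (cong₂ (λ s r → length s ℕ.+ sum (map length r)) (sel≡chosen m xs) (runs≡gaps m xs))
          (trans (gaps-size (zip m xs)) (length-zip m xs e))

  runs-nonempty : ∀ m (xs : List X) {r} → r ∈ runs m xs → T (not (null r))
  runs-nonempty m xs {r} i with r | gaps-nonempty (zip m xs) (subst (r ∈_) (runs≡gaps m xs) i)
  ... | _ ∷ _ | _ = tt

  runs-[]⇒all : ∀ m (xs : List X) → length m ≡ length xs → runs m xs ≡ [] → m ≡ map (λ _ → true) xs
  runs-[]⇒all m xs e h = constant-mask m xs e (gaps-none (zip m xs) (trans (sym (runs≡gaps m xs)) h))

  sel-[]⇒none : ∀ m (xs : List X) → length m ≡ length xs → sel m xs ≡ [] → m ≡ map (λ _ → false) xs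
  sel-[]⇒none m xs e h = constant-mask m xs e (chosen-none (zip m xs) (trans (sym (sel≡chosen m xs)) h))

-- The two half-unshuffle coproducts

allB-cong : ∀ {x} {X : Set x} {p q : X → Bool} xs → (∀ y → p y ≡ q y) → allB p xs ≡ allB q xs
allB-cong []       h = refl
allB-cong (y ∷ ys) h = cong₂ _∧_ (h y) (allB-cong ys h)

keep-cong : ∀ {x} {X : Set x} {p q : X → Bool} xs → (∀ y → p y ≡ q y) → keep p xs ≡ keep q xs
keep-cong             []       h = refl
keep-cong {p = p} {q} (y ∷ ys) h with p y | q y | h y
... | true  | _ | refl = cong (y ∷_) (keep-cong ys h)
... | false | _ | refl = keep-cong ys h

module Instances {c ℓ a ℓa} (K : Field c ℓ) (A : KAlgebra K a ℓa) where
  open Setup K A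
  open Sums K A
  private
    module F = Field K
    open Field K using (_≈_; 0#; _*_)

  module _ {L : Set a} {δ⁺≺ δ : L → List (List L × List L)} {len : L → ℕ} where
    open Dendriform δ⁺≺ δ len using (Form; e)

    e-≢[] : ∀ {w} → w ≢ [] → e w ≈ 0#
    e-≢[] {[]}    h = ⊥-elim (h refl)
    e-≢[] {_ ∷ _} h = F.refl

    -- Only the mask selecting everything leaves no gap, so `e` on the right factor picks out one
    -- term. `P` and `R` are arbitrary so that plain words and decorated partitions are covered
    -- together.
    counit-masksʳ : ∀ {x} {X : Set x} {l : L} (xs : List X) {ms : List (List Bool)} (P R : List Bool → List L) →
                    Unique ms → (∀ {m} → m ∈ ms → length m ≡ length xs) → map (λ _ → true) xs ∈ ms →
                    (∀ m → R m ≡ [] → runs m xs ≡ []) →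
                    P (map (λ _ → true) xs) ≡ l ∷ [] → R (map (λ _ → true) xs) ≡ [] →
                    ∀ (f : Form) → Σ[ map (λ m → P m , R m) ms ] (λ p → f (proj₁ p) * e (proj₂ p)) ≈ f (l ∷ [])
    counit-masksʳ xs {ms} P R u sz all∈ r eP eR f =
      F.trans (F.reflexive (Σ-map (λ m → P m , R m) ms _))
        (F.trans (Σ-single _ u all∈ λ {m} i ne → F.trans (F.*-congˡ (e-≢[] (λ h → ne (runs-[]⇒all m xs (sz i) (r m h))))) (F.zeroʳ _))
          (F.trans (F.reflexive (cong₂ (λ p r → f p * e r) eP eR)) (F.*-identityʳ _)))

    counit-masksˡ : ∀ {x} {X : Set x} {l : L} (xs : List X) {ms : List (List Bool)} (P R : List Bool → List L) →
                    Unique ms → (∀ {m} → m ∈ ms → length m ≡ length xs) → map (λ _ → false) xs ∈ ms →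
                    (∀ m → P m ≡ [] → sel m xs ≡ []) →
                    P (map (λ _ → false) xs) ≡ [] → R (map (λ _ → false) xs) ≡ l ∷ [] →
                    ∀ (f : Form) → Σ[ map (λ m → P m , R m) ms ] (λ p → e (proj₁ p) * f (proj₂ p)) ≈ f (l ∷ [])
    counit-masksˡ xs {ms} P R u sz none∈ r eP eR f =
      F.trans (F.reflexive (Σ-map (λ m → P m , R m) ms _))
        (F.trans (Σ-single _ u none∈ λ {m} i ne → F.trans (F.*-congʳ (e-≢[] (λ h → ne (sel-[]⇒none m xs (sz i) (r m h))))) (F.zeroˡ _))
          (F.trans (F.reflexive (cong₂ (λ p r → e p * f r) eP eR)) (F.*-identityˡ _)))

  close-[] : ∀ {x} {X : Set x} (ys : List X) → close ys ≡ [] → ys ≡ []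
  close-[] [] _ = refl

  unshuffleT : Unshuffle δ⁺≺T δT length
  unshuffleT = record
    { Valid       = λ l → T (not (null l))
    ; len-pos     = λ { {_ ∷ _} _ → s≤s z≤n }
    ; head-shape  = shape
    ; left-valid  = left
    ; counit-head = head
    ; counit      = λ {l} v f → counit-masksˡ {δ⁺≺ = δ⁺≺T} {δT} {length} l (λ m → leftPart (sel m l)) (λ m → runs m l)
        (masks-unique (length l)) (∈-masks⁻ (length l))
        (subst (λ n → map (λ _ → false) l ∈ masks n) (Listₚ.length-map _ l) (∈-masks⁺ (map (λ _ → false) l)))
        (λ m → close-[] (sel m l)) (cong close (sel-none l)) (trans (runs-none l) (single v)) f
    }
    where
    single : ∀ {l : TLetter} → T (not (null l)) → close l ≡ l ∷ []
    single {_ ∷ _} _ = refl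

    deg-sum : ∀ w → TD.deg w ≡ sum (map length w)
    deg-sum []      = refl
    deg-sum (l ∷ w) = cong (length l ℕ.+_) (deg-sum w)

    shape : ∀ {l p} → T (not (null l)) → p ∈ δ⁺≺T l →
            ∃ λ x → proj₁ p ≡ x ∷ [] × T (not (null x))
              × All (λ l → T (not (null l))) (proj₂ p) × length x ℕ.+ TD.deg (proj₂ p) ≡ length l
    shape {x ∷ xs} v i with ∈-map⁻ (λ m → splitT (true ∷ m) (x ∷ xs)) i
    ... | m , j , refl = x ∷ sel m xs , refl , tt , All.tabulate (runs-nonempty (true ∷ m) (x ∷ xs)) ,
      trans (cong (length (x ∷ sel m xs) ℕ.+_) (deg-sum (runs (true ∷ m) (x ∷ xs))))
            (sel-size (true ∷ m) (x ∷ xs) (cong suc (∈-masks⁻ (length xs) j)))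

    left : ∀ {l p} → T (not (null l)) → p ∈ δT l → All (λ l → T (not (null l))) (proj₁ p)
    left {l} v i with ∈-map⁻ (λ m → splitT m l) i
    ... | m , _ , refl with sel m l
    ...   | []    = []
    ...   | _ ∷ _ = tt ∷ []

    head : ∀ {l} → T (not (null l)) → (f : TD.Form) →
           Σ[ δ⁺≺T l ] (λ p → f (proj₁ p) * TD.e (proj₂ p)) ≈ f (l ∷ [])
    head {x ∷ xs} v f =
      F.trans (F.reflexive (cong (λ ps → Σ[ ps ] (λ p → f (proj₁ p) * TD.e (proj₂ p))) (Listₚ.map-∘ (masks (length xs)))))
        (counit-masksʳ {δ⁺≺ = δ⁺≺T} {δT} {length} l (λ m → leftPart (sel m l)) (λ m → runs m l)
          (Uniqueₚ.map⁺ Listₚ.∷-injectiveʳ (masks-unique (length xs))) sized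
          (∈-map⁺ (true ∷_) (subst (λ n → map (λ _ → true) xs ∈ masks n) (Listₚ.length-map _ xs) (∈-masks⁺ (map (λ _ → true) xs))))
          (λ m h → h) (cong close (sel-all l)) (runs-all l) f)
      where
      l = x ∷ xs
      sized : ∀ {m} → m ∈ map (true ∷_) (masks (length xs)) → length m ≡ length l
      sized i with ∈-map⁻ (true ∷_) i
      ... | _ , j , refl = cong suc (∈-masks⁻ (length xs) j)

  -- Standardisation changes the labels only; the entries of the algebra are carried along.
  stAux-zip : ∀ seen xs → stAux seen xs ≡ zip (rgAux seen (labels xs)) (map proj₂ xs)
  stAux-zip seen []            = refl
  stAux-zip seen ((l , x) ∷ r) with idx l seen
  ... | just j  = cong (_ ∷_) (stAux-zip seen r)
  ... | nothing = cong (_ ∷_) (stAux-zip (seen ++ l ∷ []) r)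

  labels-st : ∀ xs → labels (st xs) ≡ rg (labels xs)
  labels-st xs = trans (cong labels (stAux-zip [] xs)) (map-proj₁-zip (rg (labels xs)) (map proj₂ xs)
    (trans (length-rg (labels xs)) (trans (Listₚ.length-map proj₁ xs) (sym (Listₚ.length-map proj₂ xs)))))

  length-st : ∀ xs → length (st xs) ≡ length xs
  length-st xs = begin
    length (st xs)           ≡⟨ sym (Listₚ.length-map proj₁ (st xs)) ⟩
    length (labels (st xs))  ≡⟨ cong length (labels-st xs) ⟩
    length (rg (labels xs))  ≡⟨ length-rg (labels xs) ⟩
    length (labels xs)       ≡⟨ Listₚ.length-map proj₁ xs ⟩
    length xs                ∎
    where open ≡-Reasoning

  st-RGS : ∀ xs → T (isRGS (labels xs)) → st xs ≡ xs
  st-RGS xs t = trans (stAux-zip [] xs) (trans (cong (λ l → zip l (map proj₂ xs)) (RGS⇒rg (labels xs) t)) (go xs))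
    where
    go : ∀ (xs : NCLetter) → zip (map proj₁ xs) (map proj₂ xs) ≡ xs
    go []       = refl
    go (x ∷ xs) = cong (x ∷_) (go xs)

  LabelsNC : NCLetter → Set
  LabelsNC xs = IsNC (length (labels xs)) (labels xs)

  LabelsNC⇒NonX : ∀ xs → LabelsNC xs → NonX proj₁ xs
  LabelsNC⇒NonX xs v = nonCrossing⇒NonX proj₁ xs (noncrossing v)

  valid⇒NC : ∀ xs → T (validNC xs) → LabelsNC xs
  valid⇒NC xs v with T∧⁻ {isRGS (labels xs)} (proj₂ (T∧⁻ {not (null xs)} v))
  ... | r , nc = isNC refl r nc

  NC⇒valid : ∀ xs → T (not (null xs)) → LabelsNC xs → T (validNC xs)
  NC⇒valid xs n v = T∧⁺ n (T∧⁺ (rgs v) (noncrossing v))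

  st-valid : ∀ xs → T (not (null xs)) → NonX proj₁ xs → T (validNC (st xs))
  st-valid (x ∷ xs) _ h = NC⇒valid (st (x ∷ xs)) tt (isNC refl
    (subst (T ∘ isRGS) (sym (labels-st (x ∷ xs))) (rg-RGS (labels (x ∷ xs))))
    (subst (T ∘ nonCrossing) (sym (labels-st (x ∷ xs))) (rg-NonX proj₁ (x ∷ xs) h)))

  inQ≡colour : ∀ q bs l → inQ q bs l ≡ colour (zip q bs) l
  inQ≡colour []      bs        l = refl
  inQ≡colour (b ∷ q) []        l = refl
  inQ≡colour (b ∷ q) (l' ∷ bs) l = cong (λ c → if l ≡ᵇ l' then b else c) (inQ≡colour q bs l)

  admissible≡ : ∀ xs q → admissible xs q ≡
                admissibleColouring (length (labels xs)) (labels xs) (colour (zip q (dedup (labels xs))))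
  admissible≡ xs q = trans
    (allB-cong bs λ b → allB-cong bs λ c → cong₂ (λ u v → not (u ∧ not v ∧ nested (length xs) (labels xs) b c))
      (inQ≡colour q bs b) (inQ≡colour q bs c))
    (cong (λ n → admissibleColouring n (labels xs) (colour (zip q bs))) (sym (Listₚ.length-map proj₁ xs)))
    where bs = dedup (labels xs)

  admMasks≡ : ∀ xs → admMasks xs ≡ blockColourings (labels xs)
  admMasks≡ xs = keep-cong (masks (length (dedup (labels xs)))) (admissible≡ xs)

  posMask≡ : ∀ xs q → posMask q xs ≡ positionMask (labels xs) q
  posMask≡ xs q = trans (Listₚ.map-cong (λ p → inQ≡colour q (blocksOf xs) (proj₁ p)) xs) (Listₚ.map-∘ xs)

  splitBy : NCLetter → List Bool → NCWord × NCWord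
  splitBy xs m = leftPart (st (sel m xs)) , map st (runs m xs)

  -- Reindexes the coproduct by position masks instead of block masks.
  δNC≡ : ∀ xs → δNC xs ≡ map (splitBy xs) (cuts (labels xs))
  δNC≡ xs = trans (Listₚ.map-cong (λ q → cong (splitBy xs) (posMask≡ xs q)) (admMasks xs))
    (trans (Listₚ.map-∘ (admMasks xs)) (cong (map (splitBy xs) ∘ map (positionMask (labels xs))) (admMasks≡ xs)))

  δ⁺≺NC≡ : ∀ xs → δ⁺≺NC xs ≡ map (splitBy xs) (cutsHead (labels xs))
  δ⁺≺NC≡ []              = refl
  δ⁺≺NC≡ xs@((l , x) ∷ r) = trans (Listₚ.map-cong (λ q → cong (splitBy xs) (posMask≡ xs q)) ms)
    (trans (Listₚ.map-∘ ms) (cong (map (splitBy xs) ∘ map (positionMask (labels xs)))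
      (trans (keep-cong (admMasks xs) (λ q → inQ≡colour q (blocksOf xs) l))
             (cong (keep (λ q → colour (zip q (dedup (labels xs))) l)) (admMasks≡ xs)))))
    where ms = keep (λ q → inQ q (blocksOf xs) l) (admMasks xs)

  cutsHead-Cut : ∀ xs {m} → LabelsNC xs → m ∈ cutsHead (labels xs) → Cut m (labels xs) × ∃ λ m' → m ≡ true ∷ m'
  cutsHead-Cut xs v i = cutsHead⁻ v i

  cut-size : ∀ xs {m} → Cut m (labels xs) → length m ≡ length xs
  cut-size xs c = trans (sizes c) (Listₚ.length-map proj₁ xs)

  labels-const : ∀ (b : Bool) (xs : NCLetter) → map (λ _ → b) (labels xs) ≡ map (λ _ → b) xs
  labels-const b xs = sym (Listₚ.map-∘ xs)

  leftPart-st-[] : ∀ ys → leftPart (st ys) ≡ [] → ys ≡ []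
  leftPart-st-[] []       _ = refl

  unshuffleNC : Unshuffle δ⁺≺NC δNC length
  unshuffleNC = record
    { Valid       = λ l → T (validNC l)
    ; len-pos     = λ { {_ ∷ _} _ → s≤s z≤n }
    ; head-shape  = λ {l} → shape l
    ; left-valid  = λ {l} → left l
    ; counit-head = λ {l} v → head l v
    ; counit      = λ {l} v → counit' l v
    }
    where
    runs-valid : ∀ {xs} m → NonX proj₁ xs → All (λ l → T (validNC l)) (map st (runs m xs))
    runs-valid {xs} m nx = Allₚ.map⁺ (All.tabulate λ {r} i → st-valid r (runs-nonempty m xs i) (NonX-⊆ (runs-⊆ m xs i) nx))

    deg-sum : ∀ rs → NCD.deg (map st rs) ≡ sum (map length rs)
    deg-sum []       = refl
    deg-sum (r ∷ rs) = cong₂ ℕ._+_ (length-st r) (deg-sum rs)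

    shape : ∀ l {p} → T (validNC l) → p ∈ δ⁺≺NC l →
            ∃ λ x → proj₁ p ≡ x ∷ [] × T (validNC x) × All (λ l → T (validNC l)) (proj₂ p)
              × length x ℕ.+ NCD.deg (proj₂ p) ≡ length l
    shape xs@(x ∷ r) {p} v i with ∈-map⁻ (splitBy xs) (subst (p ∈_) (δ⁺≺NC≡ xs) i)
    ... | m , j , refl with cutsHead-Cut xs (valid⇒NC xs v) j
    ...   | c , m' , refl =
      st (sel m xs) , refl , st-valid (sel m xs) tt (NonX-⊆ (sel-⊆ m xs) nx) , runs-valid m nx ,
      trans (cong₂ ℕ._+_ (length-st (sel m xs)) (deg-sum (runs m xs))) (sel-size m xs (cut-size xs c))
      where nx = LabelsNC⇒NonX xs (valid⇒NC xs v)

    left : ∀ l {p} → T (validNC l) → p ∈ δNC l → All (λ l → T (validNC l)) (proj₁ p)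
    left xs {p} v i with ∈-map⁻ (splitBy xs) (subst (p ∈_) (δNC≡ xs) i)
    ... | m , _ , refl with sel m xs | NonX-⊆ (sel-⊆ m xs) (LabelsNC⇒NonX xs (valid⇒NC xs v))
    ...   | []     | _  = []
    ...   | y ∷ ys | nx = st-valid (y ∷ ys) tt nx ∷ []

    head : ∀ l → T (validNC l) → (f : NCD.Form) → Σ[ δ⁺≺NC l ] (λ p → f (proj₁ p) * NCD.e (proj₂ p)) ≈ f (l ∷ [])
    head xs@(x ∷ r) vl f =
      F.trans (F.reflexive (cong (λ ps → Σ[ ps ] (λ p → f (proj₁ p) * NCD.e (proj₂ p))) (δ⁺≺NC≡ xs)))
        (counit-masksʳ {δ⁺≺ = δ⁺≺NC} {δNC} {length} xs (λ m → leftPart (st (sel m xs))) (λ m → map st (runs m xs))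
          (cutsHead-unique (labels xs)) (λ i → cut-size xs (proj₁ (cutsHead-Cut xs v i)))
          (subst (_∈ cutsHead (labels xs)) (labels-const true xs) (∈-cuts⁺⁺ (constant-Cut true (labels xs))))
          (λ m h → map-[] (runs m xs) h)
          (trans (cong (leftPart ∘ st) (sel-all xs)) (cong (_∷ []) (st-RGS xs (rgs v))))
          (cong (map st) (runs-all xs)) f)
      where
      v = valid⇒NC xs vl
      map-[] : ∀ rs → map st rs ≡ [] → rs ≡ []
      map-[] [] _ = refl

    counit' : ∀ l → T (validNC l) → (f : NCD.Form) → Σ[ δNC l ] (λ p → NCD.e (proj₁ p) * f (proj₂ p)) ≈ f (l ∷ [])
    counit' xs@(x ∷ r) vl f =
      F.trans (F.reflexive (cong (λ ps → Σ[ ps ] (λ p → NCD.e (proj₁ p) * f (proj₂ p))) (δNC≡ xs)))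
        (counit-masksˡ {δ⁺≺ = δ⁺≺NC} {δNC} {length} xs (λ m → leftPart (st (sel m xs))) (λ m → map st (runs m xs))
          (cuts-unique (labels xs))
          (λ i → cut-size xs (∈-cuts⁻ (labels xs) (nonCrossing⇒pos (labels xs) (noncrossing v)) i))
          (subst (_∈ cuts (labels xs)) (labels-const false xs) (∈-cuts⁺ (constant-Cut false (labels xs))))
          (λ m h → leftPart-st-[] (sel m xs) h)
          (cong (leftPart ∘ st) (sel-none xs))
          (trans (cong (map st) (runs-none xs)) (cong (_∷ []) (st-RGS xs (rgs v)))) f)
      where v = valid⇒NC xs vl

-- Multilinearity

module _ {x} {X : Set x} where

  -- The surroundings are chosen before `y`, so that they are the same for all values of the varying
  -- entry, as linearity in that entry demands. `y₀` only fixes the length.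
  zip-slot : ∀ (m : List Bool) (ps : List X) {qs} (y₀ : X) → length m ≡ length (ps ++ y₀ ∷ qs) →
             ∃ λ zps → ∃ λ b → ∃ λ zqs → ∀ y → zip m (ps ++ y ∷ qs) ≡ zps ++ (b , y) ∷ zqs
  zip-slot (b ∷ m) []       {qs} y₀ e = [] , b , zip m qs , λ y → refl
  zip-slot (b ∷ m) (p ∷ ps) y₀ e with zip-slot m ps y₀ (ℕₚ.suc-injective e)
  ... | zps , c , zqs , h = (b , p) ∷ zps , c , zqs , λ y → cong ((b , p) ∷_) (h y)

  chosen-slot-false : ∀ zps zqs → ∃ λ ys → ∀ (y : X) → chosen (zps ++ (false , y) ∷ zqs) ≡ ys
  chosen-slot-false []                  zqs = chosen zqs , λ y → refl
  chosen-slot-false ((true  , z) ∷ zps) zqs with chosen-slot-false zps zqs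
  ... | ys , h = z ∷ ys , λ y → cong (z ∷_) (h y)
  chosen-slot-false ((false , z) ∷ zps) zqs = chosen-slot-false zps zqs

  chosen-slot-true : ∀ zps zqs → ∃ λ ps → ∃ λ qs → ∀ (y : X) → chosen (zps ++ (true , y) ∷ zqs) ≡ ps ++ y ∷ qs
  chosen-slot-true []                  zqs = [] , chosen zqs , λ y → refl
  chosen-slot-true ((true  , z) ∷ zps) zqs with chosen-slot-true zps zqs
  ... | ps , qs , h = z ∷ ps , qs , λ y → cong (z ∷_) (h y)
  chosen-slot-true ((false , z) ∷ zps) zqs = chosen-slot-true zps zqs

  gaps-slot-true : ∀ zps zqs → ∃ λ F → ∃ λ R → ∀ (y : X) →
                   firstGap (zps ++ (true , y) ∷ zqs) ≡ F × laterGaps (zps ++ (true , y) ∷ zqs) ≡ R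
  gaps-slot-true []                  zqs = [] , gaps zqs , λ y → refl , refl
  gaps-slot-true ((true  , z) ∷ zps) zqs with gaps-slot-true zps zqs
  ... | F , R , h = [] , close F ++ R , λ y → refl , cong₂ (λ f r → close f ++ r) (proj₁ (h y)) (proj₂ (h y))
  gaps-slot-true ((false , z) ∷ zps) zqs with gaps-slot-true zps zqs
  ... | F , R , h = z ∷ F , R , λ y → cong (z ∷_) (proj₁ (h y)) , proj₂ (h y)

  close-slot : ∀ ps (y : X) qs → close (ps ++ y ∷ qs) ≡ (ps ++ y ∷ qs) ∷ []
  close-slot []       y qs = refl
  close-slot (p ∷ ps) y qs = refl

  private
    InFirst InLater : List (Bool × X) → List (Bool × X) → Set x
    InFirst zps zqs = ∃ λ ps → ∃ λ qs → ∃ λ R → ∀ (y : X) →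
      firstGap (zps ++ (false , y) ∷ zqs) ≡ ps ++ y ∷ qs × laterGaps (zps ++ (false , y) ∷ zqs) ≡ R
    InLater zps zqs = ∃ λ F → ∃ λ pre → ∃ λ ps → ∃ λ qs → ∃ λ post → ∀ (y : X) →
      firstGap (zps ++ (false , y) ∷ zqs) ≡ F × laterGaps (zps ++ (false , y) ∷ zqs) ≡ pre ++ (ps ++ y ∷ qs) ∷ post

    slot-false : ∀ zps zqs → InFirst zps zqs ⊎ InLater zps zqs
    slot-false []                  zqs = inj₁ ([] , firstGap zqs , laterGaps zqs , λ y → refl , refl)
    slot-false ((true  , z) ∷ zps) zqs with slot-false zps zqs
    ... | inj₁ (ps , qs , R , h) = inj₂ ([] , [] , ps , qs , R ,
      λ y → refl , trans (cong₂ (λ f r → close f ++ r) (proj₁ (h y)) (proj₂ (h y))) (cong (_++ R) (close-slot ps y qs)))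
    ... | inj₂ (F , pre , ps , qs , post , h) = inj₂ ([] , close F ++ pre , ps , qs , post ,
      λ y → refl , trans (cong₂ (λ f r → close f ++ r) (proj₁ (h y)) (proj₂ (h y))) (sym (Listₚ.++-assoc (close F) pre _)))
    slot-false ((false , z) ∷ zps) zqs with slot-false zps zqs
    ... | inj₁ (ps , qs , R , h) = inj₁ (z ∷ ps , qs , R , λ y → cong (z ∷_) (proj₁ (h y)) , proj₂ (h y))
    ... | inj₂ (F , pre , ps , qs , post , h) =
      inj₂ (z ∷ F , pre , ps , qs , post , λ y → cong (z ∷_) (proj₁ (h y)) , proj₂ (h y))

  gaps-slot-false : ∀ zps zqs → ∃ λ pre → ∃ λ ps → ∃ λ qs → ∃ λ post → ∀ (y : X) →
                    gaps (zps ++ (false , y) ∷ zqs) ≡ pre ++ (ps ++ y ∷ qs) ∷ post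
  gaps-slot-false zps zqs with slot-false zps zqs
  ... | inj₁ (ps , qs , R , h) = [] , ps , qs , R ,
    λ y → trans (cong₂ (λ f r → close f ++ r) (proj₁ (h y)) (proj₂ (h y))) (cong (_++ R) (close-slot ps y qs))
  ... | inj₂ (F , pre , ps , qs , post , h) = close F ++ pre , ps , qs , post ,
    λ y → trans (cong₂ (λ f r → close f ++ r) (proj₁ (h y)) (proj₂ (h y))) (sym (Listₚ.++-assoc (close F) pre _))

  -- The varying entry lands either in the selected word or in a single gap, and all other pieces
  -- are constant. Hence each term of the coproduct is a product with just one factor depending on
  -- the entry.
  cut-slot : ∀ m ps (y₀ : X) qs → length m ≡ length (ps ++ y₀ ∷ qs) →
    (∃ λ ps' → ∃ λ qs' → ∃ λ G → ∀ y → sel m (ps ++ y ∷ qs) ≡ ps' ++ y ∷ qs' × runs m (ps ++ y ∷ qs) ≡ G)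
    ⊎ (∃ λ S → ∃ λ pre → ∃ λ ps' → ∃ λ qs' → ∃ λ post → ∀ y →
         sel m (ps ++ y ∷ qs) ≡ S × runs m (ps ++ y ∷ qs) ≡ pre ++ (ps' ++ y ∷ qs') ∷ post)
  cut-slot m ps y₀ qs e with zip-slot m ps y₀ e
  ... | zps , true , zqs , h with chosen-slot-true zps zqs | gaps-slot-true zps zqs
  ...   | ps' , qs' , hc | F , R , hg = inj₁ (ps' , qs' , close F ++ R , λ y →
      trans (sel≡chosen m (ps ++ y ∷ qs)) (trans (cong chosen (h y)) (hc y))
    , trans (runs≡gaps m (ps ++ y ∷ qs)) (trans (cong gaps (h y))
        (cong₂ (λ f r → close f ++ r) (proj₁ (hg y)) (proj₂ (hg y)))))
  cut-slot m ps y₀ qs e | zps , false , zqs , h with chosen-slot-false zps zqs | gaps-slot-false zps zqs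
  ...   | S , hc | pre , ps' , qs' , post , hg = inj₂ (S , pre , ps' , qs' , post , λ y →
      trans (sel≡chosen m (ps ++ y ∷ qs)) (trans (cong chosen (h y)) (hc y))
    , trans (runs≡gaps m (ps ++ y ∷ qs)) (trans (cong gaps (h y)) (hg y)))

module _ {x r} {X : Set x} (R : X → X → Set r) where

  Pointwise-sel : ∀ m {xs ys} → Pointwise R xs ys → Pointwise R (sel m xs) (sel m ys)
  Pointwise-sel []          []       = []
  Pointwise-sel []          (p ∷ ps) = []
  Pointwise-sel (true ∷ m)  []       = []
  Pointwise-sel (false ∷ m) []       = []
  Pointwise-sel (true ∷ m)  (p ∷ ps) = p ∷ Pointwise-sel m ps
  Pointwise-sel (false ∷ m) (p ∷ ps) = Pointwise-sel m ps

  Pointwise-close : ∀ {xs ys} → Pointwise R xs ys → Pointwise (Pointwise R) (close xs) (close ys)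
  Pointwise-close []       = []
  Pointwise-close (p ∷ ps) = (p ∷ ps) ∷ []

  Pointwise-runsAux : ∀ m {xs ys cur cur'} → Pointwise R xs ys → Pointwise R cur cur' →
                      Pointwise (Pointwise R) (runsAux (zip m xs) cur) (runsAux (zip m ys) cur')
  Pointwise-runsAux []          ps       c = Pointwise-close c
  Pointwise-runsAux (b ∷ m)     []       c = Pointwise-close c
  Pointwise-runsAux (true ∷ m)  (p ∷ ps) c = Pointwise.++⁺ (Pointwise-close c) (Pointwise-runsAux m ps [])
  Pointwise-runsAux (false ∷ m) (p ∷ ps) c = Pointwise-runsAux m ps (Pointwise.++⁺ c (p ∷ []))

module Linearity {c ℓ a ℓa} (K : Field c ℓ) (A : KAlgebra K a ℓa) where
  open Setup K A
  open Sums K A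
  open Instances K A
  open KAlgebra A using (Carrierᴹ; _≈ᴹ_; _+ᴹ_; _*ₗ_; 0ᴹ)
  open FixedPoint unshuffleNC
  open Unshuffle unshuffleNC using (head-shape)
  private
    module F = Field K
    open Field K using (Carrier; _≈_; 0#; _*_; -_; setoid) renaming (_+_ to _+ᴷ_; _-_ to _-ᴷ_)
    module Rₚ = Ringₚ F.ring
  open SetoidReasoning setoid

  record IsLinear (h : Carrierᴹ → Carrier) : Set (c ⊔ a ⊔ ℓ) where
    constructor lin
    field
      +-hom : ∀ x y → h (x +ᴹ y) ≈ h x +ᴷ h y
      *-hom : ∀ r x → h (r *ₗ x) ≈ r * h x
  open IsLinear

  lin-cong : ∀ {h k} → (∀ z → h z ≈ k z) → IsLinear k → IsLinear h
  lin-cong e (lin p q) = lin (λ x y → F.trans (e _) (F.trans (p x y) (F.sym (F.+-cong (e x) (e y)))))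
                             (λ r x → F.trans (e _) (F.trans (q r x) (F.sym (F.*-congˡ (e x)))))

  lin-0 : IsLinear (λ _ → 0#)
  lin-0 = lin (λ _ _ → F.sym (F.+-identityˡ 0#)) (λ r _ → F.sym (F.zeroʳ r))

  lin-+ : ∀ {h k} → IsLinear h → IsLinear k → IsLinear (λ z → h z +ᴷ k z)
  lin-+ (lin p q) (lin p' q') =
    lin (λ x y → F.trans (F.+-cong (p x y) (p' x y)) (interchange _ _ _ _))
        (λ r x → F.trans (F.+-cong (q r x) (q' r x)) (F.sym (F.distribˡ r _ _)))
    where open import Algebra.Properties.CommutativeSemigroup F.+-commutativeSemigroup using (interchange)

  lin-neg : ∀ {h} → IsLinear h → IsLinear (λ z → - h z)
  lin-neg (lin p q) = lin (λ x y → F.trans (F.-‿cong (p x y)) (F.sym (Rₚ.-‿+-comm _ _)))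
                          (λ r x → F.trans (F.-‿cong (q r x)) (Rₚ.-‿distribʳ-* r _))

  lin-*ʳ : ∀ {h} s → IsLinear h → IsLinear (λ z → h z * s)
  lin-*ʳ s (lin p q) = lin (λ x y → F.trans (F.*-congʳ (p x y)) (F.distribʳ s _ _))
                           (λ r x → F.trans (F.*-congʳ (q r x)) (F.*-assoc r _ s))

  lin-*ˡ : ∀ {h} s → IsLinear h → IsLinear (λ z → s * h z)
  lin-*ˡ s l = lin-cong (λ _ → F.*-comm s _) (lin-*ʳ s l)

  lin-Σ : ∀ {y} {Y : Set y} (ys : List Y) {h : Y → Carrierᴹ → Carrier} →
          (∀ {i} → i ∈ ys → IsLinear (h i)) → IsLinear (λ z → Σ[ ys ] λ i → h i z)
  lin-Σ []       h = lin-0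
  lin-Σ (y ∷ ys) h = lin-+ (h (here refl)) (lin-Σ ys (h ∘ there))

  -- `IsLinearNC` recast as linearity of functions of one variable, which is closed under sums and
  -- scalar factors. Validity may be asked for all `z` at once because it depends on the labels only
  -- (`validNC-slot`).
  record LinearForm (f : NCD.Form) : Set (c ⊔ a ⊔ ℓ ⊔ ℓa) where
    field
      respects : ∀ w w' → ValidNC w → EntryEq w w' → f w ≈ f w'
      slots    : ∀ pre ps l qs post → (∀ z → ValidNC (slot pre ps l qs post z)) →
                 IsLinear (λ z → f (slot pre ps l qs post z))
  open LinearForm

  slot-labels : ∀ ps l qs (y z : Carrierᴹ) → labels (ps ++ (l , y) ∷ qs) ≡ labels (ps ++ (l , z) ∷ qs)
  slot-labels ps l qs y z = trans (Listₚ.map-++ proj₁ ps _) (sym (Listₚ.map-++ proj₁ ps _))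

  null-labels : ∀ (xs : NCLetter) → null (labels xs) ≡ null xs
  null-labels []       = refl
  null-labels (_ ∷ _) = refl

  validNC-labels : ∀ {xs ys} → labels xs ≡ labels ys → T (validNC xs) → T (validNC ys)
  validNC-labels {xs} {ys} e v =
    NC⇒valid ys (subst (T ∘ not) (trans (sym (null-labels xs)) (trans (cong null e) (null-labels ys)))
                  (proj₁ (T∧⁻ {not (null xs)} v)))
                (subst (λ l → IsNC (length l) l) e (valid⇒NC xs v))

  validNC-slot : ∀ pre ps l qs post {y} z → ValidNC (slot pre ps l qs post y) → ValidNC (slot pre ps l qs post z)
  validNC-slot []        ps l qs post z (v ∷ vs) = validNC-labels {ps ++ (l , _) ∷ qs} (slot-labels ps l qs _ z) v ∷ vs
  validNC-slot (x ∷ pre) ps l qs post z (v ∷ vs) = v ∷ validNC-slot pre ps l qs post z vs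

  to-linear : ∀ {f} → IsLinearNC f → LinearForm f
  to-linear L = record
    { respects = IsLinearNC.cong L
    ; slots    = λ pre ps l qs post v → lin (λ x y → IsLinearNC.additive L pre ps l qs post x y (v x))
                                            (λ r x → IsLinearNC.homogeneous L pre ps l qs post r x (v x))
    }

  from-linear : ∀ {f} → LinearForm f → IsLinearNC f
  from-linear L = record
    { cong        = respects L
    ; additive    = λ pre ps l qs post x y v → +-hom (slots L pre ps l qs post (λ z → validNC-slot pre ps l qs post z v)) x y
    ; homogeneous = λ pre ps l qs post r x v → *-hom (slots L pre ps l qs post (λ z → validNC-slot pre ps l qs post z v)) r x
    }

  EntryEq-labels : ∀ {xs ys : NCLetter} → Pointwise (λ p q → proj₁ p ≡ proj₁ q × proj₂ p ≈ᴹ proj₂ q) xs ys →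
                   labels xs ≡ labels ys
  EntryEq-labels []            = refl
  EntryEq-labels ((e , _) ∷ p) = cong₂ _∷_ e (EntryEq-labels p)

  EntryEq-valid : ∀ {w w'} → ValidNC w → EntryEq w w' → ValidNC w'
  EntryEq-valid []       []       = []
  EntryEq-valid {x ∷ _} (v ∷ vs) (e ∷ es) = validNC-labels {x} (EntryEq-labels e) v ∷ EntryEq-valid vs es

  linear-≃ : ∀ {f g} → f ≃ g → LinearForm g → LinearForm f
  linear-≃ e L = record
    { respects = λ w w' v q → F.trans (e w v) (F.trans (respects L w w' v q) (F.sym (e w' (EntryEq-valid v q))))
    ; slots    = λ pre ps l qs post v → lin-cong (λ z → e _ (v z)) (slots L pre ps l qs post v)
    }

  linear-e : LinearForm NCD.e
  linear-e = record
    { respects = λ { _ _ _ [] → F.refl ; _ _ _ (_ ∷ _) → F.refl }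
    ; slots    = λ { [] ps l qs post v → lin-0 ; (_ ∷ _) ps l qs post v → lin-0 }
    }

  linear-0 : LinearForm (λ _ → 0#)
  linear-0 = record { respects = λ _ _ _ _ → F.refl ; slots = λ _ _ _ _ _ _ → lin-0 }

  linear-- : ∀ {f g} → LinearForm f → LinearForm g → LinearForm (λ w → f w -ᴷ g w)
  linear-- L M = record
    { respects = λ w w' v q → F.+-cong (respects L w w' v q) (F.-‿cong (respects M w w' v q))
    ; slots    = λ pre ps l qs post v → lin-+ (slots L pre ps l qs post v) (lin-neg (slots M pre ps l qs post v))
    }

  linear-onLetters : ∀ {f} → LinearForm f → LinearForm (onLetters f)
  linear-onLetters {f} L = record { respects = resp ; slots = sl }
    where
    resp : ∀ w w' → ValidNC w → EntryEq w w' → onLetters f w ≈ onLetters f w'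
    resp _ _ v []            = F.refl
    resp _ _ v (p ∷ [])      = respects L _ _ v (p ∷ [])
    resp _ _ v (_ ∷ _ ∷ _)   = F.refl
    sl : ∀ pre ps l qs post → (∀ z → ValidNC (slot pre ps l qs post z)) →
         IsLinear (λ z → onLetters f (slot pre ps l qs post z))
    sl []          ps l qs []         v = slots L [] ps l qs [] v
    sl []          ps l qs (_ ∷ _)    v = lin-0
    sl (_ ∷ [])    ps l qs post       v = lin-0
    sl (_ ∷ _ ∷ _) ps l qs post       v = lin-0

  stAux-slot : ∀ seen ps l qs → ∃ λ ps' → ∃ λ l' → ∃ λ qs' → ∀ z →
               stAux seen (ps ++ (l , z) ∷ qs) ≡ ps' ++ (l' , z) ∷ qs'
  stAux-slot seen [] l qs with idx l seen
  ... | just j  = [] , j , stAux seen qs , λ z → refl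
  ... | nothing = [] , length seen , stAux (seen ++ l ∷ []) qs , λ z → refl
  stAux-slot seen ((k , x) ∷ ps) l qs with idx k seen
  ... | just j  = let ps' , l' , qs' , h = stAux-slot seen ps l qs in (j , x) ∷ ps' , l' , qs' , λ z → cong (_ ∷_) (h z)
  ... | nothing = let ps' , l' , qs' , h = stAux-slot (seen ++ k ∷ []) ps l qs in
                  (length seen , x) ∷ ps' , l' , qs' , λ z → cong (_ ∷_) (h z)

  EntryEq-stAux : ∀ seen {xs ys : NCLetter} → Pointwise (λ p q → proj₁ p ≡ proj₁ q × proj₂ p ≈ᴹ proj₂ q) xs ys →
                  Pointwise (λ p q → proj₁ p ≡ proj₁ q × proj₂ p ≈ᴹ proj₂ q) (stAux seen xs) (stAux seen ys)
  EntryEq-stAux seen [] = []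
  EntryEq-stAux seen (_∷_ {x = l , _} (refl , e) p) with idx l seen
  ... | just j  = (refl , e) ∷ EntryEq-stAux seen p
  ... | nothing = (refl , e) ∷ EntryEq-stAux (seen ++ l ∷ []) p

  EntryEq-map-st : ∀ {w w'} → EntryEq w w' → EntryEq (map st w) (map st w')
  EntryEq-map-st []       = []
  EntryEq-map-st (p ∷ ps) = EntryEq-stAux [] p ∷ EntryEq-map-st ps

  Σ-δ⁺≺NC : ∀ xs (G : NCWord × NCWord → Carrier) → Σ[ δ⁺≺NC xs ] G ≈ Σ[ cutsHead (labels xs) ] (λ m → G (splitBy xs m))
  Σ-δ⁺≺NC xs G = F.reflexive (trans (cong (λ ps → Σ[ ps ] G) (δ⁺≺NC≡ xs)) (Σ-map (splitBy xs) (cutsHead (labels xs)) G))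

  splitBy-∈ : ∀ xs {m} → m ∈ cutsHead (labels xs) → splitBy xs m ∈ δ⁺≺NC xs
  splitBy-∈ xs {m} i = subst (splitBy xs m ∈_) (sym (δ⁺≺NC≡ xs)) (∈-map⁺ (splitBy xs) i)

  left-valid⁺ : ∀ xs {m} → T (validNC xs) → m ∈ cutsHead (labels xs) → ValidNC (leftPart (st (sel m xs)))
  left-valid⁺ xs {m} v i with leftPart (st (sel m xs)) | head-shape {xs} v (splitBy-∈ xs i)
  ... | _ | _ , refl , vx , _ = vx ∷ []

  linear-⊛ : ∀ {κ g} → LinearForm κ → LinearForm g → LinearForm (κ ⊛ g)
  linear-⊛ {κ} {g} L M = record { respects = resp ; slots = sl }
    where
    resp : ∀ w w' → ValidNC w → EntryEq w w' → (κ ⊛ g) w ≈ (κ ⊛ g) w'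
    resp [] [] v [] = F.refl
    resp (x ∷ w) (y ∷ w') v@(vx ∷ vw) (p ∷ q) = begin
      Σ[ δ⁺≺NC x ] G w                                      ≈⟨ Σ-δ⁺≺NC x (G w) ⟩
      Σ[ cutsHead (labels x) ] (λ m → G w (splitBy x m))    ≈⟨ Σ-cong (cutsHead (labels x)) term ⟩
      Σ[ cutsHead (labels x) ] (λ m → G w' (splitBy y m))   ≡⟨ cong (λ ls → Σ[ cutsHead ls ] (λ m → G w' (splitBy y m))) (EntryEq-labels p) ⟩
      Σ[ cutsHead (labels y) ] (λ m → G w' (splitBy y m))   ≈⟨ Σ-δ⁺≺NC y (G w') ⟨
      Σ[ δ⁺≺NC y ] G w'                                     ∎
      where
      G : NCWord → NCWord × NCWord → Carrier
      G w p = κ (proj₁ p) * g (proj₂ p ++ w)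
      term : ∀ {m} → m ∈ cutsHead (labels x) → G w (splitBy x m) ≈ G w' (splitBy y m)
      term {m} i = F.*-cong
        (respects L _ _ (left-valid⁺ x vx i) (Pointwise-close _ (EntryEq-stAux [] (Pointwise-sel _ m p))))
        (respects M _ _ (gap-valid v (splitBy-∈ x i))
          (Pointwise.++⁺ (EntryEq-map-st (Pointwise-runsAux _ m p [])) q))

    sl : ∀ pre ps l qs post → (∀ z → ValidNC (slot pre ps l qs post z)) →
         IsLinear (λ z → (κ ⊛ g) (slot pre ps l qs post z))
    -- The varying letter lies in the uncut tail, so only `g` depends on the entry.
    sl (x ∷ pre) ps l qs post v = lin-Σ (δ⁺≺NC x) λ {p} i → lin-*ˡ (κ (proj₁ p))
      (lin-cong (λ z → F.reflexive (cong g (sym (Listₚ.++-assoc (proj₂ p) pre _))))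
        (slots M (proj₂ p ++ pre) ps l qs post λ z →
          subst ValidNC (sym (Listₚ.++-assoc (proj₂ p) pre _)) (gap-valid (v z) i)))
    -- The cuts depend on the labels alone, so their list can be frozen at the entry `0ᴹ` before
    -- linearity is checked term by term.
    sl [] ps l qs post v = lin-cong
      (λ z → F.trans (Σ-δ⁺≺NC (x z) (λ p → κ (proj₁ p) * g (proj₂ p ++ post)))
               (F.reflexive (cong (λ ls → Σ[ cutsHead ls ] (λ m → κ (proj₁ (splitBy (x z) m)) * g (proj₂ (splitBy (x z) m) ++ post)))
                 (slot-labels ps l qs z 0ᴹ))))
      (lin-Σ (cutsHead (labels (x 0ᴹ))) term)
      where
      x : Carrierᴹ → NCLetter
      x z = ps ++ (l , z) ∷ qs
      vx : ∀ z → T (validNC (x z))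
      vx z = All.head (v z)
      term : ∀ {m} → m ∈ cutsHead (labels (x 0ᴹ)) →
             IsLinear (λ z → κ (leftPart (st (sel m (x z)))) * g (map st (runs m (x z)) ++ post))
      term {m} i with cut-slot m ps (l , 0ᴹ) qs (cut-size (x 0ᴹ) (proj₁ (cutsHead-Cut (x 0ᴹ) (valid⇒NC (x 0ᴹ) (vx 0ᴹ)) i)))
      -- The entry is selected: `κ` depends on it and the gaps are constant. In the other case it
      -- lies in one gap and the factor `κ` is constant.
      ... | inj₁ (ps' , qs' , G , h) with stAux-slot [] ps' l qs'
      ...   | ps'' , l'' , qs'' , h' = lin-cong
        (λ z → F.*-cong (F.reflexive (cong κ (left z))) (F.reflexive (cong (λ r → g (map st r ++ post)) (proj₂ (h (l , z))))))
        (lin-*ʳ _ (slots L [] ps'' l'' qs'' [] λ z → subst ValidNC (left z) (left-valid⁺ (x z) (vx z) (cut∈ z))))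
        where
        cut∈ : ∀ z → m ∈ cutsHead (labels (x z))
        cut∈ z = subst (λ ls → m ∈ cutsHead ls) (slot-labels ps l qs 0ᴹ z) i
        left : ∀ z → leftPart (st (sel m (x z))) ≡ (ps'' ++ (l'' , z) ∷ qs'') ∷ []
        left z = trans (cong (leftPart ∘ st) (proj₁ (h (l , z)))) (trans (cong leftPart (h' z)) (close-slot ps'' (l'' , z) qs''))
      term {m} i | inj₂ (S , pre , ps' , qs' , post' , h) with stAux-slot [] ps' l qs'
      ...   | ps'' , l'' , qs'' , h' = lin-cong
        (λ z → F.*-cong (F.reflexive (cong (κ ∘ leftPart ∘ st) (proj₁ (h (l , z))))) (F.reflexive (cong g (right z))))
        (lin-*ˡ _ (slots M (map st pre) ps'' l'' qs'' (map st post' ++ post) λ z →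
          subst ValidNC (right z) (gap-valid (v z) (splitBy-∈ (x z) (cut∈ z)))))
        where
        cut∈ : ∀ z → m ∈ cutsHead (labels (x z))
        cut∈ z = subst (λ ls → m ∈ cutsHead ls) (slot-labels ps l qs 0ᴹ z) i
        right : ∀ z → map st (runs m (x z)) ++ post ≡ slot (map st pre) ps'' l'' qs'' (map st post' ++ post) z
        right z = trans (cong (λ r → map st r ++ post) (proj₂ (h (l , z))))
          (trans (cong (_++ post) (Listₚ.map-++ st pre _))
            (trans (Listₚ.++-assoc (map st pre) _ post)
              (cong (λ y → map st pre ++ y ∷ map st post' ++ post) (h' z))))

  deg-slot : ∀ pre ps l qs post y z → NCD.deg (slot pre ps l qs post y) ≡ NCD.deg (slot pre ps l qs post z)
  deg-slot []        ps l qs post y z =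
    cong (ℕ._+ NCD.deg post) (trans (Listₚ.length-++ ps) (sym (Listₚ.length-++ ps)))
  deg-slot (x ∷ pre) ps l qs post y z = cong (length x ℕ.+_) (deg-slot pre ps l qs post y z)

  deg-EntryEq : ∀ {w w'} → EntryEq w w' → NCD.deg w ≡ NCD.deg w'
  deg-EntryEq []       = refl
  deg-EntryEq (p ∷ ps) = cong₂ ℕ._+_ (Pointwise.Pointwise-length p) (deg-EntryEq ps)

  -- Meant for `log≺` and `exp≺`, whose recursion index or truncation is the degree of the argument.
  -- Varying an entry leaves the degree unchanged, so the index can be frozen.
  linear-graded : ∀ {f : ℕ → NCD.Form} → (∀ n → LinearForm (f n)) → LinearForm (λ w → f (NCD.deg w) w)
  linear-graded {f} L = record
    { respects = λ w w' v q → F.trans (respects (L (NCD.deg w)) w w' v q) (F.reflexive (cong (λ n → f n w') (deg-EntryEq q)))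
    ; slots    = λ pre ps l qs post v →
        lin-cong (λ z → F.reflexive (cong (λ n → f n (slot pre ps l qs post z)) (deg-slot pre ps l qs post z 0ᴹ)))
                 (slots (L (NCD.deg (slot pre ps l qs post 0ᴹ))) pre ps l qs post v)
    }

  linear-Σ : ∀ {y} {Y : Set y} (ys : List Y) {f : Y → NCD.Form} → (∀ i → LinearForm (f i)) →
             LinearForm (λ w → Σ[ ys ] λ i → f i w)
  linear-Σ ys L = record
    { respects = λ w w' v q → Σ-cong ys λ {i} _ → respects (L i) w w' v q
    ; slots    = λ pre ps l qs post v → lin-Σ ys λ {i} _ → slots (L i) pre ps l qs post v
    }

  linear-log : ∀ {Φ} → LinearForm Φ → LinearForm (log≺ Φ)
  linear-log {Φ} L = linear-graded go
    where
    go : ∀ n → LinearForm (log-approx Φ n)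
    go zero    = linear-0
    go (suc n) = linear-onLetters (linear-- L (linear-⊛ (go n) (linear-- L linear-e)))

  linear-exp : ∀ {κ} → Inf κ → LinearForm κ → LinearForm (NCD.exp≺ κ)
  linear-exp {κ} inf L = linear-graded λ d → linear-Σ (upTo (suc d)) go
    where
    go : ∀ n → LinearForm (NCD.pow≺ κ n)
    go zero    = linear-e
    go (suc n) = linear-≃ (≺⇒⊛ inf (NCD.pow≺ κ n)) (linear-⊛ L (go n))

-- The splitting map

module Splitting {c ℓ a ℓa} (K : Field c ℓ) (A : KAlgebra K a ℓa) where
  open Setup K A
  open Sums K A
  open Instances K A
  private
    module F = Field K
    open Field K using (Carrier; _≈_; 0#; _*_; setoid)
    module N = FixedPoint unshuffleNC
    module S = FixedPoint unshuffleT
  open SetoidReasoning setoid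

  choices≡ : ∀ w → choices w ≡ ncFamilies (map length w)
  choices≡ []      = refl
  choices≡ (l ∷ w) = cong (λ cs → concatMap (λ L → map (L ∷_) cs) (ncParts (length l))) (choices≡ w)

  Σ-Sp : ∀ w (f : NCD.Form) → Sp* f w ≈ Σ[ ncFamilies (map length w) ] (λ Ls → f (zipWith zip Ls w))
  Σ-Sp w f = F.reflexive (trans (Σ-map (λ Ls → zipWith zip Ls w) (choices w) f)
    (cong (λ cs → Σ[ cs ] (λ Ls → f (zipWith zip Ls w))) (choices≡ w)))

  Sp*-∷ : ∀ l w (f : NCD.Form) → Sp* f (l ∷ w) ≈ Σ[ ncParts (length l) ] (λ L → Sp* (λ u → f (zip L l ∷ u)) w)
  Sp*-∷ l w f = begin
    Sp* f (l ∷ w)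
      ≈⟨ Σ-Sp (l ∷ w) f ⟩
    Σ[ concatMap (λ L → map (L ∷_) cs) (ncParts (length l)) ] (λ Ls → f (zipWith zip Ls (l ∷ w)))
      ≈⟨ Σ-concatMap (λ L → map (L ∷_) cs) (ncParts (length l)) (λ Ls → f (zipWith zip Ls (l ∷ w))) ⟩
    Σ[ ncParts (length l) ] (λ L → Σ[ map (L ∷_) cs ] (λ Ls → f (zipWith zip Ls (l ∷ w))))
      ≈⟨ (Σ-cong (ncParts (length l)) λ {L} _ → F.trans (F.reflexive (Σ-map (L ∷_) cs (λ Ls → f (zipWith zip Ls (l ∷ w)))))
                                                   (F.sym (Σ-Sp w (λ u → f (zip L l ∷ u))))) ⟩
    Σ[ ncParts (length l) ] (λ L → Sp* (λ u → f (zip L l ∷ u)) w) ∎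
    where cs = ncFamilies (map length w)

  Sp*-cong : ∀ w {f g : NCD.Form} → (∀ {u} → u ∈ Sp w → f u ≈ g u) → Sp* f w ≈ Sp* g w
  Sp*-cong w = Σ-cong (Sp w)

  Sp*-++ : ∀ u w (f : NCD.Form) → Sp* f (u ++ w) ≈ Sp* (λ x → Sp* (λ y → f (x ++ y)) w) u
  Sp*-++ []      w f = F.sym (F.+-identityʳ _)
  Sp*-++ (l ∷ u) w f = begin
    Sp* f (l ∷ u ++ w)
      ≈⟨ Sp*-∷ l (u ++ w) f ⟩
    Σ[ ncParts (length l) ] (λ L → Sp* (λ x → f (zip L l ∷ x)) (u ++ w))
      ≈⟨ (Σ-cong (ncParts (length l)) λ {L} _ → Sp*-++ u w (λ x → f (zip L l ∷ x))) ⟩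
    Σ[ ncParts (length l) ] (λ L → Sp* (λ x → Sp* (λ y → f (zip L l ∷ x ++ y)) w) u)
      ≈⟨ Sp*-∷ l u (λ x → Sp* (λ y → f (x ++ y)) w) ⟨
    Sp* (λ x → Sp* (λ y → f (x ++ y)) w) (l ∷ u) ∎

  Sp*-letter : ∀ l (f : NCD.Form) → Sp* f (l ∷ []) ≈ Σ[ ncParts (length l) ] (λ L → f (zip L l ∷ []))
  Sp*-letter l f = F.trans (Sp*-∷ l [] f) (Σ-cong (ncParts (length l)) λ _ → F.+-identityʳ _)

  zip-valid : ∀ l {L} → T (not (null l)) → L ∈ ncParts (length l) → T (validNC (zip L l))
  zip-valid l@(x ∷ xs) {L} v i with ∈-ncParts⁻ (length l) i
  zip-valid l@(x ∷ xs) {k ∷ L} v i | nc = NC⇒valid (zip (k ∷ L) l) tt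
    (subst (λ ls → IsNC (length ls) ls) (sym (map-proj₁-zip (k ∷ L) l (size nc))) (isNC refl (rgs nc) (noncrossing nc)))

  Sp-valid : ∀ w → ValidT w → ∀ {u} → u ∈ Sp w → ValidNC u
  Sp-valid w v i with ∈-map⁻ (λ Ls → zipWith zip Ls w) i
  ... | Ls , j , refl = go w v (subst (Ls ∈_) (choices≡ w) j)
    where
    go : ∀ w → ValidT w → ∀ {Ls} → Ls ∈ ncFamilies (map length w) → ValidNC (zipWith zip Ls w)
    go w v {Ls} i with ∈-ncFamilies⁻ (map length w) i
    go []      []       _ | []     = []
    go (l ∷ w) (v ∷ vs) _ | p ∷ ps = zip-valid l v (∈-ncParts⁺ p) ∷ go w vs (∈-ncFamilies⁺ ps)

  sel-zip : ∀ m L (l : TLetter) → length L ≡ length l → st (sel m (zip L l)) ≡ zip (rg (sel m L)) (sel m l)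
  sel-zip m L l e = trans (stAux-zip [] (sel m (zip L l))) (cong₂ (λ x y → zip (rg x) y)
    (trans (sym (sel-map proj₁ m (zip L l))) (cong (sel m) (map-proj₁-zip L l e)))
    (trans (sym (sel-map proj₂ m (zip L l))) (cong (sel m) (map-proj₂-zip L l e))))

  runs-zip : ∀ m L (l : TLetter) → length L ≡ length l →
             map st (runs m (zip L l)) ≡ zipWith zip (map rg (runs m L)) (runs m l)
  runs-zip m L l e = trans (go (runs m (zip L l))) (cong₂ (λ x y → zipWith zip (map rg x) y)
    (trans (sym (runs-map proj₁ m (zip L l))) (cong (runs m) (map-proj₁-zip L l e)))
    (trans (sym (runs-map proj₂ m (zip L l))) (cong (runs m) (map-proj₂-zip L l e))))
    where
    go : ∀ (rs : List NCLetter) → map st rs ≡ zipWith zip (map rg (map (map proj₁) rs)) (map (map proj₂) rs)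
    go []       = refl
    go (r ∷ rs) = cong₂ _∷_ (stAux-zip [] r) (go rs)

  -- Splitting and then cutting a letter equals cutting it and then splitting both factors, tested
  -- against an arbitrary `G` of the two factors. The content is the permutation
  -- `headCuts↭headPieces`; the other steps flatten and regroup sums.
  Σ-cut-split : ∀ y (ys : TLetter) (G : NCWord → NCWord → Carrier) →
    Σ[ ncParts (length (y ∷ ys)) ] (λ L → Σ[ δ⁺≺NC (zip L (y ∷ ys)) ] (λ p → G (proj₁ p) (proj₂ p)))
    ≈ Σ[ δ⁺≺T (y ∷ ys) ] (λ p → Sp* (λ Q → Sp* (G Q) (proj₂ p)) (proj₁ p))
  Σ-cut-split y ys G = begin
    Σ[ ncParts n ] (λ L → Σ[ δ⁺≺NC (zip L l) ] (λ p → G (proj₁ p) (proj₂ p)))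
      ≈⟨ Σ-cong (ncParts n) cutL ⟩
    Σ[ ncParts n ] (λ L → Σ[ map (λ m → pieces m L) (cutsHead L) ] H)
      ≈⟨ Σ-concatMap (λ L → map (λ m → pieces m L) (cutsHead L)) (ncParts n) H ⟨
    Σ[ headCuts n ] H
      ≈⟨ Σ-↭ H (headCuts↭headPieces y ys) ⟩
    Σ[ headPieces y ys ] H
      ≈⟨ Σ-concatMap (λ m → concatMap (λ Q → map (λ J → m , Q , J) (ncFamilies (map length (runs m l)))) (ncParts (length (sel m l))))
           (map (true ∷_) (masks (length ys))) H ⟩
    Σ[ map (true ∷_) (masks (length ys)) ] (λ m → Σ[ concatMap (λ Q → map (λ J → m , Q , J) (ncFamilies (map length (runs m l)))) (ncParts (length (sel m l))) ] H)
      ≡⟨ Σ-map (true ∷_) (masks (length ys)) _ ⟩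
    Σ[ masks (length ys) ] (λ m → Σ[ concatMap (λ Q → map (λ J → true ∷ m , Q , J) (ncFamilies (map length (runs (true ∷ m) l)))) (ncParts (length (sel (true ∷ m) l))) ] H)
      ≈⟨ Σ-cong (masks (length ys)) (λ {m} _ → splitPieces m) ⟩
    Σ[ masks (length ys) ] (λ m → Sp* (λ Q → Sp* (G Q) (runs (true ∷ m) l)) (sel (true ∷ m) l ∷ []))
      ≡⟨ Σ-map (λ m → splitT (true ∷ m) l) (masks (length ys)) _ ⟨
    Σ[ δ⁺≺T l ] (λ p → Sp* (λ Q → Sp* (G Q) (proj₂ p)) (proj₁ p)) ∎
    where
    l = y ∷ ys
    n = length l

    -- Puts the letters of the word back on the pieces, so that a term depends on its triple alone
    -- and can be summed over either enumeration.
    H : Pieces → Carrier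
    H (m , Q , J) = G (zip Q (sel m l) ∷ []) (zipWith zip J (runs m l))

    cutL : ∀ {L} → L ∈ ncParts n →
           Σ[ δ⁺≺NC (zip L l) ] (λ p → G (proj₁ p) (proj₂ p)) ≈ Σ[ map (λ m → pieces m L) (cutsHead L) ] H
    cutL {L} i = begin
      Σ[ δ⁺≺NC (zip L l) ] (λ p → G (proj₁ p) (proj₂ p))
        ≡⟨ cong (λ ps → Σ[ ps ] (λ p → G (proj₁ p) (proj₂ p)))
             (trans (δ⁺≺NC≡ (zip L l)) (cong (map (splitBy (zip L l)) ∘ cutsHead) (map-proj₁-zip L l (size nc)))) ⟩
      Σ[ map (splitBy (zip L l)) (cutsHead L) ] (λ p → G (proj₁ p) (proj₂ p))
        ≡⟨ Σ-map (splitBy (zip L l)) (cutsHead L) _ ⟩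
      Σ[ cutsHead L ] (λ m → G (leftPart (st (sel m (zip L l)))) (map st (runs m (zip L l))))
        ≈⟨ (Σ-cong (cutsHead L) λ {m} j → F.reflexive (cong₂ G (left j) (runs-zip m L l (size nc)))) ⟩
      Σ[ cutsHead L ] (λ m → H (pieces m L))
        ≡⟨ Σ-map (λ m → pieces m L) (cutsHead L) H ⟨
      Σ[ map (λ m → pieces m L) (cutsHead L) ] H ∎
      where
      nc = ∈-ncParts⁻ n i
      left : ∀ {m} → m ∈ cutsHead L → leftPart (st (sel m (zip L l))) ≡ zip (rg (sel m L)) (sel m l) ∷ []
      left {m} j with cutsHead⁻ nc j
      left {m} j | _ , m' , refl = trans (single L (size nc)) (cong (_∷ []) (sel-zip m L l (size nc)))
        where
        single : ∀ L → length L ≡ n → leftPart (st (sel (true ∷ m') (zip L l))) ≡ st (sel (true ∷ m') (zip L l)) ∷ []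
        single (_ ∷ _) _ = refl

    splitPieces : ∀ m → Σ[ concatMap (λ Q → map (λ J → true ∷ m , Q , J) (ncFamilies (map length (runs (true ∷ m) l)))) (ncParts (length (sel (true ∷ m) l))) ] H
                        ≈ Sp* (λ Q → Sp* (G Q) (runs (true ∷ m) l)) (sel (true ∷ m) l ∷ [])
    splitPieces m = begin
      Σ[ concatMap (λ Q → map (λ J → true ∷ m , Q , J) Js) Qs ] H
        ≈⟨ Σ-concatMap (λ Q → map (λ J → true ∷ m , Q , J) Js) Qs H ⟩
      Σ[ Qs ] (λ Q → Σ[ map (λ J → true ∷ m , Q , J) Js ] H)
        ≈⟨ (Σ-cong Qs λ {Q} _ → F.trans (F.reflexive (Σ-map (λ J → true ∷ m , Q , J) Js H))
                                  (F.sym (Σ-Sp (runs (true ∷ m) l) (G (zip Q (sel (true ∷ m) l) ∷ []))))) ⟩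
      Σ[ Qs ] (λ Q → Sp* (G (zip Q (sel (true ∷ m) l) ∷ [])) (runs (true ∷ m) l))
        ≈⟨ Sp*-letter (sel (true ∷ m) l) (λ Q → Sp* (G Q) (runs (true ∷ m) l)) ⟨
      Sp* (λ Q → Sp* (G Q) (runs (true ∷ m) l)) (sel (true ∷ m) l ∷ []) ∎
      where
      Js = ncFamilies (map length (runs (true ∷ m) l))
      Qs = ncParts (length (sel (true ∷ m) l))

  -- `⊛` cuts the first letter only. The sum over the splittings of `w` can therefore be exchanged
  -- with the cuts and absorbed into the `G` of `Σ-cut-split`; afterwards the splittings of the gaps
  -- and of `w` recombine by `Sp*-++`.
  Sp*-⊛ : ∀ (κ Φ : NCD.Form) l w → ValidT (l ∷ w) → Sp* (κ N.⊛ Φ) (l ∷ w) ≈ (Sp* κ S.⊛ Sp* Φ) (l ∷ w)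
  Sp*-⊛ κ Φ [] w (() ∷ _)
  Sp*-⊛ κ Φ (y ∷ ys) w _ = begin
    Sp* (κ N.⊛ Φ) (l ∷ w)
      ≈⟨ Sp*-∷ l w (κ N.⊛ Φ) ⟩
    Σ[ ncParts n ] (λ L → Σ[ Sp w ] (λ x → Σ[ δ⁺≺NC (zip L l) ] (λ p → κ (proj₁ p) * Φ (proj₂ p ++ x))))
      ≈⟨ (Σ-cong (ncParts n) λ {L} _ → Σ-swap (Sp w) (δ⁺≺NC (zip L l)) _) ⟩
    Σ[ ncParts n ] (λ L → Σ[ δ⁺≺NC (zip L l) ] (λ p → Σ[ Sp w ] (λ x → κ (proj₁ p) * Φ (proj₂ p ++ x))))
      ≈⟨ Σ-cut-split y ys (λ Q J → Σ[ Sp w ] (λ x → κ Q * Φ (J ++ x))) ⟩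
    Σ[ δ⁺≺T l ] (λ p → Sp* (λ Q → Sp* (λ J → Σ[ Sp w ] (λ x → κ Q * Φ (J ++ x))) (proj₂ p)) (proj₁ p))
      ≈⟨ (Σ-cong (δ⁺≺T l) λ {p} _ → factor (proj₁ p) (proj₂ p)) ⟩
    Σ[ δ⁺≺T l ] (λ p → Sp* κ (proj₁ p) * Sp* Φ (proj₂ p ++ w)) ∎
    where
    l = y ∷ ys
    n = length l
    factor : ∀ q j → Sp* (λ Q → Sp* (λ J → Σ[ Sp w ] (λ x → κ Q * Φ (J ++ x))) j) q ≈ Sp* κ q * Sp* Φ (j ++ w)
    factor q j = begin
      Sp* (λ Q → Sp* (λ J → Σ[ Sp w ] (λ x → κ Q * Φ (J ++ x))) j) q
        ≈⟨ (Sp*-cong q λ {Q} _ → F.trans (Sp*-cong j λ {J} _ → Σ-*ˡ (Sp w) (λ x → Φ (J ++ x)) (κ Q))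
                                        (F.trans (Σ-*ˡ (Sp j) (λ J → Sp* (λ x → Φ (J ++ x)) w) (κ Q))
                                                 (F.*-congˡ (F.sym (Sp*-++ j w Φ))))) ⟩
      Sp* (λ Q → κ Q * Sp* Φ (j ++ w)) q
        ≈⟨ Σ-*ʳ (Sp q) κ (Sp* Φ (j ++ w)) ⟩
      Sp* κ q * Sp* Φ (j ++ w) ∎

  Sp*-Fix : ∀ {κ Φ} → N.Fix κ Φ → S.Fix (Sp* κ) (Sp* Φ)
  Sp*-Fix {κ} {Φ} f = record
    { unit = F.trans (F.+-identityʳ _) (N.Fix.unit f)
    ; step = λ l w v → F.trans (Sp*-cong (l ∷ w) (λ {u} i → step u (Sp-valid (l ∷ w) v i) (cons l w i))) (Sp*-⊛ κ Φ l w v)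
    }
    where
    cons : ∀ l w {u} → u ∈ Sp (l ∷ w) → u ≢ []
    cons l w i refl with ∈-map⁻ (λ Ls → zipWith zip Ls (l ∷ w)) i
    ... | Ls , j , e with ∈-ncFamilies⁻ (length l ∷ map length w) (subst (Ls ∈_) (choices≡ (l ∷ w)) j)
    cons l w i refl | _ , _ , () | _ ∷ _
    step : ∀ u → ValidNC u → u ≢ [] → Φ u ≈ (κ N.⊛ Φ) u
    step []      v h = ⊥-elim (h refl)
    step (x ∷ u) v h = N.Fix.step f x u v

  -- `Sp` keeps the number of letters of a bar word, so a proper product splits into proper
  -- products, on which `κ` vanishes.
  Sp*-Inf : ∀ {κ} → N.Inf κ → S.Inf (Sp* κ)
  Sp*-Inf {κ} inf = record
    { at-𝟏      = F.trans (F.+-identityʳ _) (N.Inf.at-𝟏 inf)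
    ; at-proper = λ x y w v → Σ-zero (Sp (x ∷ y ∷ w)) λ {u} i → proper u (Sp-valid (x ∷ y ∷ w) v i) (long x y w i)
    }
    where
    long : ∀ x y w {u} → u ∈ Sp (x ∷ y ∷ w) → 1 < length u
    long x y w i with ∈-map⁻ (λ Ls → zipWith zip Ls (x ∷ y ∷ w)) i
    ... | Ls , j , refl with ∈-ncFamilies⁻ (length x ∷ length y ∷ map length w) (subst (Ls ∈_) (choices≡ (x ∷ y ∷ w)) j)
    ...   | _ ∷ _ ∷ _ = s≤s (s≤s z≤n)
    proper : ∀ u → ValidNC u → 1 < length u → κ u ≈ 0#
    proper (_ ∷ [])    v (s≤s ())
    proper (x ∷ y ∷ u) v _ = N.Inf.at-proper inf x y u v

-- Characters and infinitesimal characters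

module Characters {c ℓ a ℓa} (K : Field c ℓ) (A : KAlgebra K a ℓa) where
  open Setup K A
  open Sums K A
  open Instances K A
  open Linearity K A
  open Splitting K A
  open FixedPoint unshuffleNC
  private
    module F = Field K
    module S = FixedPoint unshuffleT
    open Field K using (_≈_; _*_)

  Character⇒multiplicative : ∀ {Φ} → IsCharacter Φ → Multiplicative Φ
  Character⇒multiplicative {Φ} χ []      v       _  _  = F.sym (F.trans (F.*-congʳ (IsCharacter.unit χ)) (F.*-identityˡ _))
  Character⇒multiplicative {Φ} χ (x ∷ u) []      _  _  =
    F.trans (F.reflexive (cong Φ (Listₚ.++-identityʳ (x ∷ u))))
            (F.sym (F.trans (F.*-congˡ (IsCharacter.unit χ)) (F.*-identityʳ _)))
  Character⇒multiplicative     χ (x ∷ u) (y ∷ v) vu vv = IsCharacter.mult χ x u y v (Allₚ.++⁺ vu vv)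

  InfChar⇒Inf : ∀ {κ} → IsInfChar κ → Inf κ
  InfChar⇒Inf κ = record { at-𝟏 = IsInfChar.unit κ ; at-proper = λ x y u v → IsInfChar.mult κ x [] y u v }

  log-InfChar : ∀ {Φ} → IsCharacter Φ → IsInfChar (log≺ Φ)
  log-InfChar {Φ} χ = record
    { linear = from-linear (linear-log (to-linear (IsCharacter.linear χ)))
    ; unit   = F.refl
    ; mult   = mult
    }
    where
    mult : ∀ x u y v → ValidNC ((x ∷ u) ++ (y ∷ v)) → log≺ Φ ((x ∷ u) ++ (y ∷ v)) ≈ F.0#
    mult x []      y v w = Inf.at-proper (Inf-log Φ) x y v w
    mult x (z ∷ u) y v w = Inf.at-proper (Inf-log Φ) x z (u ++ y ∷ v) w

  exp-Character : ∀ {κ} → IsInfChar κ → IsCharacter (NCD.exp≺ κ)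
  exp-Character {κ} k = record
    { linear = from-linear (linear-exp inf (to-linear (IsInfChar.linear k)))
    ; unit   = Fix.unit fix
    ; mult   = λ x u y v w → Fix⇒multiplicative fix (x ∷ u) (y ∷ v)
                               (Allₚ.++⁻ˡ (x ∷ u) w) (Allₚ.++⁻ʳ (x ∷ u) w)
    }
    where
    inf = InfChar⇒Inf k
    fix = exp-Fix inf

  character⇒Fix : ∀ {Φ} → IsCharacter Φ → Fix (log≺ Φ) Φ
  character⇒Fix χ = log-Fix (IsCharacter.unit χ) (Character⇒multiplicative χ)

-- The bijection and its image under splitting

mainTheorem7 : ∀ {c ℓ a ℓa : Level} (K : Field c ℓ) → CharZero K → (A : KAlgebra K a ℓa) →
    let open Setup K A in
    (∀ Φ → IsCharacter Φ →
    Σ NCD.Form λ κ →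
    (IsInfChar κ × (Φ ≈NC (NCD.e NCD.⊕ (κ NCD.≺ Φ))) × (Φ ≈NC NCD.exp≺ κ))
    × (∀ κ' → IsInfChar κ' → (Φ ≈NC (NCD.e NCD.⊕ (κ' NCD.≺ Φ))) → (Φ ≈NC NCD.exp≺ κ') →
    κ' ≈NC κ))
    × (∀ κ → IsInfChar κ → IsCharacter (NCD.exp≺ κ))
    × (∀ κ κ' → IsInfChar κ → IsInfChar κ' → (NCD.exp≺ κ ≈NC NCD.exp≺ κ') → κ ≈NC κ')
    × (∀ Φ κ → IsCharacter Φ → IsInfChar κ →
    (Φ ≈NC (NCD.e NCD.⊕ (κ NCD.≺ Φ))) → (Φ ≈NC NCD.exp≺ κ) →
    (Sp* Φ ≈T (TD.e TD.⊕ (Sp* κ TD.≺ Sp* Φ))) × (Sp* Φ ≈T TD.exp≺ (Sp* κ)))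
mainTheorem7 K _ A = existence , (λ κ → exp-Character) , injectivity , splitting
  where
  open Setup K A
  open Sums K A
  open Instances K A
  open Splitting K A
  open Characters K A
  open FixedPoint unshuffleNC
  module S = FixedPoint unshuffleT

  existence : ∀ Φ → IsCharacter Φ → Σ NCD.Form λ κ →
    (IsInfChar κ × (Φ ≈NC (NCD.e NCD.⊕ (κ NCD.≺ Φ))) × (Φ ≈NC NCD.exp≺ κ))
    × (∀ κ' → IsInfChar κ' → (Φ ≈NC (NCD.e NCD.⊕ (κ' NCD.≺ Φ))) → (Φ ≈NC NCD.exp≺ κ') → κ' ≈NC κ)
  existence Φ χ = log≺ Φ ,
    (log-InfChar χ , Fix⇒equation (Inf-log Φ) fix , Fix⇒exp (Inf-log Φ) fix) ,
    λ κ' k' eq _ → Fix-injective (InfChar⇒Inf k') (Inf-log Φ) (λ _ _ → Field.refl K)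
                     (equation⇒Fix (InfChar⇒Inf k') eq) fix
    where fix = character⇒Fix χ

  injectivity : ∀ κ κ' → IsInfChar κ → IsInfChar κ' → (NCD.exp≺ κ ≈NC NCD.exp≺ κ') → κ ≈NC κ'
  injectivity κ κ' k k' eq =
    Fix-injective (InfChar⇒Inf k) (InfChar⇒Inf k') eq (exp-Fix (InfChar⇒Inf k)) (exp-Fix (InfChar⇒Inf k'))

  splitting : ∀ Φ κ → IsCharacter Φ → IsInfChar κ →
    (Φ ≈NC (NCD.e NCD.⊕ (κ NCD.≺ Φ))) → (Φ ≈NC NCD.exp≺ κ) →
    (Sp* Φ ≈T (TD.e TD.⊕ (Sp* κ TD.≺ Sp* Φ))) × (Sp* Φ ≈T TD.exp≺ (Sp* κ))
  splitting Φ κ χ k eq _ = S.Fix⇒equation inf fix , S.Fix⇒exp inf fix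
    where
    inf = Sp*-Inf (InfChar⇒Inf k)
    fix = Sp*-Fix (equation⇒Fix (InfChar⇒Inf k) eq)
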